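{- If $n\geq 9$, then $R(S_n(4,1),W_8)=2n-1$.
   Context: All graphs are finite and simple. For graphs $G,H$, $R(G,H)$ is the smallest $N$ such that every graph $F$ of order $N$ either contains $G$ as a subgraph or has complement $\overline{F}$ containing $H$. $W_8$ is the wheel of order 9 (a hub joined to every vertex of a cycle $C_8$). $S_k$ is the star of order $k$. $S_n(4,1)$ is the tree of order $n$ obtained from $S_{n-4}$ by subdividing each of four chosen edges once, i.e. a center adjacent to $n-9$ leaves together with four pendant paths of 2 edges each starting at the center. -}

module Defs where

open import Data.Nat using (ℕ; zero; suc; _+_; _∸_; _<_)
import Data.Nat
import Data.Bool
open import Data.Fin using (Fin; zero; suc; toℕ)
open import Data.Bool using (Bool; true; false; not)
open import Data.Product using (Σ; _×_; _,_)
open import Data.Sum using (_⊎_)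
open import Relation.Nullary using (¬_)
open import Relation.Binary.PropositionalEquality using (_≡_; _≢_)
open import Function.Definitions using (Injective)

record Graph (n : ℕ) : Set where
  field
    adj   : Fin n → Fin n → Bool
    adj-sym : ∀ u v → adj u v ≡ adj v u
    adj-irrefl : ∀ v → adj v v ≡ false
open Graph public

order : ∀ {n} → Graph n → ℕ
order {n} _ = n

_⊆ᴳ_ : ∀ {m n} → Graph m → Graph n → Set
_⊆ᴳ_ {m} {n} G F =
  Σ (Fin m → Fin n) λ f →
    Injective _≡_ _≡_ f × (∀ u v → adj G u v ≡ true → adj F (f u) (f v) ≡ true)

complement : ∀ {n} → Graph n → Graph n
complement {n} F = record { adj = a ; adj-sym = s ; adj-irrefl = i }
  where
  open import Data.Fin using (_≟_)
  open import Relation.Nullary using (yes; no)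
  open import Relation.Binary.PropositionalEquality using (refl; cong; sym)
  a : Fin n → Fin n → Bool
  a u v with u ≟ v
  ... | yes _ = false
  ... | no _ = not (adj F u v)
  s : ∀ u v → a u v ≡ a v u
  s u v with u ≟ v | v ≟ u
  ... | yes _ | yes _ = refl
  ... | yes p | no q = Data.Empty.⊥-elim (q (sym p))
    where import Data.Empty
  ... | no q | yes p = Data.Empty.⊥-elim (q (sym p))
    where import Data.Empty
  ... | no _ | no _ = cong not (adj-sym F u v)
  i : ∀ v → a v v ≡ false
  i v with v ≟ v
  ... | yes _ = refl
  ... | no q = Data.Empty.⊥-elim (q refl)
    where import Data.Empty

Arrows : ∀ {p q} → ℕ → Graph p → Graph q → Set
Arrows N G H = (F : Graph N) → (G ⊆ᴳ F) ⊎ (H ⊆ᴳ complement F)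

RamseyNumberIs : ∀ {p q} → Graph p → Graph q → ℕ → Set
RamseyNumberIs G H N = Arrows N G H × (∀ M → M < N → ¬ Arrows M G H)

-- Wheel W_8 on Fin 9: vertex 0 is the hub, vertices 1..8 form the cycle
-- 1-2-...-8-1.
wheelAdj : Fin 9 → Fin 9 → Bool
wheelAdj u v = W (toℕ u) (toℕ v)
  where
  open import Data.Nat using (_≡ᵇ_)
  open import Data.Bool using (_∨_; _∧_)
  cyc : ℕ → ℕ → Bool
  cyc a b = ((b ≡ᵇ suc a) ∧ (1 Data.Nat.≤ᵇ a)) ∨ ((a ≡ᵇ 1) ∧ (b ≡ᵇ 8))
  W : ℕ → ℕ → Bool
  W zero zero = false
  W zero (suc _) = true
  W (suc _) zero = true
  W a b = cyc a b ∨ cyc b a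

W₈ : Graph 9
W₈ = record { adj = wheelAdj ; adj-sym = s ; adj-irrefl = i }
  where
  open import Data.Fin.Properties using (all?)
  open import Relation.Nullary.Decidable using (toWitness)
  open import Relation.Binary.PropositionalEquality using (refl)
  open import Data.Bool.Properties using (_≟_)
  s : ∀ u v → wheelAdj u v ≡ wheelAdj v u
  s u v = toWitness {a? = all? λ u → all? λ v → wheelAdj u v ≟ wheelAdj v u} _ u v
  i : ∀ v → wheelAdj v v ≡ false
  i v = toWitness {a? = all? λ v → wheelAdj v v ≟ false} _ v

-- S_n(4,1) for n ≥ 9, on Fin n: vertex 0 is the center; vertices
-- 1,2,3,4 are adjacent to the center; vertex 4+i (i = 1..4) is adjacent
-- to vertex i; vertices 9,...,n-1 (n-9 of them) are leaves at the center.
-- vertex x+1 ∈ {1..4} is adjacent to vertex x+5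
spiderLeg : ℕ → ℕ → Bool
spiderLeg x y = (x Data.Nat.<ᵇ 4) Data.Bool.∧ (y Data.Nat.≡ᵇ (x + 4))
  where import Data.Bool

spiderAdjℕ : ℕ → ℕ → Bool
spiderAdjℕ zero zero = false
spiderAdjℕ zero (suc b) = edgeC b
  where
  edgeC : ℕ → Bool
  edgeC 0 = true
  edgeC 1 = true
  edgeC 2 = true
  edgeC 3 = true
  edgeC 4 = false
  edgeC 5 = false
  edgeC 6 = false
  edgeC 7 = false
  edgeC _ = true
spiderAdjℕ (suc a) zero = spiderAdjℕ zero (suc a)
spiderAdjℕ (suc a) (suc b) = spiderLeg a b Data.Bool.∨ spiderLeg b a

spiderAdj : ∀ {n} → Fin n → Fin n → Bool
spiderAdj u v = spiderAdjℕ (toℕ u) (toℕ v)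

spiderAdj-sym : ∀ a b → spiderAdjℕ a b ≡ spiderAdjℕ b a
spiderAdj-sym zero zero = Relation.Binary.PropositionalEquality.refl
  where import Relation.Binary.PropositionalEquality
spiderAdj-sym zero (suc b) = Relation.Binary.PropositionalEquality.refl
  where import Relation.Binary.PropositionalEquality
spiderAdj-sym (suc a) zero = Relation.Binary.PropositionalEquality.refl
  where import Relation.Binary.PropositionalEquality
spiderAdj-sym (suc a) (suc b) = Data.Bool.Properties.∨-comm (spiderLeg a b) (spiderLeg b a)
  where import Data.Bool.Properties

spiderAdj-irr : ∀ a → spiderAdjℕ a a ≡ false
spiderAdj-irr zero = Relation.Binary.PropositionalEquality.refl
  where import Relation.Binary.PropositionalEquality
spiderAdj-irr (suc a) = lemma a
  where
  open import Relation.Binary.PropositionalEquality using (refl)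
  open import Data.Nat using (_≡ᵇ_; _<ᵇ_)
  open import Data.Bool using (_∧_; _∨_)
  l : ∀ x → (x ≡ᵇ (x + 4)) ≡ false
  l zero = refl
  l (suc x) = l x
  lemma : ∀ x → spiderAdjℕ (suc x) (suc x) ≡ false
  lemma x with x <ᵇ 4
  ... | false = refl
  ... | true rewrite l x = refl

SpiderS : (n : ℕ) → Graph n
SpiderS n = record { adj = spiderAdj ; adj-sym = λ u v → spiderAdj-sym (toℕ u) (toℕ v)
                   ; adj-irrefl = λ v → spiderAdj-irr (toℕ v) }

{-# OPTIONS --safe #-}

-- Colour the edges of F red and those of its complement blue, let n = l + 9, so that there are 2n − 1 = l + l + 17 vertices, and suppose
-- that there is neither a red spider nor a blue wheel. Let c be a vertex of maximal red degree D.
--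
-- The favourable situation is a pair of sets P, Q completely joined in blue with four vertices in P and n in Q: as there is no
-- wheel, blue degrees inside Q are at most 3, and then augmenting paths produce a red spider inside Q.
--
-- Let D ≥ n − 5. There is no spider at c, so by König's theorem the red edges between A, a set of red neighbours of c, and the set C of
-- the other vertices are covered by at most three vertices, and what remains of A and of C is completely joined in blue. If
-- D ≥ n − 1, the König matching can be completed inside A to a spider. If D ≤ n − 2 and few covering vertices lie in C,
-- the pair P, Q is found, with c in P. Otherwise the König matching extends to a spider by augmenting paths inside A, unless the
-- vertices of A left over by a maximal matching are joined in blue to almost all of C, which again gives a pair P, Q.
--
-- Let D < n − 5, and let A be the blue neighbourhood of a vertex v. Call two vertices of A good if they have six common blue
-- neighbours in A. A cycle of four good pairs would give a wheel with hub v. The vertices of A that miss about a third of the vertices outside A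
-- have so many blue neighbours in A that no three of them are pairwise bad, hence R(C₄, K₃) = 7 leaves at most six of them. Any other
-- vertex of A has at most three blue neighbours of its own kind, hence is joined to all six, which gives a wheel with hub v.
--
-- For the lower bound, two disjoint red cliques of order at most n − 1 contain no spider, and their complement has no triangle.
module Submission where

open import Data.Bool using (Bool; true; false; not; _∧_; _∨_; T)
open import Data.Bool.Properties using (¬-not) renaming (_≟_ to _≟ᵇ_)
open import Data.Empty using (⊥; ⊥-elim)
open import Data.Fin using (Fin; zero; suc; toℕ; _≟_; fromℕ<)
open import Data.Fin.Properties using (any?; toℕ-injective; toℕ<n; all?; injective⇒≤; fromℕ<-injective)
open import Data.List using (List; []; _∷_; length; map; _++_; lookup)
open import Data.List.Properties using (length-map; length-++; map-++; ++-identityʳ)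
open import Data.List.Membership.Propositional using (_∈_; _∉_; find; lose)
open import Data.List.Relation.Unary.All using (All; []; _∷_)
import Data.List.Relation.Unary.All as AllL
import Data.List.Relation.Unary.All.Properties as AllP
open import Data.List.Relation.Unary.Any using (here; there)
import Data.List.Relation.Unary.Any as AnyL
open import Data.List.Relation.Unary.AllPairs using ([]; _∷_)
open import Data.List.Relation.Unary.Unique.Propositional using (Unique)
open import Data.List.Relation.Binary.Permutation.Propositional using (_↭_; ↭-refl; ↭-sym; ↭-trans; prep; swap;
  ↭-reflexive)
open import Data.List.Relation.Binary.Permutation.Propositional.Properties using (All-resp-↭; ∈-resp-↭; map⁺;
  ↭-length; shift; ++⁺ʳ; ++-comm)
open import Data.Nat using (ℕ; zero; suc; _+_; _*_; _∸_; _≤_; _<_; z≤n; s≤s; _≤?_; _<?_; _≤ᵇ_)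
open import Data.Nat.Properties using (≤-refl; ≤-trans; ≤-reflexive; ≤-antisym; ≰⇒>; ≮⇒≥; +-assoc; +-comm; +-suc;
  +-identityʳ; *-distribˡ-+; *-distribʳ-+; *-assoc; *-monoʳ-≤; *-identityˡ; +-mono-≤; m≤n+m; m≤m+n; <⇒≱; n<1+n; ≤ᵇ⇒≤;
  *-monoˡ-≤; m+[n∸m]≡n; suc-injective; m≤n⇒∃[o]m+o≡n)
open import Data.Product using (_×_; _,_; proj₁; proj₂; ∃)
open import Data.Sum using (_⊎_; inj₁; inj₂)
open import Function using (_∘_; id; case_of_)
open import Function.Definitions using (Injective)
open import Relation.Binary.PropositionalEquality using (_≡_; _≢_; refl; sym; trans; cong; cong₂; subst;
  module ≡-Reasoning)
open import Relation.Nullary using (¬_; Dec; yes; no)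
open import Relation.Nullary.Decidable using (map′; ⌊_⌋; _×-dec_; ¬?; _→-dec_)
open import Data.List.Membership.DecPropositional using (_∈?_)
open import Defs
import Data.Vec as Vec
open import Data.List.Membership.Propositional.Properties using (∈-lookup; ∈-∃++; ∈-++⁺ˡ; ∈-++⁺ʳ; ∈-++⁻)
import Data.Vec.Properties as VecP

-- Linear arithmetic over ℕ by Farkas multipliers

-- In the middle range everything turns on D + j, where j is the number of covering vertices in C.
-- Deleting them leaves at least 2n - 2 - D - j vertices of C, which is n or more while D + j ≤ n -
-- 2. Conversely they carry j red edges leaving A, and the vertices suffice for a spider once D + j
-- ≥ n - 1. The two arguments meet without a gap, but at D + j = n - 1 neither has slack: a stuck
-- matching may leave only two vertices of A, too few to form a pair with c, so blue degrees must be
-- bounded across the matched part of C as well. From D + j = n on, three vertices are left over,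
-- and with c they are the four of a pair. The pair also needs three vertices of A outside the
-- cover. This can fail only for n ≤ 10, where the bound on red degrees makes C so dense in blue
-- that wheels are found directly. For small D, let t be the number of vertices outside A. The
-- threshold of one third is forced from both sides: three pairwise bad vertices are excluded once
-- their numbers of missed vertices add up to t - 2, while two vertices and their hub keep three
-- common links if each misses at most t/3 - 1.

infixl 6 _⊕_
infixl 7 _⊛_
infix 4 _⊑_ _⊏_

data Exp : Set where
  var con : ℕ → Exp
  _⊕_     : Exp → Exp → Exp
  _⊛_     : ℕ → Exp → Exp

record Ineq : Set where
  constructor _⊑_
  field small big : Exp
open Ineq

_⊏_ : Exp → Exp → Ineq
a ⊏ b = con 1 ⊕ a ⊑ b

Env : Set
Env = List ℕ

value : Env → ℕ → ℕ
value []      _       = 0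
value (x ∷ ρ) zero    = x
value (x ∷ ρ) (suc i) = value ρ i

eval : Env → Exp → ℕ
eval ρ (var i) = value ρ i
eval ρ (con n) = n
eval ρ (a ⊕ b) = eval ρ a + eval ρ b
eval ρ (n ⊛ a) = n * eval ρ a

⟦_⟧ : Ineq → Env → Set
⟦ a ⊑ b ⟧ ρ = eval ρ a ≤ eval ρ b

dot : List ℕ → Env → ℕ
dot []       _       = 0
dot (c ∷ cs) []      = 0
dot (c ∷ cs) (x ∷ ρ) = c * x + dot cs ρ

unit : ℕ → List ℕ
unit zero    = 1 ∷ []
unit (suc i) = 0 ∷ unit i

dot-unit : ∀ i ρ → dot (unit i) ρ ≡ value ρ i
dot-unit zero    []      = refl
dot-unit (suc i) []      = refl
dot-unit zero    (x ∷ ρ) = trans (+-identityʳ _) (*-identityˡ x)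
dot-unit (suc i) (x ∷ ρ) = dot-unit i ρ

_⊞_ : List ℕ → List ℕ → List ℕ
[]       ⊞ ds       = ds
(c ∷ cs) ⊞ []       = c ∷ cs
(c ∷ cs) ⊞ (d ∷ ds) = c + d ∷ cs ⊞ ds

+-interchange : ∀ a b c d → (a + b) + (c + d) ≡ (a + c) + (b + d)
+-interchange a b c d = begin
  (a + b) + (c + d) ≡⟨ +-assoc a b (c + d) ⟩
  a + (b + (c + d)) ≡⟨ cong (a +_) (sym (+-assoc b c d)) ⟩
  a + ((b + c) + d) ≡⟨ cong (λ z → a + (z + d)) (+-comm b c) ⟩
  a + ((c + b) + d) ≡⟨ cong (a +_) (+-assoc c b d) ⟩
  a + (c + (b + d)) ≡⟨ sym (+-assoc a c (b + d)) ⟩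
  (a + c) + (b + d) ∎
  where open ≡-Reasoning

dot-⊞ : ∀ cs ds ρ → dot (cs ⊞ ds) ρ ≡ dot cs ρ + dot ds ρ
dot-⊞ []       ds       ρ       = refl
dot-⊞ (c ∷ cs) []       ρ       = sym (+-identityʳ _)
dot-⊞ (c ∷ cs) (d ∷ ds) []      = refl
dot-⊞ (c ∷ cs) (d ∷ ds) (x ∷ ρ) = trans
  (cong₂ _+_ (*-distribʳ-+ x c d) (dot-⊞ cs ds ρ))
  (+-interchange (c * x) (d * x) (dot cs ρ) (dot ds ρ))

dot-scale : ∀ n cs ρ → dot (map (n *_) cs) ρ ≡ n * dot cs ρ
dot-scale zero    []       ρ       = refl
dot-scale (suc n) []       ρ       = dot-scale n [] ρ
dot-scale zero    (c ∷ cs) []      = refl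
dot-scale (suc n) (c ∷ cs) []      = dot-scale n (c ∷ cs) []
dot-scale n       (c ∷ cs) (x ∷ ρ) = trans
  (cong₂ _+_ (*-assoc n c x) (dot-scale n cs ρ))
  (sym (*-distribˡ-+ n (c * x) (dot cs ρ)))

constant : Exp → ℕ
constant (var i) = 0
constant (con n) = n
constant (a ⊕ b) = constant a + constant b
constant (n ⊛ a) = n * constant a

coeffs : Exp → List ℕ
coeffs (var i) = unit i
coeffs (con n) = []
coeffs (a ⊕ b) = coeffs a ⊞ coeffs b
coeffs (n ⊛ a) = map (n *_) (coeffs a)

normal : ∀ ρ e → eval ρ e ≡ constant e + dot (coeffs e) ρ
normal ρ (var i) = sym (dot-unit i ρ)
normal ρ (con n) = sym (+-identityʳ n)
normal ρ (a ⊕ b) = trans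
  (cong₂ _+_ (normal ρ a) (normal ρ b))
  (trans (+-interchange (constant a) (dot (coeffs a) ρ) (constant b) (dot (coeffs b) ρ))
         (cong (constant a + constant b +_) (sym (dot-⊞ (coeffs a) (coeffs b) ρ))))
normal ρ (n ⊛ a) = trans
  (cong (n *_) (normal ρ a))
  (trans (*-distribˡ-+ n (constant a) (dot (coeffs a) ρ))
         (cong (n * constant a +_) (sym (dot-scale n (coeffs a) ρ))))

_≤ˡ_ : List ℕ → List ℕ → Bool
[]       ≤ˡ ds       = true
(c ∷ cs) ≤ˡ []       = (c ≤ᵇ 0) ∧ (cs ≤ˡ [])
(c ∷ cs) ≤ˡ (d ∷ ds) = (c ≤ᵇ d) ∧ (cs ≤ˡ ds)

∧-true : ∀ {a b} → a ∧ b ≡ true → (a ≡ true) × (b ≡ true)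
∧-true {true} {true} refl = refl , refl

true-∧ : ∀ {a b} → a ≡ true → b ≡ true → a ∧ b ≡ true
true-∧ refl refl = refl

≤ᵇ-sound : ∀ m n → (m ≤ᵇ n) ≡ true → m ≤ n
≤ᵇ-sound m n eq = ≤ᵇ⇒≤ m n (subst T (sym eq) _)

dot-≤ : ∀ cs ds ρ → (cs ≤ˡ ds) ≡ true → dot cs ρ ≤ dot ds ρ
dot-≤ []       ds       ρ       _  = z≤n
dot-≤ (c ∷ cs) ds       []      _  = z≤n
dot-≤ (c ∷ cs) []       (x ∷ ρ) eq with ∧-true eq
... | c≤0 , cs≤ with ≤ᵇ-sound c 0 c≤0
... | z≤n = dot-≤ cs [] ρ cs≤
dot-≤ (c ∷ cs) (d ∷ ds) (x ∷ ρ) eq with ∧-true eq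
... | c≤d , cs≤ = +-mono-≤ (*-monoˡ-≤ x (≤ᵇ-sound c d c≤d)) (dot-≤ cs ds ρ cs≤)

-- Domination coefficient by coefficient is enough because the variables range over natural numbers.
-- Strictness is asked of the constants alone.
smaller : Exp → Exp → Bool
smaller a b = (suc (constant a) ≤ᵇ constant b) ∧ (coeffs a ≤ˡ coeffs b)

smaller-sound : ∀ ρ a b → smaller a b ≡ true → eval ρ a < eval ρ b
smaller-sound ρ a b eq with ∧-true {suc (constant a) ≤ᵇ constant b} eq
... | c< , cs≤ rewrite normal ρ a | normal ρ b =
  +-mono-≤ (≤ᵇ-sound (suc (constant a)) (constant b) c<) (dot-≤ (coeffs a) (coeffs b) ρ cs≤)

-- The two sides of the weighted sum are kept apart, so that no subtraction of natural numbers
-- arises.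
combine : List ℕ → List Ineq → Ineq
combine (n ∷ ns) (h ∷ hs) =
  n ⊛ small h ⊕ small (combine ns hs) ⊑ n ⊛ big h ⊕ big (combine ns hs)
-- Multipliers missing at the end of the list thus count as zero.
combine _        _        = con 0 ⊑ con 0

combine-sound : ∀ ρ ns hs → All (λ h → ⟦ h ⟧ ρ) hs → ⟦ combine ns hs ⟧ ρ
combine-sound ρ []       hs       _        = z≤n
combine-sound ρ (n ∷ ns) []       _        = z≤n
combine-sound ρ (n ∷ ns) (h ∷ hs) (p ∷ ps) = +-mono-≤ (*-monoʳ-≤ n p) (combine-sound ρ ns hs ps)

infixr 5 _⟹_

_⟹_ : List Ineq → Set → Env → Set
(hs ⟹ G) ρ = go hs
  where
  go : List Ineq → Set
  go []       = G
  go (h ∷ hs) = ⟦ h ⟧ ρ → go hs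

curry-⟹ : ∀ ρ hs {G} → (All (λ h → ⟦ h ⟧ ρ) hs → G) → (hs ⟹ G) ρ
curry-⟹ ρ []       f = f []
curry-⟹ ρ (h ∷ hs) f = λ p → curry-⟹ ρ hs (λ ps → f (p ∷ ps))

refutes : List ℕ → List Ineq → Bool
refutes ns hs = smaller (big (combine ns hs)) (small (combine ns hs))

contradictory : ∀ ρ ns hs → refutes ns hs ≡ true → All (λ h → ⟦ h ⟧ ρ) hs → ⊥
contradictory ρ ns hs eq ps =
  <⇒≱ (smaller-sound ρ (big (combine ns hs)) (small (combine ns hs)) eq) (combine-sound ρ ns hs ps)

abstract

  -- The list of multipliers refutes the hypotheses, in the order given; for lin the first multiplier is that of the negated goal.
  lin⊥ : ∀ ρ hs ns → refutes ns hs ≡ true → (hs ⟹ ⊥) ρ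
  lin⊥ ρ hs ns eq = curry-⟹ ρ hs (contradictory ρ ns hs eq)

  lin : ∀ ρ hs g ns → refutes ns ((big g ⊏ small g) ∷ hs) ≡ true → (hs ⟹ ⟦ g ⟧ ρ) ρ
  lin ρ hs g ns eq = curry-⟹ ρ hs λ ps →
    ≮⇒≥ λ b<a → contradictory ρ ns ((big g ⊏ small g) ∷ hs) eq (b<a ∷ ps)

x₀ x₁ x₂ x₃ x₄ x₅ x₆ x₇ x₈ x₉ : Exp
x₀ = var 0
x₁ = var 1
x₂ = var 2
x₃ = var 3
x₄ = var 4
x₅ = var 5
x₆ = var 6
x₇ = var 7
x₈ = var 8
x₉ = var 9

-- Counting

Pred : ℕ → Set
Pred N = Fin N → Bool

bit : Bool → ℕ
bit true  = 1
bit false = 0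

♯ : ∀ {N} → Pred N → ℕ
♯ {zero}  P = 0
♯ {suc N} P = bit (P zero) + ♯ (P ∘ suc)

infixr 7 _∩_
infixl 8 _∖_

_∩_ : ∀ {N} → Pred N → Pred N → Pred N
(P ∩ Q) x = P x ∧ Q x

_∪_ : ∀ {N} → Pred N → Pred N → Pred N
(P ∪ Q) x = P x ∨ Q x

¬ᵖ_ : ∀ {N} → Pred N → Pred N
(¬ᵖ P) x = not (P x)

infix 9 ¬ᵖ_

member : ∀ {N} → List (Fin N) → Pred N
member xs x = ⌊ _∈?_ _≟_ x xs ⌋

_∖_ : ∀ {N} → Pred N → List (Fin N) → Pred N
P ∖ xs = P ∩ ¬ᵖ (member xs)

full : ∀ {N} → Pred N
full _ = true

member-∈ : ∀ {N} {x : Fin N} xs → member xs x ≡ true → x ∈ xs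
member-∈ {x = x} xs eq with _∈?_ _≟_ x xs
... | yes p = p

∈-member : ∀ {N} {x : Fin N} xs → x ∈ xs → member xs x ≡ true
∈-member {x = x} xs p with _∈?_ _≟_ x xs
... | yes _ = refl
... | no ¬p = ⊥-elim (¬p p)

∖-intro : ∀ {N} (P : Pred N) xs {x} → P x ≡ true → x ∉ xs → (P ∖ xs) x ≡ true
∖-intro P xs {x} Px x∉ with _∈?_ _≟_ x xs
... | yes p = ⊥-elim (x∉ p)
... | no _ = true-∧ Px refl

∖-elim : ∀ {N} (P : Pred N) xs {x} → (P ∖ xs) x ≡ true → (P x ≡ true) × (x ∉ xs)
∖-elim P xs {x} eq with _∈?_ _≟_ x xs | ∧-true {P x} eq
... | no ¬p | Px , _ = Px , ¬p

∪-elim : ∀ {a b} → a ∨ b ≡ true → (a ≡ true) ⊎ (b ≡ true)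
∪-elim {true}  _ = inj₁ refl
∪-elim {false} e = inj₂ e

∪-left : ∀ {a b} → a ≡ true → a ∨ b ≡ true
∪-left refl = refl

∪-right : ∀ {a b} → b ≡ true → a ∨ b ≡ true
∪-right {true}  _ = refl
∪-right {false} e = e

yes-true : ∀ {A : Set} (d : Dec A) → ⌊ d ⌋ ≡ true → A
yes-true (yes a) _ = a

true-yes : ∀ {A : Set} (d : Dec A) → A → ⌊ d ⌋ ≡ true
true-yes (yes _) _ = refl
true-yes (no ¬a) a = ⊥-elim (¬a a)

true≢false : ∀ {a} → a ≡ true → a ≡ false → ⊥
true≢false refl ()

bool-ext : ∀ {a b} → (a ≡ true → b ≡ true) → (b ≡ true → a ≡ true) → a ≡ b
bool-ext {true}          f g = sym (f refl)
bool-ext {false} {true}  f g = g refl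
bool-ext {false} {false} f g = refl

bool-cases : ∀ a → (a ≡ true) ⊎ (a ≡ false)
bool-cases true  = inj₁ refl
bool-cases false = inj₂ refl

abstract

  bit-cover : ∀ a b c → (a ≡ true → (b ≡ true) ⊎ (c ≡ true)) → bit a ≤ bit b + bit c
  bit-cover false b    c    f = z≤n
  bit-cover true  true c    f = s≤s z≤n
  bit-cover true  false true f = s≤s z≤n
  bit-cover true  false false f with f refl
  ... | inj₁ ()
  ... | inj₂ ()

  -- Cardinalities are handled by inequalities only, from above by covers and from below by disjoint
  -- pieces as in `♯-disjoint`. This is the form in which `lin` takes them.
  ♯-cover : ∀ {N} (P Q R : Pred N) → (∀ x → P x ≡ true → (Q x ≡ true) ⊎ (R x ≡ true)) → ♯ P ≤ ♯ Q + ♯ R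
  ♯-cover {zero}  P Q R f = z≤n
  ♯-cover {suc N} P Q R f = ≤-trans
    (+-mono-≤ (bit-cover (P zero) (Q zero) (R zero) (f zero)) (♯-cover (P ∘ suc) (Q ∘ suc) (R ∘ suc) (f ∘ suc)))
    (≤-reflexive (+-interchange (bit (Q zero)) (bit (R zero)) (♯ (Q ∘ suc)) (♯ (R ∘ suc))))

  bit-disjoint : ∀ a b c → (b ≡ true → a ≡ true) → (c ≡ true → a ≡ true) → (b ≡ true → c ≡ true → ⊥) →
                 bit b + bit c ≤ bit a
  bit-disjoint a     true  true  f g h = ⊥-elim (h refl refl)
  bit-disjoint a     true  false f g h rewrite f refl = ≤-refl
  bit-disjoint a     false true  f g h rewrite g refl = ≤-refl
  bit-disjoint a     false false f g h = z≤n

  ♯-disjoint : ∀ {N} (P Q R : Pred N) → (∀ x → Q x ≡ true → P x ≡ true) → (∀ x → R x ≡ true → P x ≡ true) →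
               (∀ x → Q x ≡ true → R x ≡ true → ⊥) → ♯ Q + ♯ R ≤ ♯ P
  ♯-disjoint {zero}  P Q R f g h = z≤n
  ♯-disjoint {suc N} P Q R f g h = ≤-trans
    (≤-reflexive (+-interchange (bit (Q zero)) (♯ (Q ∘ suc)) (bit (R zero)) (♯ (R ∘ suc))))
    (+-mono-≤ (bit-disjoint (P zero) (Q zero) (R zero) (f zero) (g zero) (h zero))
              (♯-disjoint (P ∘ suc) (Q ∘ suc) (R ∘ suc) (f ∘ suc) (g ∘ suc) (h ∘ suc)))

  ♯-∅ : ∀ {N} (P : Pred N) → (∀ x → P x ≡ true → ⊥) → ♯ P ≡ 0
  ♯-∅ {zero}  P f = refl
  ♯-∅ {suc N} P f with P zero | f zero
  ... | true  | g = ⊥-elim (g refl)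
  ... | false | _ = ♯-∅ (P ∘ suc) (f ∘ suc)

  ♯-mono : ∀ {N} (P Q : Pred N) → (∀ x → P x ≡ true → Q x ≡ true) → ♯ P ≤ ♯ Q
  ♯-mono {N} P Q f = ≤-trans (♯-cover P Q (λ _ → false) (λ x p → inj₁ (f x p)))
    (≤-reflexive (trans (cong (♯ Q +_) (♯-∅ {N} (λ _ → false) (λ _ ()))) (+-identityʳ _)))

  ♯-full : ∀ N → ♯ (full {N}) ≡ N
  ♯-full zero    = refl
  ♯-full (suc N) = cong suc (♯-full N)

  ♯-split : ∀ {N} (P Q : Pred N) → ♯ P ≤ ♯ (P ∩ Q) + ♯ (P ∩ ¬ᵖ Q)
  ♯-split P Q = ♯-cover P (P ∩ Q) (P ∩ ¬ᵖ Q) λ x p → case bool-cases (Q x) of λ where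
    (inj₁ q) → inj₁ (true-∧ p q)
    (inj₂ q) → inj₂ (true-∧ p (cong not q))

  ♯-split′ : ∀ {N} (P Q : Pred N) → ♯ (P ∩ Q) + ♯ (P ∩ ¬ᵖ Q) ≤ ♯ P
  ♯-split′ P Q = ♯-disjoint P (P ∩ Q) (P ∩ ¬ᵖ Q) (λ x e → proj₁ (∧-true e)) (λ x e → proj₁ (∧-true e))
    λ x p q → true≢false (proj₂ (∧-true {P x} q)) (cong not (proj₂ (∧-true {P x} p)))

  ♯-singleton : ∀ {N} (x : Fin N) → ♯ (member (x ∷ [])) ≡ 1
  ♯-singleton {suc N} zero = cong suc (♯-∅ (member (zero ∷ []) ∘ suc) λ y e → absurd y (member-∈ (zero ∷ []) e))
    where
    absurd : (y : Fin N) → suc y ∈ (zero ∷ []) → ⊥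
    absurd y (here ())
  ♯-singleton {suc N} (suc x) = trans
    (cong (λ b → bit b + ♯ (member (suc x ∷ []) ∘ suc)) (¬-not first))
    (≤-antisym (≤-trans (♯-mono (member (suc x ∷ []) ∘ suc) (member (x ∷ [])) λ y e → ∈-member (x ∷ []) (down (member-∈ (suc x ∷ []) e)))
                        (≤-reflexive (♯-singleton x)))
               (≤-trans (≤-reflexive (sym (♯-singleton x)))
                        (♯-mono (member (x ∷ [])) (member (suc x ∷ []) ∘ suc) λ y e → ∈-member (suc x ∷ []) (up (member-∈ (x ∷ []) e)))))
    where
    down : ∀ {y} → suc y ∈ (suc x ∷ []) → y ∈ (x ∷ [])
    down (here refl) = here refl
    up : ∀ {y} → y ∈ (x ∷ []) → suc y ∈ (suc x ∷ [])
    up (here refl) = here refl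
    first : member (suc x ∷ []) zero ≡ true → ⊥
    first e with member-∈ {x = zero} (suc x ∷ []) e
    ... | here ()
    ... | there ()

  ♯-member : ∀ {N} (xs : List (Fin N)) → ♯ (member xs) ≤ length xs
  ♯-member {N} []   = ≤-reflexive (♯-∅ {N} (member []) λ x ())
  ♯-member (x ∷ xs) = ≤-trans
    (♯-cover (member (x ∷ xs)) (member (x ∷ [])) (member xs) λ y e → split y (member-∈ (x ∷ xs) e))
    (+-mono-≤ (≤-reflexive (♯-singleton x)) (♯-member xs))
    where
    split : ∀ y → y ∈ (x ∷ xs) → (member (x ∷ []) y ≡ true) ⊎ (member xs y ≡ true)
    split y (here e)  = inj₁ (∈-member (x ∷ []) (here e))
    split y (there p) = inj₂ (∈-member xs p)

  ♯-∖ : ∀ {N} (P : Pred N) xs → ♯ P ≤ ♯ (P ∖ xs) + length xs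
  ♯-∖ P xs = ≤-trans
    (♯-cover P (P ∖ xs) (member xs) λ x p → case bool-cases (member xs x) of λ where
      (inj₁ m) → inj₂ m
      (inj₂ m) → inj₁ (true-∧ p (cong not m)))
    (+-mono-≤ ≤-refl (♯-member xs))

  ♯-∷ : ∀ {N} (P Q : Pred N) x → P x ≡ true → Q x ≡ false → (∀ y → Q y ≡ true → P y ≡ true) → suc (♯ Q) ≤ ♯ P
  ♯-∷ P Q x p q f = ≤-trans (≤-reflexive (cong (_+ ♯ Q) (sym (♯-singleton x))))
    (♯-disjoint P (member (x ∷ [])) Q one f other)
    where
    one : ∀ y → member (x ∷ []) y ≡ true → P y ≡ true
    one y e with member-∈ (x ∷ []) e
    ... | here refl = p
    other : ∀ y → member (x ∷ []) y ≡ true → Q y ≡ true → ⊥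
    other y e e′ with member-∈ (x ∷ []) e
    ... | here refl = true≢false e′ q

  distinct-∉ : ∀ {N} {x : Fin N} {xs} → All (x ≢_) xs → x ∉ xs
  distinct-∉ (p ∷ ps) (here e)  = p e
  distinct-∉ (p ∷ ps) (there m) = distinct-∉ ps m

  ∉-distinct : ∀ {N} {x : Fin N} {xs} → x ∉ xs → All (x ≢_) xs
  ∉-distinct {xs = []}     n = []
  ∉-distinct {xs = y ∷ ys} n = (λ e → n (here e)) ∷ ∉-distinct (n ∘ there)

  ♯-∖-unique : ∀ {N} (P : Pred N) {xs} → Unique xs → All (λ x → P x ≡ true) xs → length xs + ♯ (P ∖ xs) ≤ ♯ P
  ♯-∖-unique P {[]} _ _ = ♯-mono (P ∖ []) P λ x e → proj₁ (∖-elim P [] e)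
  ♯-∖-unique P {x ∷ xs} (x∉ ∷ u) (p ∷ ps) = ≤-trans
    (≤-trans (≤-reflexive (sym (+-suc (length xs) _)))
             (+-mono-≤ (≤-refl {length xs}) (♯-∷ (P ∖ xs) (P ∖ (x ∷ xs)) x (∖-intro P xs p (distinct-∉ x∉)) gone less)))
    (♯-∖-unique P u ps)
    where
    gone : (P ∖ (x ∷ xs)) x ≡ false
    gone = ¬-not λ e → proj₂ (∖-elim P (x ∷ xs) e) (here refl)
    less : ∀ y → (P ∖ (x ∷ xs)) y ≡ true → (P ∖ xs) y ≡ true
    less y e with ∖-elim P (x ∷ xs) e
    ... | q , y∉ = ∖-intro P xs q (y∉ ∘ there)

  unique-≤ : ∀ {N} (P : Pred N) {xs} → Unique xs → All (λ x → P x ≡ true) xs → length xs ≤ ♯ P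
  unique-≤ P u ps = ≤-trans (m≤m+n _ _) (♯-∖-unique P u ps)

  inhabited : ∀ {N} (P : Pred N) → 1 ≤ ♯ P → ∃ λ x → P x ≡ true
  inhabited {suc N} P le with P zero in eq
  ... | true = zero , eq
  ... | false with inhabited (P ∘ suc) le
  ... | x , p = suc x , p

  pick : ∀ {N} (P : Pred N) xs → suc (length xs) ≤ ♯ P → ∃ λ x → (P x ≡ true) × (x ∉ xs)
  pick P xs le with inhabited (P ∖ xs) (lin (♯ P ∷ ♯ (P ∖ xs) ∷ length xs ∷ [])
         ((con 1 ⊕ x₂ ⊑ x₀) ∷ (x₀ ⊑ x₁ ⊕ x₂) ∷ []) (con 1 ⊑ x₁) (1 ∷ 1 ∷ 1 ∷ []) refl le (♯-∖ P xs))
  ... | x , e = x , ∖-elim P xs e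

  choose : ∀ {N} (P : Pred N) m → m ≤ ♯ P → ∃ λ xs → (length xs ≡ m) × Unique xs × All (λ x → P x ≡ true) xs
  choose P zero    _  = [] , refl , [] , []
  choose P (suc m) le with choose P m (≤-trans (m≤n+m m 1) le)
  ... | xs , refl , u , ps with pick P xs le
  ... | x , p , x∉ = x ∷ xs , refl , ∉-distinct x∉ ∷ u , p ∷ ps

  shrink : ∀ {N} (P : Pred N) m → m ≤ ♯ P → ∃ λ Q → (♯ Q ≡ m) × (∀ x → Q x ≡ true → P x ≡ true)
  shrink P m le with choose P m le
  ... | xs , refl , u , ps =
    member xs ,
    ≤-antisym (♯-member xs) (unique-≤ (member xs) u (AllL.tabulate (∈-member xs))) ,
    λ x e → AllL.lookup ps (member-∈ xs e)

argmax : ∀ {n} (f : Fin n → ℕ) → Fin n → ∃ λ c → ∀ x → f x ≤ f c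
argmax {suc zero}    f _ = zero , λ { zero → ≤-refl }
argmax {suc (suc n)} f _ with argmax (f ∘ suc) zero
... | c , max with f zero ≤? f (suc c)
... | yes le = suc c , λ { zero → le ; (suc x) → max x }
... | no nle = zero , λ { zero → ≤-refl ; (suc x) → ≤-trans (max x) (≤-trans (m≤n+m _ 1) (≰⇒> nle)) }

-- Embeddings

abstract

  -- Maps out of a finite set are searched in tabulated form, where induction on the length is
  -- available.
  any-vec? : ∀ {N} m {P : Vec.Vec (Fin N) m → Set} → (∀ v → Dec (P v)) → Dec (∃ P)
  any-vec? zero    P? = map′ (Vec.[] ,_) (λ { (Vec.[] , p) → p }) (P? Vec.[])
  any-vec? (suc m) P? = map′ (λ (x , v , p) → x Vec.∷ v , p) (λ { (x Vec.∷ v , p) → x , v , p })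
    (any? λ x → any-vec? m λ v → P? (x Vec.∷ v))

  -- The Ramsey property asks for an explicit embedding. Deciding both alternatives turns the
  -- refutation of "neither spider nor wheel" into one.
  _⊆ᴳ?_ : ∀ {m N} (G : Graph m) (F : Graph N) → Dec (G ⊆ᴳ F)
  _⊆ᴳ?_ {m} {N} G F = map′ to from (any-vec? m λ v →
    all? (λ i → all? λ j → (Vec.lookup v i ≟ Vec.lookup v j) →-dec (i ≟ j)) ×-dec
    all? (λ i → all? λ j → (adj G i j ≟ᵇ true) →-dec (adj F (Vec.lookup v i) (Vec.lookup v j) ≟ᵇ true)))
    where
    Embeds : Vec.Vec (Fin N) m → Set
    Embeds v = (∀ i j → Vec.lookup v i ≡ Vec.lookup v j → i ≡ j) ×
               (∀ i j → adj G i j ≡ true → adj F (Vec.lookup v i) (Vec.lookup v j) ≡ true)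
    to : ∃ Embeds → G ⊆ᴳ F
    to (v , inj , hom) = Vec.lookup v , inj _ _ , hom
    from : G ⊆ᴳ F → ∃ Embeds
    from (f , inj , hom) = Vec.tabulate f ,
      (λ i j e → inj (trans (sym (VecP.lookup∘tabulate f i)) (trans e (VecP.lookup∘tabulate f j)))) ,
      (λ i j e → trans (cong₂ (adj F) (VecP.lookup∘tabulate f i) (VecP.lookup∘tabulate f j)) (hom i j e))

lookup-injective : ∀ {A : Set} {xs : List A} → Unique xs → ∀ i j → lookup xs i ≡ lookup xs j → i ≡ j
lookup-injective (p ∷ ps) zero    zero    e = refl
lookup-injective (p ∷ ps) zero    (suc j) e = ⊥-elim (AllL.lookup p (∈-lookup j) e)
lookup-injective (p ∷ ps) (suc i) zero    e = ⊥-elim (AllL.lookup p (∈-lookup i) (sym e))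
lookup-injective (p ∷ ps) (suc i) (suc j) e = cong suc (lookup-injective ps i j e)

complement-not : ∀ {N} (F : Graph N) x y → x ≢ y → adj (complement F) x y ≡ not (adj F x y)
complement-not F x y x≢y with x ≟ y
... | yes e = ⊥-elim (x≢y e)
... | no _  = refl

-- F is the red graph and H the blue one; n is l + 9.
module Colours {N : ℕ} (F H : Graph N)
  (complementary : ∀ x y → x ≢ y → adj H x y ≡ not (adj F x y))
  (l : ℕ) (order≡ : N ≡ l + l + 17)
  (no-spider : ¬ (SpiderS (9 + l) ⊆ᴳ F)) (no-wheel : ¬ (W₈ ⊆ᴳ H)) where

  V : Set
  V = Fin N

  r b : V → Pred N
  r = adj F
  b = adj H

  r-sym : ∀ {x y c} → r x y ≡ c → r y x ≡ c
  r-sym {x} {y} = trans (adj-sym F y x)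

  b-sym : ∀ {x y c} → b x y ≡ c → b y x ≡ c
  b-sym {x} {y} = trans (adj-sym H y x)

  r-≢ : ∀ {x y} → r x y ≡ true → x ≢ y
  r-≢ {x} e refl = true≢false e (adj-irrefl F x)

  b-≢ : ∀ {x y} → b x y ≡ true → x ≢ y
  b-≢ {x} e refl = true≢false e (adj-irrefl H x)

  ¬r⇒b : ∀ {x y} → x ≢ y → r x y ≡ false → b x y ≡ true
  ¬r⇒b x≢y e = trans (complementary _ _ x≢y) (cong not e)

  b⇒¬r : ∀ {x y} → b x y ≡ true → r x y ≡ false
  b⇒¬r {x} {y} e with r x y in eq
  ... | false = refl
  ... | true  = ⊥-elim (true≢false e (trans (complementary _ _ (b-≢ e)) (cong not eq)))

  r⇒¬b : ∀ {x y} → r x y ≡ true → b x y ≡ false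
  r⇒¬b e = trans (complementary _ _ (r-≢ e)) (cong not e)

  colour : ∀ {x y} → x ≢ y → (r x y ≡ true) ⊎ (b x y ≡ true)
  colour {x} {y} x≢y with r x y in eq
  ... | true  = inj₁ refl
  ... | false = inj₂ (¬r⇒b x≢y eq)

  -- Wheels from four rim vertices and four links between them

  wheel : ∀ {h y₁ c₁ y₂ c₂ y₃ c₃ y₄ c₄} →
          All (λ x → b h x ≡ true) (y₁ ∷ c₁ ∷ y₂ ∷ c₂ ∷ y₃ ∷ c₃ ∷ y₄ ∷ c₄ ∷ []) →
          Unique (y₁ ∷ c₁ ∷ y₂ ∷ c₂ ∷ y₃ ∷ c₃ ∷ y₄ ∷ c₄ ∷ []) →
          b y₁ c₁ ≡ true → b c₁ y₂ ≡ true → b y₂ c₂ ≡ true → b c₂ y₃ ≡ true →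
          b y₃ c₃ ≡ true → b c₃ y₄ ≡ true → b y₄ c₄ ≡ true → b c₄ y₁ ≡ true → ⊥
  wheel {h} {y₁} {c₁} {y₂} {c₂} {y₃} {c₃} {y₄} {c₄} spokes u e₁ e₂ e₃ e₄ e₅ e₆ e₇ e₈ =
    no-wheel (f , (λ {i} {j} → lookup-injective (AllL.map b-≢ spokes ∷ u) i j) , hom)
    where
    f : Fin 9 → V
    f = lookup (h ∷ y₁ ∷ c₁ ∷ y₂ ∷ c₂ ∷ y₃ ∷ c₃ ∷ y₄ ∷ c₄ ∷ [])
    spoke : ∀ i → b h (f (suc i)) ≡ true
    spoke i = AllL.lookup spokes (∈-lookup i)
    hom : ∀ i j → wheelAdj i j ≡ true → b (f i) (f j) ≡ true
    hom zero    (suc j) _ = spoke j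
    hom (suc i) zero    _ = b-sym (spoke i)
    hom (suc zero) (suc (suc zero)) refl = e₁
    hom (suc (suc zero)) (suc (suc (suc zero))) refl = e₂
    hom (suc (suc (suc zero))) (suc (suc (suc (suc zero)))) refl = e₃
    hom (suc (suc (suc (suc zero)))) (suc (suc (suc (suc (suc zero))))) refl = e₄
    hom (suc (suc (suc (suc (suc zero))))) (suc (suc (suc (suc (suc (suc zero)))))) refl = e₅
    hom (suc (suc (suc (suc (suc (suc zero)))))) (suc (suc (suc (suc (suc (suc (suc zero))))))) refl = e₆
    hom (suc (suc (suc (suc (suc (suc (suc zero))))))) (suc (suc (suc (suc (suc (suc (suc (suc zero)))))))) refl = e₇
    hom (suc zero) (suc (suc (suc (suc (suc (suc (suc (suc zero)))))))) refl = b-sym e₈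
    hom (suc (suc zero)) (suc zero) refl = b-sym e₁
    hom (suc (suc (suc zero))) (suc (suc zero)) refl = b-sym e₂
    hom (suc (suc (suc (suc zero)))) (suc (suc (suc zero))) refl = b-sym e₃
    hom (suc (suc (suc (suc (suc zero))))) (suc (suc (suc (suc zero)))) refl = b-sym e₄
    hom (suc (suc (suc (suc (suc (suc zero)))))) (suc (suc (suc (suc (suc zero))))) refl = b-sym e₅
    hom (suc (suc (suc (suc (suc (suc (suc zero))))))) (suc (suc (suc (suc (suc (suc zero)))))) refl = b-sym e₆
    hom (suc (suc (suc (suc (suc (suc (suc (suc zero)))))))) (suc (suc (suc (suc (suc (suc (suc zero))))))) refl = b-sym e₇
    hom (suc (suc (suc (suc (suc (suc (suc (suc zero)))))))) (suc zero) refl = e₈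
    hom (suc (suc (suc (suc (suc (suc (suc (suc zero)))))))) (suc (suc (suc (suc (suc (suc (suc (suc zero)))))))) ()

  -- The rim alternates between y's and links, but the links are chosen after the y's and one after
  -- another. The hypotheses list the inequalities in the order in which they arise.
  rim-distinct : ∀ {y₁ y₂ y₃ y₄ c₁ c₂ c₃ c₄ : V} → Unique (y₁ ∷ y₂ ∷ y₃ ∷ y₄ ∷ []) →
                 All (c₁ ≢_) (y₁ ∷ y₂ ∷ y₃ ∷ y₄ ∷ []) → All (c₂ ≢_) (y₁ ∷ y₂ ∷ y₃ ∷ y₄ ∷ []) →
                 All (c₃ ≢_) (y₁ ∷ y₂ ∷ y₃ ∷ y₄ ∷ []) → All (c₄ ≢_) (y₁ ∷ y₂ ∷ y₃ ∷ y₄ ∷ []) →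
                 All (c₂ ≢_) (c₁ ∷ []) → All (c₃ ≢_) (c₁ ∷ c₂ ∷ []) → All (c₄ ≢_) (c₁ ∷ c₂ ∷ c₃ ∷ []) →
                 Unique (y₁ ∷ c₁ ∷ y₂ ∷ c₂ ∷ y₃ ∷ c₃ ∷ y₄ ∷ c₄ ∷ [])
  rim-distinct ((y₁₂ ∷ y₁₃ ∷ y₁₄ ∷ []) ∷ (y₂₃ ∷ y₂₄ ∷ []) ∷ (y₃₄ ∷ []) ∷ [] ∷ [])
    (a₁ ∷ a₂ ∷ a₃ ∷ a₄ ∷ []) (b₁ ∷ b₂ ∷ b₃ ∷ b₄ ∷ []) (d₁ ∷ d₂ ∷ d₃ ∷ d₄ ∷ []) (g₁ ∷ g₂ ∷ g₃ ∷ g₄ ∷ [])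
    (s₁ ∷ []) (u₁ ∷ u₂ ∷ []) (v₁ ∷ v₂ ∷ v₃ ∷ []) =
    (a₁ ∘ sym ∷ y₁₂ ∷ b₁ ∘ sym ∷ y₁₃ ∷ d₁ ∘ sym ∷ y₁₄ ∷ g₁ ∘ sym ∷ []) ∷
    (a₂ ∷ s₁ ∘ sym ∷ a₃ ∷ u₁ ∘ sym ∷ a₄ ∷ v₁ ∘ sym ∷ []) ∷
    (b₂ ∘ sym ∷ y₂₃ ∷ d₂ ∘ sym ∷ y₂₄ ∷ g₂ ∘ sym ∷ []) ∷
    (b₃ ∷ u₂ ∘ sym ∷ b₄ ∷ v₂ ∘ sym ∷ []) ∷
    (d₃ ∘ sym ∷ y₃₄ ∷ g₃ ∘ sym ∷ []) ∷
    (d₄ ∷ v₃ ∘ sym ∷ []) ∷ (g₄ ∘ sym ∷ []) ∷ [] ∷ []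

  Link : V → List V → V → V → V → Set
  Link h ys y z x = (b h x ≡ true) × (b y x ≡ true) × (b z x ≡ true) × (x ∉ ys)

  wheel-links : ∀ {h y₁ y₂ y₃ y₄ c₁ c₂ c₃ c₄} (let ys = y₁ ∷ y₂ ∷ y₃ ∷ y₄ ∷ []) →
                All (λ y → b h y ≡ true) ys → Unique ys →
                Link h ys y₁ y₂ c₁ → Link h ys y₂ y₃ c₂ → Link h ys y₃ y₄ c₃ → Link h ys y₄ y₁ c₄ →
                c₂ ∉ c₁ ∷ [] → c₃ ∉ c₁ ∷ c₂ ∷ [] → c₄ ∉ c₁ ∷ c₂ ∷ c₃ ∷ [] → ⊥
  wheel-links (h₁ ∷ h₂ ∷ h₃ ∷ h₄ ∷ []) u (k₁ , e₁ , f₁ , m₁) (k₂ , e₂ , f₂ , m₂) (k₃ , e₃ , f₃ , m₃) (k₄ , e₄ , f₄ , m₄)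
    q₂ q₃ q₄ =
    wheel (h₁ ∷ k₁ ∷ h₂ ∷ k₂ ∷ h₃ ∷ k₃ ∷ h₄ ∷ k₄ ∷ [])
      (rim-distinct u (∉-distinct m₁) (∉-distinct m₂) (∉-distinct m₃) (∉-distinct m₄)
                      (∉-distinct q₂) (∉-distinct q₃) (∉-distinct q₄))
      e₁ (b-sym f₁) e₂ (b-sym f₂) e₃ (b-sym f₃) e₄ (b-sym f₄)

  -- When the links are chosen in turn, the k-th has to avoid only the k - 1 earlier ones. Hence the
  -- sizes 1, 2, 3, 4, which later proofs exploit by starting the rim at the scarcest link.
  wheel-greedy : ∀ {h y₁ y₂ y₃ y₄} (let ys = y₁ ∷ y₂ ∷ y₃ ∷ y₄ ∷ []) →
                 All (λ y → b h y ≡ true) ys → Unique ys → (T₁ T₂ T₃ T₄ : Pred N) →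
                 (∀ x → T₁ x ≡ true → Link h ys y₁ y₂ x) → (∀ x → T₂ x ≡ true → Link h ys y₂ y₃ x) →
                 (∀ x → T₃ x ≡ true → Link h ys y₃ y₄ x) → (∀ x → T₄ x ≡ true → Link h ys y₄ y₁ x) →
                 1 ≤ ♯ T₁ → 2 ≤ ♯ T₂ → 3 ≤ ♯ T₃ → 4 ≤ ♯ T₄ → ⊥
  wheel-greedy hs u T₁ T₂ T₃ T₄ t₁ t₂ t₃ t₄ n₁ n₂ n₃ n₄ =
    let c₁ , p₁ , _  = pick T₁ [] n₁
        c₂ , p₂ , q₂ = pick T₂ (c₁ ∷ []) n₂
        c₃ , p₃ , q₃ = pick T₃ (c₁ ∷ c₂ ∷ []) n₃
        c₄ , p₄ , q₄ = pick T₄ (c₁ ∷ c₂ ∷ c₃ ∷ []) n₄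
    in wheel-links hs u (t₁ c₁ p₁) (t₂ c₂ p₂) (t₃ c₃ p₃) (t₄ c₄ p₄) q₂ q₃ q₄

  link : ∀ {h} ys (Q : Pred N) → (∀ x → Q x ≡ true → b h x ≡ true) → All (λ y → Q y ≡ false) ys →
         ∀ y z x → (Q ∩ b y ∩ b z) x ≡ true → Link h ys y z x
  link ys Q Q⊆ out y z x e =
    let q , e′ = ∧-true {Q x} e
        by , bz = ∧-true {b y x} e′
    in Q⊆ x q , by , bz , λ m → true≢false q (AllL.lookup out m)

  wheel-pool : ∀ {h y₁ y₂ y₃ y₄} (let ys = y₁ ∷ y₂ ∷ y₃ ∷ y₄ ∷ []) →
               All (λ y → b h y ≡ true) ys → Unique ys →
               (Q : Pred N) → (∀ x → Q x ≡ true → b h x ≡ true) → All (λ y → Q y ≡ false) ys →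
               1 ≤ ♯ (Q ∩ b y₁ ∩ b y₂) → 2 ≤ ♯ (Q ∩ b y₂ ∩ b y₃) →
               3 ≤ ♯ (Q ∩ b y₃ ∩ b y₄) → 4 ≤ ♯ (Q ∩ b y₄ ∩ b y₁) → ⊥
  wheel-pool {h} {y₁} {y₂} {y₃} {y₄} hs u Q Q⊆ out =
    wheel-greedy hs u (Q ∩ b y₁ ∩ b y₂) (Q ∩ b y₂ ∩ b y₃) (Q ∩ b y₃ ∩ b y₄) (Q ∩ b y₄ ∩ b y₁)
      (link ys Q Q⊆ out y₁ y₂) (link ys Q Q⊆ out y₂ y₃) (link ys Q Q⊆ out y₃ y₄) (link ys Q Q⊆ out y₄ y₁)
    where
    ys : List V
    ys = y₁ ∷ y₂ ∷ y₃ ∷ y₄ ∷ []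

  wheel-complete : ∀ {h ys} → length ys ≡ 4 → All (λ y → b h y ≡ true) ys → Unique ys →
                   (Q : Pred N) → (∀ x → Q x ≡ true → b h x ≡ true) →
                   (∀ {y} → y ∈ ys → ∀ x → Q x ≡ true → b y x ≡ true) → 4 ≤ ♯ Q → ⊥
  wheel-complete {h} {y₁ ∷ y₂ ∷ y₃ ∷ y₄ ∷ []} refl hs u Q Q⊆ complete le =
    wheel-greedy hs u Q Q Q Q (joined i₁ i₂) (joined i₂ i₃) (joined i₃ i₄) (joined i₄ i₁)
      (≤-trans (s≤s z≤n) le) (≤-trans (s≤s (s≤s z≤n)) le) (≤-trans (s≤s (s≤s (s≤s z≤n))) le) le
    where
    ys : List V
    ys = y₁ ∷ y₂ ∷ y₃ ∷ y₄ ∷ []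
    i₁ : y₁ ∈ ys
    i₁ = here refl
    i₂ : y₂ ∈ ys
    i₂ = there (here refl)
    i₃ : y₃ ∈ ys
    i₃ = there (there (here refl))
    i₄ : y₄ ∈ ys
    i₄ = there (there (there (here refl)))
    joined : ∀ {y z} → y ∈ ys → z ∈ ys → ∀ x → Q x ≡ true → Link h ys y z x
    joined m n x q = Q⊆ x q , complete m x q , complete n x q , λ k → b-≢ (complete k x q) refl

  -- Four blue neighbours of h in S, linked through Q, would be a rim around h.
  few-blue : ∀ h (S Q : Pred N) → (∀ x → Q x ≡ true → b h x ≡ true) →
             (∀ y x → S y ≡ true → Q x ≡ true → b y x ≡ true) → 4 ≤ ♯ Q → ♯ (S ∩ b h) ≤ 3
  few-blue h S Q hQ SQ le with 4 ≤? ♯ (S ∩ b h)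
  ... | no n = lin (♯ (S ∩ b h) ∷ []) ((x₀ ⊏ con 4) ∷ []) (x₀ ⊑ con 3) (1 ∷ 1 ∷ []) refl (≰⇒> n)
  ... | yes p with choose (S ∩ b h) 4 p
  ... | ys , len , u , all = ⊥-elim
    (wheel-complete len (AllL.map (λ {y} e → proj₂ (∧-true {S y} e)) all) u Q hQ
      (λ {y} m x → SQ y x (proj₁ (∧-true {S y} (AllL.lookup all m)))) le)

  verts : List (V × V) → List V
  verts []             = []
  verts ((x , y) ∷ ps) = x ∷ y ∷ verts ps

  -- Spiders from a centre and four red edges

  spider : ∀ c ps → length ps ≡ 4 → Unique (c ∷ verts ps) → All (λ (x , y) → (r c x ≡ true) × (r x y ≡ true)) ps →
           (L : Pred N) → (∀ x → L x ≡ true → r c x ≡ true) → (∀ x → L x ≡ true → x ∉ verts ps) → l ≤ ♯ L → ⊥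
  spider c ((u₁ , w₁) ∷ (u₂ , w₂) ∷ (u₃ , w₃) ∷ (u₄ , w₄) ∷ []) refl
         ((c₁ ∷ d₁ ∷ c₂ ∷ d₂ ∷ c₃ ∷ d₃ ∷ c₄ ∷ d₄ ∷ []) ∷
          (a₁ ∷ a₂ ∷ a₃ ∷ a₄ ∷ a₅ ∷ a₆ ∷ a₇ ∷ []) ∷ (b₂ ∷ b₃ ∷ b₄ ∷ b₅ ∷ b₆ ∷ b₇ ∷ []) ∷
          (e₃ ∷ e₄ ∷ e₅ ∷ e₆ ∷ e₇ ∷ []) ∷ (f₄ ∷ f₅ ∷ f₆ ∷ f₇ ∷ []) ∷
          (g₅ ∷ g₆ ∷ g₇ ∷ []) ∷ (h₆ ∷ h₇ ∷ []) ∷ (k₇ ∷ []) ∷ [] ∷ [])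
         ((r₁ , s₁) ∷ (r₂ , s₂) ∷ (r₃ , s₃) ∷ (r₄ , s₄) ∷ []) L L⊆ L∉ le
    with choose L l le
  ... | xs , len , u , all = no-spider (subst (λ n → SpiderS (9 + n) ⊆ᴳ F) len embedding)
    where
    leaf≢ : ∀ {z} → z ∈ verts ((u₁ , w₁) ∷ (u₂ , w₂) ∷ (u₃ , w₃) ∷ (u₄ , w₄) ∷ []) → All (z ≢_) xs
    leaf≢ m = AllL.map (λ {x} p e → L∉ x p (subst (_∈ _) e m)) all
    c≢ : All (c ≢_) xs
    c≢ = AllL.map (λ {x} p → r-≢ (L⊆ x p)) all
    zs : List V
    zs = c ∷ u₁ ∷ u₂ ∷ u₃ ∷ u₄ ∷ w₁ ∷ w₂ ∷ w₃ ∷ w₄ ∷ xs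
    distinct : Unique zs
    -- The pairs interleave the neighbours of the centre with the feet, whereas `SpiderS` numbers
    -- the four neighbours before the four feet.
    distinct =
      (c₁ ∷ c₂ ∷ c₃ ∷ c₄ ∷ d₁ ∷ d₂ ∷ d₃ ∷ d₄ ∷ c≢) ∷
      (a₂ ∷ a₄ ∷ a₆ ∷ a₁ ∷ a₃ ∷ a₅ ∷ a₇ ∷ leaf≢ (here refl)) ∷
      (e₄ ∷ e₆ ∷ b₂ ∘ sym ∷ e₃ ∷ e₅ ∷ e₇ ∷ leaf≢ (there (there (here refl)))) ∷
      (g₆ ∷ b₄ ∘ sym ∷ f₄ ∘ sym ∷ g₅ ∷ g₇ ∷ leaf≢ (there (there (there (there (here refl)))))) ∷
      (b₆ ∘ sym ∷ f₆ ∘ sym ∷ h₆ ∘ sym ∷ k₇ ∷ leaf≢ (there (there (there (there (there (there (here refl)))))))) ∷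
      (b₃ ∷ b₅ ∷ b₇ ∷ leaf≢ (there (here refl))) ∷
      (f₅ ∷ f₇ ∷ leaf≢ (there (there (there (here refl))))) ∷
      (h₇ ∷ leaf≢ (there (there (there (there (there (here refl))))))) ∷
      leaf≢ (there (there (there (there (there (there (there (here refl)))))))) ∷ u
    leaf : ∀ i → r c (lookup xs i) ≡ true
    leaf i = L⊆ _ (AllL.lookup all (∈-lookup i))
    f : Fin (9 + length xs) → V
    f = lookup zs
    hom : ∀ i j → spiderAdj i j ≡ true → r (f i) (f j) ≡ true
    hom zero (suc zero) _ = r₁
    hom zero (suc (suc zero)) _ = r₂
    hom zero (suc (suc (suc zero))) _ = r₃
    hom zero (suc (suc (suc (suc zero)))) _ = r₄
    hom zero (suc (suc (suc (suc (suc (suc (suc (suc (suc i))))))))) _ = leaf i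
    hom (suc zero) zero _ = r-sym r₁
    hom (suc (suc zero)) zero _ = r-sym r₂
    hom (suc (suc (suc zero))) zero _ = r-sym r₃
    hom (suc (suc (suc (suc zero)))) zero _ = r-sym r₄
    hom (suc (suc (suc (suc (suc (suc (suc (suc (suc i))))))))) zero _ = r-sym (leaf i)
    hom (suc zero) (suc (suc (suc (suc (suc zero))))) refl = s₁
    hom (suc (suc zero)) (suc (suc (suc (suc (suc (suc zero)))))) refl = s₂
    hom (suc (suc (suc zero))) (suc (suc (suc (suc (suc (suc (suc zero))))))) refl = s₃
    hom (suc (suc (suc (suc zero)))) (suc (suc (suc (suc (suc (suc (suc (suc zero)))))))) refl = s₄
    hom (suc (suc (suc (suc (suc zero))))) (suc zero) refl = r-sym s₁
    hom (suc (suc (suc (suc (suc (suc zero)))))) (suc (suc zero)) refl = r-sym s₂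
    hom (suc (suc (suc (suc (suc (suc (suc zero))))))) (suc (suc (suc zero))) refl = r-sym s₃
    hom (suc (suc (suc (suc (suc (suc (suc (suc zero)))))))) (suc (suc (suc (suc zero)))) refl = r-sym s₄
    hom (suc (suc (suc (suc (suc zero))))) (suc (suc (suc (suc (suc (suc (suc (suc (suc j))))))))) ()
    hom (suc (suc (suc (suc (suc (suc zero)))))) (suc (suc (suc (suc (suc (suc (suc (suc (suc j))))))))) ()
    hom (suc (suc (suc (suc (suc (suc (suc zero))))))) (suc (suc (suc (suc (suc (suc (suc (suc (suc j))))))))) ()
    hom (suc (suc (suc (suc (suc (suc (suc (suc zero)))))))) (suc (suc (suc (suc (suc (suc (suc (suc (suc j))))))))) ()
    hom (suc (suc (suc (suc (suc (suc (suc (suc (suc i))))))))) (suc (suc (suc (suc (suc (suc (suc (suc (suc j))))))))) ()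
    embedding : SpiderS (9 + length xs) ⊆ᴳ F
    embedding = f , (λ {i} {j} → lookup-injective distinct i j) , hom

  Unique-resp-↭ : ∀ {xs ys : List V} → xs ↭ ys → Unique xs → Unique ys
  Unique-resp-↭ _↭_.refl          u                    = u
  Unique-resp-↭ (_↭_.prep x p)    (a ∷ u)              = All-resp-↭ p a ∷ Unique-resp-↭ p u
  Unique-resp-↭ (_↭_.swap x y p)  ((n ∷ a) ∷ a′ ∷ u)   = (n ∘ sym ∷ All-resp-↭ p a′) ∷ All-resp-↭ p a ∷ Unique-resp-↭ p u
  Unique-resp-↭ (_↭_.trans p q)   u                    = Unique-resp-↭ q (Unique-resp-↭ p u)

  verts-++ : ∀ ps qs → verts (ps ++ qs) ≡ verts ps ++ verts qs
  verts-++ []             qs = refl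
  verts-++ ((x , y) ∷ ps) qs = cong (λ zs → x ∷ y ∷ zs) (verts-++ ps qs)

  verts-↭ : ∀ {ps qs} → ps ↭ qs → verts ps ↭ verts qs
  verts-↭ _↭_.refl                       = ↭-refl
  verts-↭ (_↭_.prep (x , y) p)           = prep x (prep y (verts-↭ p))
  verts-↭ (_↭_.swap (x , y) (z , w) p)   = ↭-trans
    (prep x (↭-trans (swap y z ↭-refl) (prep z (swap y w (verts-↭ p)))))
    (↭-trans (swap x z ↭-refl) (prep z (swap x w ↭-refl)))
  verts-↭ (_↭_.trans p q)                = ↭-trans (verts-↭ p) (verts-↭ q)

  ∈-verts : ∀ {x y ps} → (x , y) ∈ ps → (x ∈ verts ps) × (y ∈ verts ps)
  ∈-verts (here refl) = here refl , there (here refl)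
  ∈-verts (there m)   = let mx , my = ∈-verts m in there (there mx) , there (there my)

  count : Pred N → List V → ℕ
  count P []       = 0
  count P (x ∷ xs) = bit (P x) + count P xs

  ♯-∖-count : ∀ (P : Pred N) {xs} → Unique xs → count P xs + ♯ (P ∖ xs) ≤ ♯ P
  ♯-∖-count P {[]} _ = ♯-mono (P ∖ []) P λ x e → proj₁ (∖-elim P [] e)
  ♯-∖-count P {x ∷ xs} (x∉ ∷ u) with P x in eq
  ... | false = ≤-trans (+-mono-≤ (≤-refl {count P xs}) (♯-mono (P ∖ (x ∷ xs)) (P ∖ xs) λ y e →
          let q , y∉ = ∖-elim P (x ∷ xs) e in ∖-intro P xs q (y∉ ∘ there)))
        (♯-∖-count P u)
  ... | true = ≤-trans
    (≤-trans (≤-reflexive (sym (+-suc (count P xs) _)))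
             (+-mono-≤ (≤-refl {count P xs}) (♯-∷ (P ∖ xs) (P ∖ (x ∷ xs)) x (∖-intro P xs eq (distinct-∉ x∉))
               (¬-not λ e → proj₂ (∖-elim P (x ∷ xs) e) (here refl))
               λ y e → let q , y∉ = ∖-elim P (x ∷ xs) e in ∖-intro P xs q (y∉ ∘ there))))
    (♯-∖-count P u)

  -- Matchings of red edges touching a red neighbourhood

  -- A spider with centre c arises from four disjoint red edges (x , y) with x in A ⊆ r c. The edges in dead are kept;
  -- those in live may be exchanged along augmenting paths that end in the unused vertices of G.
  record Matching (c : V) (A G I : Pred N) (dead : List (V × V)) (cov : List V) (K : ℕ) (live : List (V × V)) : Set where
    field
      distinct : Unique (verts (live ++ dead))
      avoids   : c ∉ verts (live ++ dead)
      edges    : All (λ (x , y) → (A x ≡ true) × (r x y ≡ true)) (live ++ dead)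
      inside   : All (λ (x , y) → (I x ≡ true) × (I y ≡ true)) live
      -- Augmenting never frees a matched vertex, so what is covered once remains covered.
      covers   : All (_∈ verts live) cov
      -- An augmentation uses up two vertices of G and adds one edge, which counts twice, so the
      -- right side never drops. With four edges, K ≥ l + 8 guarantees l leaves.
      size     : K ≤ ♯ (G ∖ verts live) + (length live + length dead) + (length live + length dead)

  -- The two clauses exclude augmenting paths with one and with three edges; these two lengths
  -- already suffice.
  Stuck : Pred N → List (V × V) → Set
  Stuck L live = ∀ g g′ → L g ≡ true → L g′ ≡ true → g ≢ g′ →
    (b g g′ ≡ true) × All (λ (x , y) → r g x ≡ true → r g′ y ≡ true → ⊥) live

  module Augment (c : V) (A G I : Pred N) (dead : List (V × V)) (cov : List V) (K : ℕ)
    (A⊆ : ∀ x → A x ≡ true → r c x ≡ true) (G⊆ : ∀ x → G x ≡ true → (A x ≡ true) × (I x ≡ true))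
    (G∉ : ∀ x → G x ≡ true → x ∉ verts dead) where

    open Matching

    Match : List (V × V) → Set
    Match = Matching c A G I dead cov K

    resp : ∀ {live live′} → live ↭ live′ → Match live → Match live′
    resp {live} {live′} p M = record
      { distinct = Unique-resp-↭ (verts-↭ (++⁺ʳ dead p)) (distinct M)
      ; avoids   = λ m → avoids M (∈-resp-↭ (↭-sym (verts-↭ (++⁺ʳ dead p))) m)
      ; edges    = All-resp-↭ (++⁺ʳ dead p) (edges M)
      ; inside   = All-resp-↭ p (inside M)
      ; covers   = AllL.map (∈-resp-↭ (verts-↭ p)) (covers M)
      ; size     = ≤-trans (subst (λ n → K ≤ ♯ (G ∖ verts live) + (n + length dead) + (n + length dead)) (↭-length p) (size M))
          (+-mono-≤ (+-mono-≤ (♯-mono (G ∖ verts live) (G ∖ verts live′) λ x e →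
            let g , x∉ = ∖-elim G (verts live) e
            in ∖-intro G (verts live′) g (x∉ ∘ ∈-resp-↭ (↭-sym (verts-↭ p)))) ≤-refl) ≤-refl)
      }

    unused : ∀ {live x} → (G ∖ verts live) x ≡ true → x ∉ verts (live ++ dead)
    unused {live} {x} e m with ∈-++⁻ (verts live) (subst (x ∈_) (verts-++ live dead) m)
    ... | inj₁ m′ = proj₂ (∖-elim G (verts live) e) m′
    ... | inj₂ m′ = G∉ x (proj₁ (∖-elim G (verts live) e)) m′

    free : ∀ {live x} → (G ∖ verts live) x ≡ true → (A x ≡ true) × (I x ≡ true) × (r c x ≡ true)
    free {live} {x} e = let a , i = G⊆ x (proj₁ (∖-elim G (verts live) e)) in a , i , A⊆ x a

    shrinks : ∀ live live′ g g′ → (∀ {x} → x ∈ verts live′ → x ∈ g ∷ g′ ∷ verts live) →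
              length live′ ≡ suc (length live) → Match live →
              K ≤ ♯ (G ∖ verts live′) + (length live′ + length dead) + (length live′ + length dead)
    shrinks live live′ g g′ sub len M rewrite len =
      lin (K ∷ ♯ (G ∖ verts live) ∷ ♯ (G ∖ verts live ∖ (g ∷ g′ ∷ [])) ∷ ♯ (G ∖ verts live′) ∷ length live ∷ length dead ∷ [])
        ((x₀ ⊑ x₁ ⊕ (x₄ ⊕ x₅) ⊕ (x₄ ⊕ x₅)) ∷ (x₁ ⊑ x₂ ⊕ con 2) ∷ (x₂ ⊑ x₃) ∷ [])
        (x₀ ⊑ x₃ ⊕ (con 1 ⊕ x₄ ⊕ x₅) ⊕ (con 1 ⊕ x₄ ⊕ x₅)) (1 ∷ 1 ∷ 1 ∷ 1 ∷ []) refl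
        (size M) (♯-∖ (G ∖ verts live) (g ∷ g′ ∷ []))
        (♯-mono (G ∖ verts live ∖ (g ∷ g′ ∷ [])) (G ∖ verts live′) λ x e →
          let e′ , x∉ = ∖-elim (G ∖ verts live) (g ∷ g′ ∷ []) e
              gx , x∉′ = ∖-elim G (verts live) e′
          in ∖-intro G (verts live′) gx λ m → case sub m of λ where
               (here q)          → x∉ (here q)
               (there (here q))  → x∉ (there (here q))
               (there (there q)) → x∉′ q)

    add : ∀ {live g g′} → Match live → (G ∖ verts live) g ≡ true → (G ∖ verts live) g′ ≡ true → r g g′ ≡ true →
          Match ((g , g′) ∷ live)
    add {live} {g} {g′} M e e′ rgg′ =
      let a , i , c≁ = free {live} e
          a′ , i′ , c≁′ = free {live} e′
      in record
      { distinct = (r-≢ rgg′ ∷ ∉-distinct (unused {live} e)) ∷ ∉-distinct (unused {live} e′) ∷ distinct M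
      ; avoids   = λ { (here q) → r-≢ c≁ q ; (there (here q)) → r-≢ c≁′ q ; (there (there m)) → avoids M m }
      ; edges    = (a , rgg′) ∷ edges M
      ; inside   = (i , i′) ∷ inside M
      ; covers   = AllL.map (there ∘ there) (covers M)
      ; size     = shrinks live ((g , g′) ∷ live) g g′ id refl M
      }

    -- Augmentation along the path g, x, y, g′. Both new edges are listed from their end in G,
    -- because the first ends must remain red neighbours of c.
    exchange : ∀ {live x y g g′} → Match ((x , y) ∷ live) → (G ∖ verts ((x , y) ∷ live)) g ≡ true →
               (G ∖ verts ((x , y) ∷ live)) g′ ≡ true → g ≢ g′ → r g x ≡ true → r g′ y ≡ true →
               Match ((g , x) ∷ (g′ , y) ∷ live)
    exchange {live} {x} {y} {g} {g′} M e e′ g≢ rx ry =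
      let a , i , c≁ = free {(x , y) ∷ live} e
          a′ , i′ , c≁′ = free {(x , y) ∷ live} e′
          ix , iy = AllL.head (inside M)
      in record
      { distinct = Unique-resp-↭ {g ∷ g′ ∷ x ∷ y ∷ verts (live ++ dead)} (prep g reorder)
          ((g≢ ∷ ∉-distinct (unused {(x , y) ∷ live} e)) ∷ ∉-distinct (unused {(x , y) ∷ live} e′) ∷ distinct M)
      ; avoids   = λ { (here q) → r-≢ c≁ q ; (there (here q)) → avoids M (here q)
                     ; (there (there (here q))) → r-≢ c≁′ q ; (there (there (there m))) → avoids M (there m) }
      ; edges    = (a , rx) ∷ (a′ , ry) ∷ AllL.tail (edges M)
      ; inside   = (i , ix) ∷ (i′ , iy) ∷ AllL.tail (inside M)
      ; covers   = AllL.map (∈-resp-↭ (prep g reorder) ∘ there ∘ there) (covers M)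
      ; size     = shrinks ((x , y) ∷ live) ((g , x) ∷ (g′ , y) ∷ live) g g′ (∈-resp-↭ (prep g (↭-sym reorder))) refl M
      }
      where
      reorder : ∀ {zs} → g′ ∷ x ∷ y ∷ zs ↭ x ∷ g′ ∷ y ∷ zs
      reorder = swap g′ x ↭-refl

    step : ∀ {live} → Match live → (∃ λ live′ → Match live′ × (length live′ ≡ suc (length live))) ⊎ Stuck (G ∖ verts live) live
    step {live} M
      with any? (λ g → any? (λ g′ → ((G ∖ verts live) g ≟ᵇ true) ×-dec ((G ∖ verts live) g′ ≟ᵇ true) ×-dec (r g g′ ≟ᵇ true)))
    ... | yes (g , g′ , e , e′ , rgg′) = inj₁ ((g , g′) ∷ live , add M e e′ rgg′ , refl)
    ... | no none
      with AnyL.any? (λ (x , y) → any? (λ g → any? (λ g′ → ((G ∖ verts live) g ≟ᵇ true) ×-dec ((G ∖ verts live) g′ ≟ᵇ true)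
                       ×-dec ¬? (g ≟ g′) ×-dec (r g x ≟ᵇ true) ×-dec (r g′ y ≟ᵇ true)))) live
    ... | no none′ = inj₂ λ g g′ e e′ g≢ →
            (case colour g≢ of λ where
              (inj₁ red)  → ⊥-elim (none (g , g′ , e , e′ , red))
              (inj₂ blue) → blue) ,
            AllL.tabulate λ {(x , y)} m rx ry → none′ (lose m (g , g′ , e , e′ , g≢ , rx , ry))
    ... | yes found = let (x , y) , m , g , g′ , e , e′ , g≢ , rx , ry = find found in swapped m e e′ g≢ rx ry
      where
      swapped : ∀ {x y g g′} → (x , y) ∈ live → (G ∖ verts live) g ≡ true → (G ∖ verts live) g′ ≡ true → g ≢ g′ →
                r g x ≡ true → r g′ y ≡ true →
                (∃ λ live′ → Match live′ × (length live′ ≡ suc (length live))) ⊎ Stuck (G ∖ verts live) live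
      swapped {x} {y} {g} {g′} m e e′ g≢ rx ry =
        let ys , zs , eq = ∈-∃++ m
            p : live ↭ (x , y) ∷ (ys ++ zs)
            p = ↭-trans (↭-reflexive eq) (shift (x , y) ys zs)
            moved : ∀ {h} → (G ∖ verts live) h ≡ true → (G ∖ verts ((x , y) ∷ (ys ++ zs))) h ≡ true
            moved e = let gh , h∉ = ∖-elim G (verts live) e
                      in ∖-intro G (verts ((x , y) ∷ (ys ++ zs))) gh (h∉ ∘ ∈-resp-↭ (↭-sym (verts-↭ p)))
        in inj₁ ((g , x) ∷ (g′ , y) ∷ (ys ++ zs) ,
                 exchange (resp p M) (moved e) (moved e′) g≢ rx ry , cong suc (sym (↭-length p)))

    four : ∀ {live} → Match live → length live + length dead ≡ 4 → l + 8 ≤ K → ⊥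
    four {live} M len le = spider c (live ++ dead) (trans (length-++ live) len)
      (∉-distinct (avoids M) ∷ distinct M)
      (AllL.map (λ {(x , y)} (a , e) → A⊆ x a , e) (edges M))
      (G ∖ verts live) (λ x e → proj₂ (proj₂ (free {live} e))) (λ x e → unused {live} e)
      (lin (l ∷ K ∷ ♯ (G ∖ verts live) ∷ length live + length dead ∷ [])
        ((x₀ ⊕ con 8 ⊑ x₁) ∷ (x₁ ⊑ x₂ ⊕ x₃ ⊕ x₃) ∷ (x₃ ⊑ con 4) ∷ []) (x₀ ⊑ x₂) (1 ∷ 1 ∷ 1 ∷ 2 ∷ []) refl
        le (size M) (≤-reflexive len))

    complete : ∀ s {live} → Match live → length live + length dead + s ≡ 4 → l + 8 ≤ K →
               ∃ λ live′ → Match live′ × (length live′ + length dead ≤ 3) × Stuck (G ∖ verts live′) live′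
    complete zero    M len le = ⊥-elim (four M (trans (sym (+-identityʳ _)) len) le)
    complete (suc s) {live} M len le with step M
    ... | inj₂ stuck = live , M , lin (length live + length dead ∷ s ∷ [])
            ((x₀ ⊕ (con 1 ⊕ x₁) ⊑ con 4) ∷ []) (x₀ ⊑ con 3) (1 ∷ 1 ∷ []) refl (≤-reflexive len) , stuck
    ... | inj₁ (live′ , M′ , len′) = complete s M′
            (trans (cong (λ n → n + length dead + s) len′) (trans (sym (+-suc (length live + length dead) s)) len)) le

  -- g is blue to the rest of L, in addition to its blue neighbours in xs.
  blue-count : ∀ (L Z : Pred N) xs g → Unique xs → L g ≡ true → (∀ x → L x ≡ true → x ∉ xs) →
               (∀ x → L x ≡ true → Z x ≡ true) → (∀ x → L x ≡ true → g ≢ x → b g x ≡ true) →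
               ♯ L + count (Z ∩ b g) xs ≤ suc (♯ (Z ∩ b g))
  blue-count L Z xs g u Lg L∉ LZ blue =
    lin (♯ L ∷ ♯ (L ∖ (g ∷ [])) ∷ count (Z ∩ b g) xs ∷ ♯ ((Z ∩ b g) ∖ xs) ∷ ♯ (Z ∩ b g) ∷ [])
      ((x₀ ⊑ x₁ ⊕ con 1) ∷ (x₁ ⊑ x₃) ∷ (x₂ ⊕ x₃ ⊑ x₄) ∷ []) (x₀ ⊕ x₂ ⊑ con 1 ⊕ x₄) (1 ∷ 1 ∷ 1 ∷ 1 ∷ []) refl
      (♯-∖ L (g ∷ []))
      (♯-mono (L ∖ (g ∷ [])) ((Z ∩ b g) ∖ xs) λ x e →
        let Lx , x∉ = ∖-elim L (g ∷ []) e
        in ∖-intro (Z ∩ b g) xs (true-∧ (LZ x Lx) (blue x Lx λ q → x∉ (here (sym q)))) (L∉ x Lx))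
      (♯-∖-count (Z ∩ b g) u)

  -- An edge x y blocks the exchange in both orientations. One of g x, g′ y is therefore blue, and
  -- so is one of g′ x, g y, which makes two blue edges for each edge of the matching.
  blocked-count : ∀ (Z : Pred N) live g g′ → All (λ (x , y) → (Z x ≡ true) × (Z y ≡ true)) live →
                  g ∉ verts live → g′ ∉ verts live →
                  All (λ (x , y) → r g x ≡ true → r g′ y ≡ true → ⊥) live →
                  All (λ (x , y) → r g′ x ≡ true → r g y ≡ true → ⊥) live →
                  length live + length live ≤ count (Z ∩ b g) (verts live) + count (Z ∩ b g′) (verts live)
  blocked-count Z [] g g′ _ _ _ _ _ = z≤n
  blocked-count Z ((x , y) ∷ live) g g′ ((zx , zy) ∷ zs) g∉ g′∉ (p ∷ ps) (q ∷ qs) =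
    lin (bit ((Z ∩ b g) x) ∷ bit ((Z ∩ b g) y) ∷ bit ((Z ∩ b g′) x) ∷ bit ((Z ∩ b g′) y) ∷
         count (Z ∩ b g) (verts live) ∷ count (Z ∩ b g′) (verts live) ∷ length live ∷ [])
      ((con 1 ⊑ x₀ ⊕ x₃) ∷ (con 1 ⊑ x₂ ⊕ x₁) ∷ (x₆ ⊕ x₆ ⊑ x₄ ⊕ x₅) ∷ [])
      (con 1 ⊕ x₆ ⊕ (con 1 ⊕ x₆) ⊑ x₀ ⊕ (x₁ ⊕ x₄) ⊕ (x₂ ⊕ (x₃ ⊕ x₅))) (1 ∷ 1 ∷ 1 ∷ 1 ∷ []) refl
      (blocked zx zy (λ e → g∉ (here e)) (λ e → g′∉ (there (here e))) p)
      (blocked zx zy (λ e → g′∉ (here e)) (λ e → g∉ (there (here e))) q)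
      (blocked-count Z live g g′ zs (g∉ ∘ there ∘ there) (g′∉ ∘ there ∘ there) ps qs)
    where
    blocked : ∀ {x y g g′} → Z x ≡ true → Z y ≡ true → g ≢ x → g′ ≢ y → (r g x ≡ true → r g′ y ≡ true → ⊥) →
              1 ≤ bit ((Z ∩ b g) x) + bit ((Z ∩ b g′) y)
    blocked {x} {y} {g} {g′} zx zy g≢ g′≢ not-both with colour g≢ | colour g′≢
    ... | inj₂ e | _      rewrite zx | e = s≤s z≤n
    ... | inj₁ _ | inj₂ e rewrite zy | e = m≤n+m 1 _
    ... | inj₁ e | inj₁ f = ⊥-elim (not-both e f)

  -- Averaging over two vertices g and g′ of L: together they have 2(|L| - 1) blue neighbours within
  -- L and, by `blocked-count`, at least two for each edge of the matching, but at most six in all.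
  stuck-bound : ∀ (L Z : Pred N) live → Unique (verts live) →
                All (λ (x , y) → (Z x ≡ true) × (Z y ≡ true)) live →
                (∀ x → L x ≡ true → x ∉ verts live) → (∀ x → L x ≡ true → Z x ≡ true) →
                (∀ x → L x ≡ true → ♯ (Z ∩ b x) ≤ 3) → Stuck L live → 2 ≤ ♯ L → ♯ L + length live ≤ 4
  stuck-bound L Z live u inside L∉ LZ deg stuck two with choose L 2 two
  ... | g ∷ g′ ∷ [] , refl , (g≢ ∷ []) ∷ _ , Lg ∷ Lg′ ∷ [] =
    lin (♯ L ∷ length live ∷ count (Z ∩ b g) (verts live) ∷ count (Z ∩ b g′) (verts live) ∷ ♯ (Z ∩ b g) ∷ ♯ (Z ∩ b g′) ∷ [])
      ((x₀ ⊕ x₂ ⊑ con 1 ⊕ x₄) ∷ (x₀ ⊕ x₃ ⊑ con 1 ⊕ x₅) ∷ (x₁ ⊕ x₁ ⊑ x₂ ⊕ x₃) ∷ (x₄ ⊑ con 3) ∷ (x₅ ⊑ con 3) ∷ [])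
      (x₀ ⊕ x₁ ⊑ con 4) (2 ∷ 1 ∷ 1 ∷ 1 ∷ 1 ∷ 1 ∷ []) refl
      (blue-count L Z (verts live) g u Lg L∉ LZ (λ x Lx ne → proj₁ (stuck g x Lg Lx ne)))
      (blue-count L Z (verts live) g′ u Lg′ L∉ LZ (λ x Lx ne → proj₁ (stuck g′ x Lg′ Lx ne)))
      (blocked-count Z live g g′ inside (L∉ g Lg) (L∉ g′ Lg′)
        (proj₂ (stuck g g′ Lg Lg′ g≢)) (proj₂ (stuck g′ g Lg′ Lg (g≢ ∘ sym))))
      (deg g Lg) (deg g′ Lg′)

  Unique-++ˡ : ∀ (xs : List V) {ys} → Unique (xs ++ ys) → Unique xs
  Unique-++ˡ []       _        = []
  Unique-++ˡ (x ∷ xs) (a ∷ u) = AllP.++⁻ˡ xs a ∷ Unique-++ˡ xs u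

  -- If the augmentation got stuck, then |L| + |live| ≤ 4 and |live| + |dead| ≤ 3, so K ≤ |L| +
  -- 2(|live| + |dead|) ≤ 7 + |dead|. The last hypothesis excludes this, and the one before it
  -- provides the leaves.
  matching-completion :
    ∀ c (A G Z : Pred N) dead live K → (∀ x → A x ≡ true → r c x ≡ true) →
    (∀ x → G x ≡ true → (A x ≡ true) × (Z x ≡ true)) → (∀ x → G x ≡ true → x ∉ verts dead) →
    (∀ x → G x ≡ true → ♯ (Z ∩ b x) ≤ 3) → Matching c A G Z dead [] K live →
    length live + length dead ≤ 4 → l + 8 ≤ K → length dead + 8 ≤ K → ⊥
  matching-completion c A G Z dead live K A⊆ G⊆ G∉ deg M len le le′ =
    let s , eq = slack len
        live′ , M′ , len′ , stuck = complete s M eq le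
        bound = stuck-bound (G ∖ verts live′) Z live′
          (Unique-++ˡ (verts live′) (subst Unique (verts-++ live′ dead) (Matching.distinct M′))) (Matching.inside M′)
          (λ x e → proj₂ (∖-elim G (verts live′) e)) (λ x e → proj₂ (G⊆ x (proj₁ (∖-elim G (verts live′) e))))
          (λ x e → deg x (proj₁ (∖-elim G (verts live′) e))) stuck
          (lin (♯ (G ∖ verts live′) ∷ length live′ ∷ length dead ∷ K ∷ [])
            ((x₃ ⊑ x₀ ⊕ (x₁ ⊕ x₂) ⊕ (x₁ ⊕ x₂)) ∷ (x₁ ⊕ x₂ ⊑ con 3) ∷ (x₂ ⊕ con 8 ⊑ x₃) ∷ []) (con 2 ⊑ x₀) (1 ∷ 1 ∷ 2 ∷ 1 ∷ []) refl
            (Matching.size M′) len′ le′)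
    in lin⊥ (♯ (G ∖ verts live′) ∷ length live′ ∷ length dead ∷ K ∷ [])
         ((x₃ ⊑ x₀ ⊕ (x₁ ⊕ x₂) ⊕ (x₁ ⊕ x₂)) ∷ (x₁ ⊕ x₂ ⊑ con 3) ∷ (x₂ ⊕ con 8 ⊑ x₃) ∷ (x₀ ⊕ x₁ ⊑ con 4) ∷ []) (1 ∷ 1 ∷ 1 ∷ 1 ∷ []) refl
         (Matching.size M′) len′ le′ bound
    where
    open Augment c A G Z dead [] K A⊆ G⊆ G∉
    slack : ∀ {m} → m ≤ 4 → ∃ λ s → m + s ≡ 4
    slack le = _ , m+[n∸m]≡n le

  colour-split : ∀ (P : Pred N) x → ♯ P ≤ ♯ (P ∩ r x) + ♯ (P ∩ b x) + 1
  colour-split P x = lin (♯ P ∷ ♯ (P ∩ r x) ∷ ♯ (P ∩ ¬ᵖ r x) ∷ ♯ ((P ∩ ¬ᵖ r x) ∖ (x ∷ [])) ∷ ♯ (P ∩ b x) ∷ [])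
    ((x₀ ⊑ x₁ ⊕ x₂) ∷ (x₂ ⊑ x₃ ⊕ con 1) ∷ (x₃ ⊑ x₄) ∷ []) (x₀ ⊑ x₁ ⊕ x₄ ⊕ con 1) (1 ∷ 1 ∷ 1 ∷ 1 ∷ []) refl
    (♯-split P (r x)) (♯-∖ (P ∩ ¬ᵖ r x) (x ∷ []))
    (♯-mono ((P ∩ ¬ᵖ r x) ∖ (x ∷ [])) (P ∩ b x) λ y e →
      let e′ , y∉ = ∖-elim (P ∩ ¬ᵖ r x) (x ∷ []) e
          p , nr  = ∧-true {P y} e′
      in true-∧ p (case colour {x} {y} (λ q → y∉ (here (sym q))) of λ where
           (inj₁ red)  → ⊥-elim (true≢false nr (cong not red))
           (inj₂ blue) → blue))

  colour-split-∉ : ∀ (P : Pred N) x → P x ≡ false → ♯ P ≤ ♯ (P ∩ r x) + ♯ (P ∩ b x)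
  colour-split-∉ P x out = ♯-cover P (P ∩ r x) (P ∩ b x) λ y p →
    case colour {x} {y} (λ { refl → true≢false p out }) of λ where
      (inj₁ red)  → inj₁ (true-∧ p red)
      (inj₂ blue) → inj₂ (true-∧ p blue)

  -- Matchings between two sets, and pairs of sets joined in blue

  firsts seconds : List (V × V) → List V
  firsts  = map proj₁
  seconds = map proj₂

  ∈-firsts : ∀ {x} ps → x ∈ firsts ps → ∃ λ y → (x , y) ∈ ps
  ∈-firsts ((x , y) ∷ ps) (here refl) = y , here refl
  ∈-firsts (p ∷ ps)       (there m)   = let y , m′ = ∈-firsts ps m in y , there m′

  ∈-seconds : ∀ {y} ps → y ∈ seconds ps → ∃ λ x → (x , y) ∈ ps
  ∈-seconds ((x , y) ∷ ps) (here refl) = x , here refl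
  ∈-seconds (p ∷ ps)       (there m)   = let x , m′ = ∈-seconds ps m in x , there m′

  first-∈ : ∀ {x y ps} → (x , y) ∈ ps → x ∈ firsts ps
  first-∈ (here refl) = here refl
  first-∈ (there m)   = there (first-∈ m)

  second-∈ : ∀ {x y ps} → (x , y) ∈ ps → y ∈ seconds ps
  second-∈ (here refl) = here refl
  second-∈ (there m)   = there (second-∈ m)

  firsts⊆verts : ∀ ps {x} → x ∈ firsts ps → x ∈ verts ps
  firsts⊆verts ps m = proj₁ (∈-verts (proj₂ (∈-firsts ps m)))

  seconds⊆verts : ∀ ps {x} → x ∈ seconds ps → x ∈ verts ps
  seconds⊆verts ps m = proj₂ (∈-verts (proj₂ (∈-seconds ps m)))

  verts-split : ∀ ps {x} → x ∈ verts ps → (x ∈ firsts ps) ⊎ (x ∈ seconds ps)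
  verts-split ((x , y) ∷ ps) (here q)          = inj₁ (here q)
  verts-split ((x , y) ∷ ps) (there (here q))  = inj₂ (here q)
  verts-split ((x , y) ∷ ps) (there (there m)) with verts-split ps m
  ... | inj₁ k = inj₁ (there k)
  ... | inj₂ k = inj₂ (there k)

  verts-unique : ∀ (A : Pred N) ps → All (λ (x , y) → (A x ≡ true) × (A y ≡ false)) ps →
                 Unique (firsts ps) → Unique (seconds ps) → Unique (verts ps)
  verts-unique A []             _              _        _        = []
  verts-unique A ((x , y) ∷ ps) ((a , n) ∷ as) (f ∷ fs) (s ∷ ss) =
    ((λ { refl → true≢false a n }) ∷ ∉-distinct λ m → case verts-split ps m of λ where
        (inj₁ k) → distinct-∉ f k
        (inj₂ k) → true≢false a (proj₂ (AllL.lookup as (proj₂ (∈-seconds ps k))))) ∷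
    (∉-distinct λ m → case verts-split ps m of λ where
        (inj₁ k) → true≢false (proj₁ (AllL.lookup as (proj₂ (∈-firsts ps k)))) n
        (inj₂ k) → distinct-∉ s k) ∷
    verts-unique A ps as fs ss

  greedy : ∀ (A : Pred N) us → (∀ {u} → u ∈ us → length us ≤ ♯ (A ∩ r u)) →
           ∃ λ ps → (seconds ps ≡ us) × All (λ (x , y) → (A x ≡ true) × (r x y ≡ true)) ps × Unique (firsts ps)
  greedy A []       _   = [] , refl , [] , []
  greedy A (u ∷ us) big with greedy A us (λ m → ≤-trans (m≤n+m _ 1) (big (there m)))
  ... | ps , refl , es , f with pick (A ∩ r u) (firsts ps)
          (subst (λ n → suc n ≤ ♯ (A ∩ r u)) (trans (length-map proj₂ ps) (sym (length-map proj₁ ps))) (big (here refl)))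
  ... | x , e , x∉ = (x , u) ∷ ps , refl , (proj₁ (∧-true e) , r-sym (proj₂ (∧-true {A x} e))) ∷ es , ∉-distinct x∉ ∷ f

  -- Otherwise q is the hub of a wheel whose rim alternates between P and the blue neighbours of q
  -- in Q.
  joined-bound : ∀ (P Q : Pred N) → (∀ x y → P x ≡ true → Q y ≡ true → b x y ≡ true) → 4 ≤ ♯ P →
                 ∀ q → Q q ≡ true → ♯ (Q ∩ b q) ≤ 3
  joined-bound P Q PQ four q Qq with 4 ≤? ♯ (Q ∩ b q)
  ... | no n = lin (♯ (Q ∩ b q) ∷ []) ((x₀ ⊏ con 4) ∷ []) (x₀ ⊑ con 3) (1 ∷ 1 ∷ []) refl (≰⇒> n)
  ... | yes p with choose P 4 four
  ... | ys , len , u , all = ⊥-elim (wheel-complete len (AllL.map (λ {y} e → b-sym (PQ y q e Qq)) all) u (Q ∩ b q)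
          (λ x e → proj₂ (∧-true {Q x} e)) (λ m x e → PQ _ x (AllL.lookup all m) (proj₁ (∧-true e))) p)

  -- Any vertex q of Q is the centre of a spider some of whose legs end in the blue neighbours of q in Q.
  joined-large : ∀ (P Q : Pred N) → (∀ x y → P x ≡ true → Q y ≡ true → b x y ≡ true) → 4 ≤ ♯ P → l + 9 ≤ ♯ Q → ⊥
  joined-large P Q PQ four large
    with inhabited Q (lin (l ∷ ♯ Q ∷ []) ((x₀ ⊕ con 9 ⊑ x₁) ∷ []) (con 1 ⊑ x₁) (1 ∷ 1 ∷ []) refl large)
  ... | q , Qq with choose (Q ∩ b q) (♯ (Q ∩ b q)) ≤-refl
  ... | us , len , u , all =
    matching-completion q A A Q [] ps (l + 8)
      (λ x e → proj₂ (∧-true {Q x} e)) (λ x e → e , proj₁ (∧-true e)) (λ _ _ ()) (λ x e → deg x (proj₁ (∧-true e)))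
      record
      { distinct = subst (λ zs → Unique (verts zs)) (sym (++-identityʳ ps))
                     (verts-unique A ps (AllL.tabulate λ m → proj₁ (AllL.lookup es m) , not-A (subst (_ ∈_) sec (second-∈ m))) f
                       (subst Unique (sym sec) u))
      ; avoids   = λ m → q∉ (subst (λ zs → q ∈ verts zs) (++-identityʳ ps) m)
      ; edges    = subst (All _) (sym (++-identityʳ ps)) es
      ; inside   = AllL.tabulate λ {(x , y)} m → proj₁ (∧-true (proj₁ (AllL.lookup es m))) ,
                     proj₁ (∧-true (AllL.lookup all (subst (y ∈_) sec (second-∈ m))))
      ; covers   = []
      -- Apart from q, every vertex of Q is in A or in `us`, and each edge uses one vertex of either
      -- kind. Hence the sum is at least |Q| - 1.
      ; size     = lin (l ∷ ♯ A ∷ ♯ (A ∖ firsts ps) ∷ ♯ (A ∖ verts ps) ∷ length (firsts ps) ∷ length ps ∷ ♯ Q ∷ ♯ (Q ∩ b q) ∷ [])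
          ((x₁ ⊑ x₂ ⊕ x₄) ∷ (x₂ ⊑ x₃) ∷ (x₄ ⊑ x₅) ∷ (x₅ ⊑ x₇) ∷ (x₇ ⊑ x₅) ∷ (x₆ ⊑ x₁ ⊕ x₇ ⊕ con 1) ∷ (x₀ ⊕ con 9 ⊑ x₆) ∷ [])
          (x₀ ⊕ con 8 ⊑ x₃ ⊕ (x₅ ⊕ con 0) ⊕ (x₅ ⊕ con 0)) (1 ∷ 1 ∷ 1 ∷ 1 ∷ 0 ∷ 1 ∷ 1 ∷ 1 ∷ []) refl
          (♯-∖ A (firsts ps))
          (♯-mono (A ∖ firsts ps) (A ∖ verts ps) λ x e →
             let a , x∉ = ∖-elim A (firsts ps) e
             in ∖-intro A (verts ps) a λ m → case verts-split ps m of λ where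
                  (inj₁ k) → x∉ k
                  (inj₂ k) → true≢false a (not-A (subst (x ∈_) sec k)))
          (≤-reflexive (length-map proj₁ ps)) (≤-reflexive lenps) (≤-reflexive (sym lenps))
          (colour-split Q q) large
      }
      (lin (length ps ∷ ♯ (Q ∩ b q) ∷ []) ((x₀ ⊑ x₁) ∷ (x₁ ⊑ con 3) ∷ []) (x₀ ⊕ con 0 ⊑ con 4) (1 ∷ 1 ∷ 1 ∷ []) refl
        (≤-reflexive lenps) (deg q Qq))
      ≤-refl (m≤n+m 8 l)
    where
    A : Pred N
    A = Q ∩ r q
    deg : ∀ x → Q x ≡ true → ♯ (Q ∩ b x) ≤ 3
    deg = joined-bound P Q PQ four
    not-A : ∀ {u} → u ∈ us → A u ≡ false
    not-A {u} m = ¬-not λ e → true≢false (proj₂ (∧-true {Q u} e)) (b⇒¬r (proj₂ (∧-true {Q u} (AllL.lookup all m))))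
    -- One of the at most three blue neighbours of u is q, so at most two lie in A. As |A| ≥ l + 5,
    -- at least three vertices of A are red to u.
    degree : ∀ {u} → u ∈ us → length us ≤ ♯ (A ∩ r u)
    degree {u} m =
      lin (length us ∷ ♯ A ∷ ♯ (A ∩ r u) ∷ ♯ (A ∩ b u) ∷ ♯ (Q ∩ b u) ∷ ♯ (Q ∩ b q) ∷ ♯ Q ∷ l ∷ [])
        ((x₀ ⊑ x₅) ∷ (x₅ ⊑ con 3) ∷ (x₁ ⊑ x₂ ⊕ x₃) ∷ (con 1 ⊕ x₃ ⊑ x₄) ∷ (x₄ ⊑ con 3) ∷ (x₆ ⊑ x₁ ⊕ x₅ ⊕ con 1) ∷ (x₇ ⊕ con 9 ⊑ x₆) ∷ [])
        (x₀ ⊑ x₂) (1 ∷ 1 ∷ 2 ∷ 1 ∷ 1 ∷ 1 ∷ 1 ∷ 1 ∷ []) refl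
        (≤-reflexive len) (deg q Qq) (colour-split-∉ A u (not-A m))
        (♯-∷ (Q ∩ b u) (A ∩ b u) q (true-∧ Qq (b-sym (proj₂ (∧-true {Q u} Qu))))
          (¬-not λ e → true≢false (proj₂ (∧-true {Q q} (proj₁ (∧-true e)))) (adj-irrefl F q))
          (λ y e → true-∧ (proj₁ (∧-true (proj₁ (∧-true e)))) (proj₂ (∧-true {A y} e))))
        (deg u (proj₁ (∧-true Qu))) (colour-split Q q) large
      where
      Qu : (Q ∩ b q) u ≡ true
      Qu = AllL.lookup all m
    matched : _
    matched = greedy A us degree
    ps : List (V × V)
    ps = proj₁ matched
    sec : seconds ps ≡ us
    sec = proj₁ (proj₂ matched)
    es : All (λ (x , y) → (A x ≡ true) × (r x y ≡ true)) ps
    es = proj₁ (proj₂ (proj₂ matched))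
    f : Unique (firsts ps)
    f = proj₂ (proj₂ (proj₂ matched))
    q∉ : q ∉ verts ps
    q∉ m with verts-split ps m
    ... | inj₁ k = true≢false (proj₂ (∧-true {Q q} (proj₁ (AllL.lookup es (proj₂ (∈-firsts ps k)))))) (adj-irrefl F q)
    ... | inj₂ k = b-≢ (proj₂ (∧-true {Q q} (AllL.lookup all (subst (q ∈_) sec k)))) refl
    lenps : length ps ≡ ♯ (Q ∩ b q)
    lenps = trans (sym (length-map proj₂ ps)) (trans (cong length sec) len)

  -- König's theorem for the red edges between A and C

  Red : List (V × V) → Set
  Red = All (λ (x , y) → r x y ≡ true)

  -- Only the sets of matched ends are tracked, up to permutation, because an augmentation may pair
  -- them quite differently.
  Augmented : Pred N → Pred N → List (V × V) → Set
  Augmented A₀ C₀ M = ∃ λ M′ → ∃ λ a → ∃ λ c → (A₀ a ≡ true) × (C₀ c ≡ true) × Red M′ ×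
    (firsts M′ ↭ a ∷ firsts M) × (seconds M′ ↭ c ∷ seconds M)

  -- The first ends of Ma and the second ends of Mc cover all red edges between A₀ ∪ firsts M and C₀ ∪ seconds M.
  Covered : Pred N → Pred N → List (V × V) → Set
  Covered A₀ C₀ M = ∃ λ Ma → ∃ λ Mc → (M ↭ Ma ++ Mc) ×
    (∀ x y → (A₀ x ≡ true) ⊎ (x ∈ firsts Mc) → (C₀ y ≡ true) ⊎ (y ∈ seconds Ma) → r x y ≡ true → ⊥)

  -- This replaces a search for alternating paths. If a free a₀ is red to cᵢ, the edge aᵢ cᵢ is
  -- removed and aᵢ is declared free. An augmentation of the smaller matching that uses aᵢ is
  -- completed by a₀ cᵢ, and any other one by restoring aᵢ cᵢ. If there is none, the cover of the
  -- smaller problem is enlarged by cᵢ.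
  augment : ∀ n M → length M ≡ n → (A₀ C₀ : Pred N) → Red M → Augmented A₀ C₀ M ⊎ Covered A₀ C₀ M
  augment n M len A₀ C₀ es
    with any? (λ a → any? (λ c → (A₀ a ≟ᵇ true) ×-dec (C₀ c ≟ᵇ true) ×-dec (r a c ≟ᵇ true)))
  ... | yes (a , c , Aa , Cc , e) = inj₁ ((a , c) ∷ M , a , c , Aa , Cc , e ∷ es , ↭-refl , ↭-refl)
  ... | no none with AnyL.any? (λ (_ , y) → any? (λ a → (A₀ a ≟ᵇ true) ×-dec (r a y ≟ᵇ true))) M
  ... | no none′ = inj₂ (M , [] , ↭-reflexive (sym (++-identityʳ M)) , uncovered)
    where
    uncovered : ∀ x y → (A₀ x ≡ true) ⊎ (x ∈ []) → (C₀ y ≡ true) ⊎ (y ∈ seconds M) → r x y ≡ true → ⊥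
    uncovered x y (inj₁ Ax) (inj₁ Cy) e = none (x , y , Ax , Cy , e)
    uncovered x y (inj₁ Ax) (inj₂ m)  e = none′ (lose (proj₂ (∈-seconds M m)) (x , Ax , e))
  augment zero    []      len A₀ C₀ es | no none | yes ()
  augment (suc n) M       len A₀ C₀ es | no none | yes found = reach (find found)
    where
    reach : (∃ λ p → p ∈ M × ∃ λ a → (A₀ a ≡ true) × (r a (proj₂ p) ≡ true)) → Augmented A₀ C₀ M ⊎ Covered A₀ C₀ M
    reach ((aᵢ , cᵢ) , m , a₀ , A₀a₀ , e₀) with ∈-∃++ m
    ... | ys , zs , refl = extend (augment n M₁ len₁ A₁ C₀ es₁)
      where
      M₁ : List (V × V)
      M₁ = ys ++ zs
      p : ys ++ (aᵢ , cᵢ) ∷ zs ↭ (aᵢ , cᵢ) ∷ M₁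
      p = shift (aᵢ , cᵢ) ys zs
      len₁ : length M₁ ≡ n
      len₁ = suc-injective (trans (sym (↭-length p)) len)
      A₁ : Pred N
      A₁ = A₀ ∪ member (aᵢ ∷ [])
      es₁ : Red M₁
      es₁ = AllL.tail (All-resp-↭ p es)
      eᵢ : r aᵢ cᵢ ≡ true
      eᵢ = AllL.head (All-resp-↭ p es)
      extend : Augmented A₁ C₀ M₁ ⊎ Covered A₁ C₀ M₁ →
               Augmented A₀ C₀ (ys ++ (aᵢ , cᵢ) ∷ zs) ⊎ Covered A₀ C₀ (ys ++ (aᵢ , cᵢ) ∷ zs)
      extend (inj₁ (M′ , a , c , A₁a , Cc , es′ , pf , ps)) with ∪-elim {A₀ a} A₁a
      ... | inj₁ Aa = inj₁ ((aᵢ , cᵢ) ∷ M′ , a , c , Aa , Cc , eᵢ ∷ es′ ,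
              ↭-trans (prep aᵢ pf) (↭-trans (swap aᵢ a ↭-refl) (prep a (map⁺ proj₁ (↭-sym p)))) ,
              ↭-trans (prep cᵢ ps) (↭-trans (swap cᵢ c ↭-refl) (prep c (map⁺ proj₂ (↭-sym p)))))
      ... | inj₂ m with member-∈ (aᵢ ∷ []) m
      ... | here refl = inj₁ ((a₀ , cᵢ) ∷ M′ , a₀ , c , A₀a₀ , Cc , e₀ ∷ es′ ,
              prep a₀ (↭-trans pf (map⁺ proj₁ (↭-sym p))) ,
              ↭-trans (prep cᵢ ps) (↭-trans (swap cᵢ c ↭-refl) (prep c (map⁺ proj₂ (↭-sym p)))))
      extend (inj₂ (Ma , Mc , q , cover)) =
        inj₂ (Ma , (aᵢ , cᵢ) ∷ Mc , ↭-trans p (↭-trans (prep _ q) (↭-sym (shift _ Ma Mc))) , cover′)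
        where
        cover′ : ∀ x y → (A₀ x ≡ true) ⊎ (x ∈ aᵢ ∷ firsts Mc) → (C₀ y ≡ true) ⊎ (y ∈ seconds Ma) → r x y ≡ true → ⊥
        cover′ x y (inj₁ Ax)            = cover x y (inj₁ (∪-left Ax))
        cover′ x y (inj₂ (here refl))   = cover x y (inj₁ (∪-right {A₀ x} (∈-member (aᵢ ∷ []) (here refl))))
        cover′ x y (inj₂ (there m))     = cover x y (inj₂ m)

  record Bipartite (A C : Pred N) (M : List (V × V)) : Set where
    field
      edges          : All (λ (x , y) → (A x ≡ true) × (C y ≡ true) × (r x y ≡ true)) M
      unique-firsts  : Unique (firsts M)
      unique-seconds : Unique (seconds M)

  König : Pred N → Pred N → Set
  König A C = ∃ λ Ma → ∃ λ Mc → Bipartite A C (Ma ++ Mc) × (length Ma + length Mc ≤ 3) ×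
    (∀ x y → (A ∖ firsts Ma) x ≡ true → (C ∖ seconds Mc) y ≡ true → r x y ≡ false)

  könig : ∀ s (A C : Pred N) M → Bipartite A C M → length M + s ≡ 4 →
          (∃ λ M′ → Bipartite A C M′ × (length M′ ≡ 4)) ⊎ König A C
  könig zero    A C M B len = inj₁ (M , B , trans (sym (+-identityʳ _)) len)
  könig (suc s) A C M B len
    with augment (length M) M refl (A ∖ firsts M) (C ∖ seconds M) (AllL.map (λ (_ , _ , e) → e) (Bipartite.edges B))
  ... | inj₁ (M′ , a , c , Aa , Cc , es , pf , ps) = könig s A C M′
          record
          { edges          = AllL.tabulate λ {(x , y)} m →
              All-resp-↭ (↭-sym pf) (proj₁ (∖-elim A (firsts M) Aa) ∷ AllP.map⁺ (AllL.map proj₁ (Bipartite.edges B)))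
                ∋ first-∈ m ,
              All-resp-↭ (↭-sym ps) (proj₁ (∖-elim C (seconds M) Cc) ∷ AllP.map⁺ (AllL.map (λ (_ , q , _) → q) (Bipartite.edges B)))
                ∋ second-∈ m ,
              AllL.lookup es m
          ; unique-firsts  = Unique-resp-↭ (↭-sym pf)
              (∉-distinct (proj₂ (∖-elim A (firsts M) Aa)) ∷ Bipartite.unique-firsts B)
          ; unique-seconds = Unique-resp-↭ (↭-sym ps)
              (∉-distinct (proj₂ (∖-elim C (seconds M) Cc)) ∷ Bipartite.unique-seconds B)
          }
          (trans (cong (_+ s) (trans (sym (length-map proj₁ M′)) (trans (↭-length pf) (cong suc (length-map proj₁ M)))))
                 (trans (sym (+-suc (length M) s)) len))
    where
    _∋_ : ∀ {P : V → Set} {xs x} → All P xs → x ∈ xs → P x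
    ps ∋ m = AllL.lookup ps m
  ... | inj₂ (Ma , Mc , p , cover) = inj₂ (Ma , Mc ,
          record
          { edges          = All-resp-↭ p (Bipartite.edges B)
          ; unique-firsts  = Unique-resp-↭ (map⁺ proj₁ p) (Bipartite.unique-firsts B)
          ; unique-seconds = Unique-resp-↭ (map⁺ proj₂ p) (Bipartite.unique-seconds B)
          } ,
          lin (length M ∷ length Ma + length Mc ∷ s ∷ []) ((x₀ ⊕ (con 1 ⊕ x₂) ⊑ con 4) ∷ (x₁ ⊑ x₀) ∷ []) (x₁ ⊑ con 3) (1 ∷ 1 ∷ 1 ∷ []) refl
            (≤-reflexive len) (≤-reflexive (trans (sym (length-++ Ma)) (sym (↭-length p)))) ,
          λ x y Ax Cy → ¬-not (cover x y (left x Ax) (right y Cy)))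
    where
    left : ∀ x → (A ∖ firsts Ma) x ≡ true → ((A ∖ firsts M) x ≡ true) ⊎ (x ∈ firsts Mc)
    left x e with ∖-elim A (firsts Ma) e | bool-cases (member (firsts M) x)
    ... | Ax , x∉ | inj₂ n = inj₁ (true-∧ Ax (cong not n))
    ... | Ax , x∉ | inj₁ e′ with ∈-++⁻ (firsts Ma) (subst (x ∈_) (map-++ proj₁ Ma Mc) (∈-resp-↭ (map⁺ proj₁ p) (member-∈ (firsts M) e′)))
    ... | inj₁ k = ⊥-elim (x∉ k)
    ... | inj₂ k = inj₂ k
    right : ∀ y → (C ∖ seconds Mc) y ≡ true → ((C ∖ seconds M) y ≡ true) ⊎ (y ∈ seconds Ma)
    right y e with ∖-elim C (seconds Mc) e | bool-cases (member (seconds M) y)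
    ... | Cy , y∉ | inj₂ n = inj₁ (true-∧ Cy (cong not n))
    ... | Cy , y∉ | inj₁ e′ with ∈-++⁻ (seconds Ma) (subst (y ∈_) (map-++ proj₂ Ma Mc) (∈-resp-↭ (map⁺ proj₂ p) (member-∈ (seconds M) e′)))
    ... | inj₁ k = inj₂ k
    ... | inj₂ k = ⊥-elim (y∉ k)

  -- Covers of the red edges that leave a neighbourhood of the centre

  module Centre (c : V) (A C : Pred N) (A⊆ : ∀ x → A x ≡ true → r c x ≡ true)
    (C∩A : ∀ x → C x ≡ true → A x ≡ false) (C∌c : C c ≡ false) where

    A-sides : ∀ {M} → Bipartite A C M → All (λ (x , y) → (A x ≡ true) × (A y ≡ false)) M
    A-sides B = AllL.map (λ (a , q , _) → a , C∩A _ q) (Bipartite.edges B)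

    distinct : ∀ {M} → Bipartite A C M → Unique (verts M)
    distinct {M} B = verts-unique A M (A-sides B) (Bipartite.unique-firsts B) (Bipartite.unique-seconds B)

    avoids : ∀ {M} → Bipartite A C M → c ∉ verts M
    avoids {M} B m with verts-split M m
    ... | inj₁ k = r-≢ (A⊆ c (proj₁ (AllL.lookup (Bipartite.edges B) (proj₂ (∈-firsts M k))))) refl
    ... | inj₂ k = true≢false (proj₁ (proj₂ (AllL.lookup (Bipartite.edges B) (proj₂ (∈-seconds M k))))) C∌c

    red-edges : ∀ {M} → Bipartite A C M → All (λ (x , y) → (A x ≡ true) × (r x y ≡ true)) M
    red-edges B = AllL.map (λ (a , _ , e) → a , e) (Bipartite.edges B)

    unused-verts : ∀ {M} → Bipartite A C M → ∀ x → (A ∖ firsts M) x ≡ true → (A ∖ verts M) x ≡ true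
    unused-verts {M} B x e = let a , x∉ = ∖-elim A (firsts M) e in
      ∖-intro A (verts M) a λ m → case verts-split M m of λ where
        (inj₁ k) → x∉ k
        (inj₂ k) → true≢false a (proj₂ (AllL.lookup (A-sides B) (proj₂ (∈-seconds M k))))

    used : ∀ {M} → Bipartite A C M → ♯ A ≤ ♯ (A ∖ verts M) + length M
    used {M} B = ≤-trans (♯-∖ A (firsts M))
      (+-mono-≤ (♯-mono (A ∖ firsts M) (A ∖ verts M) (unused-verts B)) (≤-reflexive (length-map proj₁ M)))

    no-four : ∀ {M} → Bipartite A C M → length M ≡ 4 → l + 4 ≤ ♯ A → ⊥
    no-four {M} B len le = spider c M len (∉-distinct (avoids B) ∷ distinct B)
      (AllL.map (λ {(x , y)} (a , e) → A⊆ x a , e) (red-edges B))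
      (A ∖ verts M) (λ x e → A⊆ x (proj₁ (∖-elim A (verts M) e))) (λ x e → proj₂ (∖-elim A (verts M) e))
      (lin (l ∷ ♯ A ∷ ♯ (A ∖ verts M) ∷ length M ∷ []) ((x₀ ⊕ con 4 ⊑ x₁) ∷ (x₁ ⊑ x₂ ⊕ x₃) ∷ (x₃ ⊑ con 4) ∷ []) (x₀ ⊑ x₂) (1 ∷ 1 ∷ 1 ∷ 1 ∷ []) refl
        le (used B) (≤-reflexive len))

    cover : l + 4 ≤ ♯ A → König A C
    cover le with könig 4 A C [] (record { edges = [] ; unique-firsts = [] ; unique-seconds = [] }) refl
    ... | inj₁ (M , B , len) = ⊥-elim (no-four B len le)
    ... | inj₂ k = k

    module Cover (Ma Mc : List (V × V)) (B : Bipartite A C (Ma ++ Mc))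
      (uncovered : ∀ x y → (A ∖ firsts Ma) x ≡ true → (C ∖ seconds Mc) y ≡ true → r x y ≡ false) where

      A′ Q : Pred N
      A′ = A ∖ firsts Ma
      Q  = C ∖ seconds Mc

      A′⊆ : ∀ {x} → A′ x ≡ true → A x ≡ true
      A′⊆ e = proj₁ (∖-elim A (firsts Ma) e)

      Q⊆ : ∀ {x} → Q x ≡ true → C x ≡ true
      Q⊆ e = proj₁ (∖-elim C (seconds Mc) e)

      A-C≢ : ∀ {x y} → A x ≡ true → C y ≡ true → x ≢ y
      A-C≢ a q refl = true≢false a (C∩A _ q)

      joined : ∀ x y → A′ x ≡ true → Q y ≡ true → b x y ≡ true
      joined x y a q = ¬r⇒b (A-C≢ (A′⊆ a) (Q⊆ q)) (uncovered x y a q)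

      ♯A′ : ♯ A ≤ ♯ A′ + length Ma
      ♯A′ = ≤-trans (♯-∖ A (firsts Ma)) (+-mono-≤ (≤-refl {♯ A′}) (≤-reflexive (length-map proj₁ Ma)))

      ♯Q : ♯ C ≤ ♯ Q + length Mc
      ♯Q = ≤-trans (♯-∖ C (seconds Mc)) (+-mono-≤ (≤-refl {♯ Q}) (≤-reflexive (length-map proj₂ Mc)))

      A′-degree : 4 ≤ ♯ Q → ∀ x → A′ x ≡ true → ♯ (A′ ∩ b x) ≤ 3
      A′-degree four x a = few-blue x A′ Q (λ y → joined x y a) (λ y z a′ → joined y z a′) four

      G : Pred N
      G = A ∖ verts (Ma ++ Mc)

      G⊆A′ : ∀ x → G x ≡ true → A′ x ≡ true
      G⊆A′ x e = let a , x∉ = ∖-elim A (verts (Ma ++ Mc)) e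
                 in ∖-intro A (firsts Ma) a λ m → x∉ (subst (x ∈_) (sym (verts-++ Ma Mc)) (∈-++⁺ˡ (firsts⊆verts Ma m)))

      length-M : length (Ma ++ Mc) ≡ length Ma + length Mc
      length-M = length-++ Ma

  -- Red degree at least n - 1

  large-degree : ∀ c → l + 8 ≤ ♯ (r c) → ⊥
  large-degree c le with shrink (r c) (l + 8) le
  -- Exactly n - 1 neighbours are kept, so that C has n - 1 vertices too. After the removal of at
  -- most three of them, four remain to bound the blue degrees in `A′`.
  ... | A , ♯A , A⊆ = contradiction (cover (lin (l ∷ ♯ A ∷ []) ((x₀ ⊕ con 8 ⊑ x₁) ∷ []) (x₀ ⊕ con 4 ⊑ x₁) (1 ∷ 1 ∷ []) refl (≤-reflexive (sym ♯A))))
    where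
    C : Pred N
    C = (¬ᵖ A) ∖ (c ∷ [])
    C-elim : ∀ {x} → C x ≡ true → (A x ≡ false) × (x ∉ c ∷ [])
    C-elim {x} e = let n , x∉ = ∖-elim (¬ᵖ A) (c ∷ []) e
                   in ¬-not (λ a → true≢false n (cong not a)) , x∉
    open Centre c A C A⊆ (λ x e → proj₁ (C-elim e)) (¬-not λ e → proj₂ (C-elim e) (here refl))
    ♯C : l + 8 ≤ ♯ C
    ♯C = lin (l ∷ ♯ A ∷ ♯ (¬ᵖ A) ∷ ♯ C ∷ N ∷ [])
      ((x₄ ⊑ x₁ ⊕ x₂) ∷ (x₁ ⊑ x₀ ⊕ con 8) ∷ (x₂ ⊑ x₃ ⊕ con 1) ∷ (x₀ ⊕ x₀ ⊕ con 17 ⊑ x₄) ∷ []) (x₀ ⊕ con 8 ⊑ x₃) (1 ∷ 1 ∷ 1 ∷ 1 ∷ 1 ∷ []) refl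
      (≤-trans (≤-reflexive (sym (♯-full N))) (♯-split full A))
      (≤-reflexive ♯A) (♯-∖ (¬ᵖ A) (c ∷ [])) (≤-reflexive (sym order≡))
    contradiction : König A C → ⊥
    contradiction (Ma , Mc , B , small , uncovered) =
      -- The whole König matching is dead: its second ends lie in C, and blue degrees are under
      -- control only inside `A′`.
      matching-completion c A G A′ (Ma ++ Mc) [] (♯ A + length (Ma ++ Mc)) A⊆
        (λ x e → A′⊆ (G⊆A′ x e) , G⊆A′ x e)
        (λ x e → proj₂ (∖-elim A (verts (Ma ++ Mc)) e))
        (λ x e → A′-degree (lin (♯ C ∷ ♯ Q ∷ length Mc ∷ length Ma ∷ l ∷ [])
             ((x₀ ⊑ x₁ ⊕ x₂) ∷ (x₃ ⊕ x₂ ⊑ con 3) ∷ (x₄ ⊕ con 8 ⊑ x₀) ∷ []) (con 4 ⊑ x₁) (1 ∷ 1 ∷ 1 ∷ 1 ∷ []) refl ♯Q small ♯C) x (G⊆A′ x e))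
        record
        { distinct = distinct B
        ; avoids   = avoids B
        ; edges    = red-edges B
        ; inside   = []
        ; covers   = []
        ; size     = lin (♯ A ∷ ♯ (G ∖ []) ∷ length (Ma ++ Mc) ∷ ♯ G ∷ [])
            ((x₀ ⊑ x₃ ⊕ x₂) ∷ (x₃ ⊑ x₁ ⊕ con 0) ∷ []) (x₀ ⊕ x₂ ⊑ x₁ ⊕ x₂ ⊕ x₂) (1 ∷ 1 ∷ 1 ∷ []) refl
            (used B) (♯-∖ G [])
        }
        (lin (length (Ma ++ Mc) ∷ length Ma + length Mc ∷ []) ((x₀ ⊑ x₁) ∷ (x₁ ⊑ con 3) ∷ []) (x₀ ⊑ con 4) (1 ∷ 1 ∷ 1 ∷ []) refl
          (≤-reflexive length-M) small)
        (≤-trans (≤-reflexive (sym ♯A)) (m≤m+n (♯ A) _))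
        (lin (length (Ma ++ Mc) ∷ ♯ A ∷ l ∷ []) ((x₂ ⊕ con 8 ⊑ x₁) ∷ []) (x₀ ⊕ con 8 ⊑ x₁ ⊕ x₀) (1 ∷ 1 ∷ []) refl (≤-reflexive (sym ♯A)))
      where open Cover Ma Mc B uncovered

  -- Maximal red degree between n - 5 and n - 2

  ♯-inter : ∀ (S P R : Pred N) → (∀ x → P x ≡ true → S x ≡ true) → (∀ x → R x ≡ true → S x ≡ true) →
            ♯ P + ♯ R ≤ ♯ S + ♯ (P ∩ R)
  ♯-inter S P R P⊆ R⊆ = lin (♯ P ∷ ♯ R ∷ ♯ S ∷ ♯ (P ∩ R) ∷ ♯ (P ∩ ¬ᵖ R) ∷ [])
    ((x₀ ⊑ x₃ ⊕ x₄) ∷ (x₄ ⊕ x₁ ⊑ x₂) ∷ []) (x₀ ⊕ x₁ ⊑ x₂ ⊕ x₃) (1 ∷ 1 ∷ 1 ∷ []) refl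
    (♯-split P R)
    (♯-disjoint S (P ∩ ¬ᵖ R) R (λ x e → P⊆ x (proj₁ (∧-true e))) R⊆
      λ x e q → true≢false (proj₂ (∧-true {P x} e)) (cong not q))

  ♯-∪-singleton : ∀ (P : Pred N) x → P x ≡ false → 1 + ♯ P ≤ ♯ (P ∪ member (x ∷ []))
  ♯-∪-singleton P x out = ♯-∷ (P ∪ member (x ∷ [])) P x (∪-right {P x} (∈-member (x ∷ []) (here refl))) out (λ _ → ∪-left)

  Unique-++-∉ : ∀ (xs : List V) {ys x} → Unique (xs ++ ys) → x ∈ ys → x ∉ xs
  Unique-++-∉ (z ∷ xs) (n ∷ u) m (here refl) = distinct-∉ (AllP.++⁻ʳ xs n) m
  Unique-++-∉ (z ∷ xs) (n ∷ u) m (there k)   = Unique-++-∉ xs u m k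

  Bipartite-↭ : ∀ {A C M M′} → M ↭ M′ → Bipartite A C M → Bipartite A C M′
  Bipartite-↭ p B = record
    { edges          = All-resp-↭ p (Bipartite.edges B)
    ; unique-firsts  = Unique-resp-↭ (map⁺ proj₁ p) (Bipartite.unique-firsts B)
    ; unique-seconds = Unique-resp-↭ (map⁺ proj₂ p) (Bipartite.unique-seconds B)
    }

  module Middle (c : V) (low : l + 4 ≤ ♯ (r c)) (high : ♯ (r c) ≤ l + 7) (maximal : ∀ x → ♯ (r x) ≤ ♯ (r c))
    (Ma Mc : List (V × V)) (B : Bipartite (r c) (b c) (Ma ++ Mc)) (small : length Ma + length Mc ≤ 3)
    (uncovered : ∀ x y → (r c ∖ firsts Ma) x ≡ true → (b c ∖ seconds Mc) y ≡ true → r x y ≡ false) where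

    open Centre c (r c) (b c) (λ _ e → e) (λ _ → b⇒¬r) (adj-irrefl H c) public
    open Cover Ma Mc B uncovered public

    i j : ℕ
    i = length Ma
    j = length Mc

    -- `Z` is the region of the live edges. The edges of `Mc` run from `A′` to `U`; those of `Ma`
    -- start at covering vertices, outside `A′`, and are therefore kept dead.
    U Z : Pred N
    U = member (seconds Mc)
    Z = A′ ∪ U

    ♯C : l + l + 16 ≤ ♯ (r c) + ♯ (b c)
    ♯C = lin (l ∷ ♯ (r c) ∷ ♯ (b c) ∷ N ∷ ♯ (full {N}) ∷ [])
      ((x₀ ⊕ x₀ ⊕ con 17 ⊑ x₃) ∷ (x₃ ⊑ x₄) ∷ (x₄ ⊑ x₁ ⊕ x₂ ⊕ con 1) ∷ []) (x₀ ⊕ x₀ ⊕ con 16 ⊑ x₁ ⊕ x₂) (1 ∷ 1 ∷ 1 ∷ 1 ∷ []) refl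
      (≤-reflexive (sym order≡)) (≤-reflexive (sym (♯-full N))) (colour-split full c)

    ♯Q≥ : l + l + 16 ≤ ♯ (r c) + ♯ Q + j
    ♯Q≥ = lin (l ∷ ♯ (r c) ∷ ♯ (b c) ∷ ♯ Q ∷ j ∷ [])
      ((x₀ ⊕ x₀ ⊕ con 16 ⊑ x₁ ⊕ x₂) ∷ (x₂ ⊑ x₃ ⊕ x₄) ∷ []) (x₀ ⊕ x₀ ⊕ con 16 ⊑ x₁ ⊕ x₃ ⊕ x₄) (1 ∷ 1 ∷ 1 ∷ []) refl ♯C ♯Q

    four-Q : 4 ≤ ♯ Q
    four-Q = lin (l ∷ ♯ (r c) ∷ ♯ Q ∷ i ∷ j ∷ [])
      ((x₀ ⊕ x₀ ⊕ con 16 ⊑ x₁ ⊕ x₂ ⊕ x₄) ∷ (x₁ ⊑ x₀ ⊕ con 7) ∷ (x₃ ⊕ x₄ ⊑ con 3) ∷ []) (con 4 ⊑ x₂) (1 ∷ 1 ∷ 1 ∷ 1 ∷ []) refl ♯Q≥ high small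

    A′-out : ∀ {x} → b c x ≡ true → A′ x ≡ false
    A′-out e = ¬-not λ a → true≢false (A′⊆ a) (b⇒¬r e)

    Q-out : ∀ {x} → r c x ≡ true → Q x ≡ false
    Q-out e = ¬-not λ q → true≢false (Q⊆ q) (r⇒¬b e)

    U-edge : ∀ {u} → U u ≡ true → b c u ≡ true
    U-edge {u} e = let x , m = ∈-seconds Mc (member-∈ (seconds Mc) e)
                   in proj₁ (proj₂ (AllL.lookup (Bipartite.edges B) (∈-++⁺ʳ Ma m)))

    U-out : ∀ {u} → U u ≡ true → Q u ≡ false
    U-out e = ¬-not λ q → proj₂ (∖-elim (b c) (seconds Mc) q) (member-∈ (seconds Mc) e)

    first-A′ : ∀ {x} → x ∈ firsts Mc → A′ x ≡ true
    first-A′ {x} m =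
      let y , m′ = ∈-firsts Mc m
      in ∖-intro (r c) (firsts Ma) (proj₁ (AllL.lookup (Bipartite.edges B) (∈-++⁺ʳ Ma m′)))
           (Unique-++-∉ (firsts Ma) (subst Unique (map-++ proj₁ Ma Mc) (Bipartite.unique-firsts B)) m)

    -- c itself is blue to all of C, so three further vertices suffice.
    three-joined : ∀ (P R : Pred N) → P c ≡ false → (∀ y → R y ≡ true → b c y ≡ true) →
                   (∀ x y → P x ≡ true → R y ≡ true → b x y ≡ true) → 3 ≤ ♯ P → l + 9 ≤ ♯ R → ⊥
    three-joined P R out R⊆ PR three large =
      joined-large (P ∪ member (c ∷ [])) R join (≤-trans (s≤s three) (♯-∪-singleton P c out)) large
      where
      join : ∀ x y → (P ∪ member (c ∷ [])) x ≡ true → R y ≡ true → b x y ≡ true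
      join x y e q with ∪-elim {P x} e
      ... | inj₁ p = PR x y p q
      ... | inj₂ m with member-∈ (c ∷ []) m
      ... | here refl = R⊆ y q

    A′c : A′ c ≡ false
    A′c = ¬-not λ a → true≢false (A′⊆ a) (adj-irrefl F c)

    few-seconds : 3 ≤ ♯ A′ → ♯ (r c) + j ≤ l + 7 → ⊥
    few-seconds three le = three-joined A′ Q A′c (λ y → Q⊆) joined three
      (lin (l ∷ ♯ (r c) ∷ ♯ Q ∷ j ∷ [])
        ((x₀ ⊕ x₀ ⊕ con 16 ⊑ x₁ ⊕ x₂ ⊕ x₃) ∷ (x₁ ⊕ x₃ ⊑ x₀ ⊕ con 7) ∷ []) (x₀ ⊕ con 9 ⊑ x₂) (2 ∷ 2 ∷ 2 ∷ []) refl ♯Q≥ le)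

    live-dead : Bipartite (r c) (b c) (Mc ++ Ma)
    live-dead = Bipartite-↭ (++-comm Ma Mc) B

    G∉ : ∀ x → G x ≡ true → x ∉ verts Ma
    G∉ x e m = proj₂ (∖-elim (r c) (verts (Ma ++ Mc)) e) (subst (x ∈_) (sym (verts-++ Ma Mc)) (∈-++⁺ˡ m))

    -- Each König edge takes one vertex from the neighbourhood of c and counts twice, hence the
    -- value D + i + j. Listing the second ends of `Mc` as covered lets `Loose` find them again
    -- after augmentation.
    initial : Matching c (r c) G Z Ma (seconds Mc) (♯ (r c) + (i + j)) Mc
    initial = record
      { distinct = distinct live-dead
      ; avoids   = avoids live-dead
      ; edges    = red-edges live-dead
      ; inside   = AllL.tabulate λ {(x , y)} m →
          ∪-left (first-A′ (first-∈ m)) , ∪-right {A′ y} (∈-member (seconds Mc) (second-∈ m))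
      ; covers   = AllL.tabulate (seconds⊆verts Mc)
      ; size     = lin (♯ (r c) ∷ ♯ G ∷ ♯ (G ∖ verts Mc) ∷ i ∷ j ∷ length (Ma ++ Mc) ∷ [])
          ((x₀ ⊑ x₁ ⊕ x₅) ∷ (x₁ ⊑ x₂) ∷ (x₅ ⊑ x₃ ⊕ x₄) ∷ [])
          (x₀ ⊕ (x₃ ⊕ x₄) ⊑ x₂ ⊕ (x₄ ⊕ x₃) ⊕ (x₄ ⊕ x₃)) (1 ∷ 1 ∷ 1 ∷ 1 ∷ []) refl
          (used B)
          (♯-mono G (G ∖ verts Mc) λ x e → ∖-intro G (verts Mc) e λ m →
            proj₂ (∖-elim (r c) (verts (Ma ++ Mc)) e) (subst (x ∈_) (sym (verts-++ Ma Mc)) (∈-++⁺ʳ (verts Ma) m)))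
          (≤-reflexive length-M)
      }

    module Tight (three : 3 ≤ ♯ A′) (tight : ♯ (r c) + j ≡ l + 8) where

      Q≥ : l + 8 ≤ ♯ Q
      Q≥ = lin (l ∷ ♯ (r c) ∷ ♯ Q ∷ j ∷ [])
        ((x₀ ⊕ x₀ ⊕ con 16 ⊑ x₁ ⊕ x₂ ⊕ x₃) ∷ (x₁ ⊕ x₃ ⊑ x₀ ⊕ con 8) ∷ []) (x₀ ⊕ con 8 ⊑ x₂) (2 ∷ 2 ∷ 2 ∷ []) refl ♯Q≥ (≤-reflexive tight)

      i≤2 : i ≤ 2
      i≤2 = lin (l ∷ ♯ (r c) ∷ i ∷ j ∷ [])
        ((x₁ ⊑ x₀ ⊕ con 7) ∷ (x₂ ⊕ x₃ ⊑ con 3) ∷ (x₀ ⊕ con 8 ⊑ x₁ ⊕ x₃) ∷ []) (x₂ ⊑ con 2) (1 ∷ 1 ∷ 1 ∷ 1 ∷ []) refl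
        high small (≤-reflexive (sym tight))

      -- `Q` is one vertex short of a forbidden pair. With three blue neighbours in `A′`, the vertex
      -- u could be added to `Q`, and c would be the fourth vertex on the other side.
      blue-seconds : ∀ u → U u ≡ true → ♯ (A′ ∩ b u) ≤ 2
      blue-seconds u e with 3 ≤? ♯ (A′ ∩ b u)
      ... | no n = lin (♯ (A′ ∩ b u) ∷ []) ((x₀ ⊏ con 3) ∷ []) (x₀ ⊑ con 2) (1 ∷ 1 ∷ []) refl (≰⇒> n)
      ... | yes p = ⊥-elim (three-joined (A′ ∩ b u) (Q ∪ member (u ∷ []))
                (cong (_∧ b u c) A′c) sub join p
                (≤-trans (lin (l ∷ ♯ Q ∷ []) ((x₀ ⊕ con 8 ⊑ x₁) ∷ []) (x₀ ⊕ con 9 ⊑ con 1 ⊕ x₁) (1 ∷ 1 ∷ []) refl Q≥)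
                         (♯-∪-singleton Q u (U-out e))))
        where
        sub : ∀ y → (Q ∪ member (u ∷ [])) y ≡ true → b c y ≡ true
        sub y q with ∪-elim {Q y} q
        ... | inj₁ k = Q⊆ k
        ... | inj₂ m with member-∈ (u ∷ []) m
        ... | here refl = U-edge e
        join : ∀ x y → (A′ ∩ b u) x ≡ true → (Q ∪ member (u ∷ [])) y ≡ true → b x y ≡ true
        join x y a q with ∧-true {A′ x} a | ∪-elim {Q y} q
        ... | a′ , _  | inj₁ k = joined x y a′ k
        ... | _  , bu | inj₂ m with member-∈ (u ∷ []) m
        ... | here refl = b-sym bu

      -- A vertex of `U` has at most D red edges, and spends at least D - i - 2 of them on `A′`.
      missing : ∀ y → Z y ≡ true → ♯ (Q ∩ ¬ᵖ b y) ≤ i + 2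
      missing y e with ∪-elim {A′ y} e
      ... | inj₁ a = ≤-trans (≤-reflexive (♯-∅ (Q ∩ ¬ᵖ b y) λ x q →
              true≢false (proj₂ (∧-true {Q x} q)) (cong not (joined y x a (proj₁ (∧-true q)))))) z≤n
      ... | inj₂ u = lin (♯ (Q ∩ ¬ᵖ b y) ∷ ♯ (Q ∩ r y) ∷ ♯ (A′ ∩ r y) ∷ ♯ (A′ ∩ b y) ∷ ♯ A′ ∷ ♯ (r y) ∷ ♯ (r c) ∷ i ∷ [])
              ((x₀ ⊑ x₁) ∷ (x₁ ⊕ x₂ ⊑ x₅) ∷ (x₄ ⊑ x₂ ⊕ x₃) ∷ (x₃ ⊑ con 2) ∷ (x₅ ⊑ x₆) ∷ (x₆ ⊑ x₄ ⊕ x₇) ∷ [])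
              (x₀ ⊑ x₇ ⊕ con 2) (1 ∷ 1 ∷ 1 ∷ 1 ∷ 1 ∷ 1 ∷ 1 ∷ []) refl
              (♯-mono (Q ∩ ¬ᵖ b y) (Q ∩ r y) λ x q → let k , n = ∧-true {Q x} q in
                true-∧ k (case colour {y} {x} (λ { refl → true≢false k (U-out u) }) of λ where
                  (inj₁ red)  → red
                  (inj₂ blue) → ⊥-elim (true≢false n (cong not blue))))
              (♯-disjoint (r y) (Q ∩ r y) (A′ ∩ r y) (λ x q → proj₂ (∧-true {Q x} q)) (λ x q → proj₂ (∧-true {A′ x} q))
                λ x q a → true≢false (proj₁ (∧-true a)) (A′-out (Q⊆ (proj₁ (∧-true q)))))
              (colour-split-∉ A′ y (A′-out (U-edge u)))
              (blue-seconds y u) (maximal y) ♯A′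

      common : ∀ y z → Z y ≡ true → Z z ≡ true → ♯ Q ≤ ♯ (Q ∩ b y ∩ b z) + (i + 2) + (i + 2)
      common y z Zy Zz = lin (♯ Q ∷ ♯ (Q ∩ b y ∩ b z) ∷ ♯ (Q ∩ b y) ∷ ♯ (Q ∩ ¬ᵖ b y) ∷ ♯ (Q ∩ ¬ᵖ b z) ∷ i ∷ [])
        ((x₀ ⊑ x₂ ⊕ x₃) ∷ (x₂ ⊑ x₁ ⊕ x₄) ∷ (x₃ ⊑ x₅ ⊕ con 2) ∷ (x₄ ⊑ x₅ ⊕ con 2) ∷ [])
        (x₀ ⊑ x₁ ⊕ (x₅ ⊕ con 2) ⊕ (x₅ ⊕ con 2)) (1 ∷ 1 ∷ 1 ∷ 1 ∷ 1 ∷ []) refl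
        (♯-split Q (b y))
        (♯-cover (Q ∩ b y) (Q ∩ b y ∩ b z) (Q ∩ ¬ᵖ b z) λ x e → let q , e′ = ∧-true {Q x} e in
          case bool-cases (b z x) of λ where
            (inj₁ t) → inj₁ (true-∧ q (true-∧ e′ t))
            (inj₂ f) → inj₂ (true-∧ q (cong not f)))
        (missing y Zy) (missing z Zz)

      half : ∀ x y → A′ x ≡ true → Z y ≡ true → 4 ≤ ♯ (Q ∩ b x ∩ b y)
      half x y a e = lin (♯ Q ∷ ♯ (Q ∩ b y) ∷ ♯ (Q ∩ ¬ᵖ b y) ∷ ♯ (Q ∩ b x ∩ b y) ∷ i ∷ l ∷ [])
        ((x₀ ⊑ x₁ ⊕ x₂) ∷ (x₂ ⊑ x₄ ⊕ con 2) ∷ (x₁ ⊑ x₃) ∷ (x₄ ⊑ con 2) ∷ (x₅ ⊕ con 8 ⊑ x₀) ∷ []) (con 4 ⊑ x₃) (1 ∷ 1 ∷ 1 ∷ 1 ∷ 1 ∷ 1 ∷ []) refl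
        (♯-split Q (b y)) (missing y e)
        (♯-mono (Q ∩ b y) (Q ∩ b x ∩ b y) λ z q → let k , q′ = ∧-true {Q z} q in true-∧ k (true-∧ (joined x z a k) q′))
        i≤2 Q≥

      half′ : ∀ x y → A′ x ≡ true → Z y ≡ true → 4 ≤ ♯ (Q ∩ b y ∩ b x)
      half′ x y a e = ≤-trans (half x y a e) (♯-mono (Q ∩ b x ∩ b y) (Q ∩ b y ∩ b x) λ z q →
        let k , q′ = ∧-true {Q z} q ; bx , by = ∧-true {b x z} q′ in true-∧ k (true-∧ by bx))

      Z-out : ∀ {y} → Z y ≡ true → Q y ≡ false
      Z-out {y} e with ∪-elim {A′ y} e
      ... | inj₁ a = Q-out (A′⊆ a)
      ... | inj₂ u = U-out u

      -- Two blue neighbours of g in `A′` can alternate on the rim with two others, so that no link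
      -- has to serve two vertices of `U`. With at most one in `A′`, no covering vertex lies in the
      -- neighbourhood of c, and any two vertices of `Z` miss at most four vertices of `Q` together.
      Z-degree : ∀ g → A′ g ≡ true → ♯ (Z ∩ b g) ≤ 3
      Z-degree g a with 4 ≤? ♯ (Z ∩ b g)
      ... | no n = lin (♯ (Z ∩ b g) ∷ []) ((x₀ ⊏ con 4) ∷ []) (x₀ ⊑ con 3) (1 ∷ 1 ∷ []) refl (≰⇒> n)
      ... | yes four with 2 ≤? ♯ (A′ ∩ b g)
      ... | yes two with choose (A′ ∩ b g) 2 two
      ... | a₁ ∷ a₂ ∷ [] , refl , (a₁₂ ∷ []) ∷ _ , e₁ ∷ e₂ ∷ []
        with pick (Z ∩ b g) (a₁ ∷ a₂ ∷ []) (≤-trans (s≤s (s≤s (s≤s z≤n))) four)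
      ... | y , ey , y∉ with pick (Z ∩ b g) (y ∷ a₁ ∷ a₂ ∷ []) four
      ... | z , ez , z∉ with ∉-distinct y∉ | ∉-distinct z∉
      ... | ya₁ ∷ ya₂ ∷ [] | zy ∷ za₁ ∷ za₂ ∷ [] = ⊥-elim
        (wheel-pool {g} {a₁} {y} {a₂} {z} (proj₂ (∧-true {A′ a₁} e₁) ∷ proj₂ (∧-true {Z y} ey) ∷ proj₂ (∧-true {A′ a₂} e₂) ∷ proj₂ (∧-true {Z z} ez) ∷ [])
          ((ya₁ ∘ sym ∷ a₁₂ ∷ za₁ ∘ sym ∷ []) ∷ (ya₂ ∷ zy ∘ sym ∷ []) ∷ (za₂ ∘ sym ∷ []) ∷ [] ∷ [])
          Q (λ x → joined g x a) (Q-out (A′⊆ A₁) ∷ Z-out Zy ∷ Q-out (A′⊆ A₂) ∷ Z-out Zz ∷ [])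
          (≤-trans (s≤s z≤n) (half a₁ y A₁ Zy)) (≤-trans (s≤s (s≤s z≤n)) (half′ a₂ y A₂ Zy))
          (≤-trans (s≤s (s≤s (s≤s z≤n))) (half a₂ z A₂ Zz)) (half′ a₁ z A₁ Zz))
        where
        A₁ = proj₁ (∧-true {A′ a₁} e₁)
        A₂ = proj₁ (∧-true {A′ a₂} e₂)
        Zy = proj₁ (∧-true {Z y} ey)
        Zz = proj₁ (∧-true {Z z} ez)
      Z-degree g a | yes four | no few with choose (Z ∩ b g) 4 four
      ... | y₁ ∷ y₂ ∷ y₃ ∷ y₄ ∷ [] , refl , u , e₁ ∷ e₂ ∷ e₃ ∷ e₄ ∷ [] = ⊥-elim
        (wheel-pool (blue y₁ e₁ ∷ blue y₂ e₂ ∷ blue y₃ e₃ ∷ blue y₄ e₄ ∷ []) u Q (λ x → joined g x a)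
          (Z-out (in-Z y₁ e₁) ∷ Z-out (in-Z y₂ e₂) ∷ Z-out (in-Z y₃ e₃) ∷ Z-out (in-Z y₄ e₄) ∷ [])
          (≤-trans (s≤s z≤n) (enough y₁ y₂ e₁ e₂)) (≤-trans (s≤s (s≤s z≤n)) (enough y₂ y₃ e₂ e₃))
          (≤-trans (s≤s (s≤s (s≤s z≤n))) (enough y₃ y₄ e₃ e₄)) (enough y₄ y₁ e₄ e₁))
        where
        blue : ∀ y → (Z ∩ b g) y ≡ true → b g y ≡ true
        blue y e = proj₂ (∧-true {Z y} e)
        in-Z : ∀ y → (Z ∩ b g) y ≡ true → Z y ≡ true
        in-Z y e = proj₁ (∧-true {Z y} e)
        -- At least three of the y's are in U, so j = 3 and i = 0.
        i≡0 : i ≤ 0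
        i≡0 = lin (♯ (Z ∩ b g) ∷ ♯ (A′ ∩ b g) ∷ ♯ U ∷ length (seconds Mc) ∷ i ∷ j ∷ [])
          ((con 4 ⊑ x₀) ∷ (x₀ ⊑ x₁ ⊕ x₂) ∷ (x₁ ⊏ con 2) ∷ (x₂ ⊑ x₃) ∷ (x₃ ⊑ x₅) ∷ (x₄ ⊕ x₅ ⊑ con 3) ∷ []) (x₄ ⊑ con 0) (1 ∷ 1 ∷ 1 ∷ 1 ∷ 1 ∷ 1 ∷ 1 ∷ []) refl
          four
          (♯-cover (Z ∩ b g) (A′ ∩ b g) U λ x e → let z , bx = ∧-true {Z x} e in case ∪-elim {A′ x} z of λ where
            (inj₁ k) → inj₁ (true-∧ k bx)
            (inj₂ k) → inj₂ k)
          (≰⇒> few) (♯-member (seconds Mc)) (≤-reflexive (length-map proj₂ Mc)) small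
        enough : ∀ y z → (Z ∩ b g) y ≡ true → (Z ∩ b g) z ≡ true → 4 ≤ ♯ (Q ∩ b y ∩ b z)
        enough y z ey ez = lin (♯ Q ∷ ♯ (Q ∩ b y ∩ b z) ∷ i ∷ l ∷ [])
          ((x₀ ⊑ x₁ ⊕ (x₂ ⊕ con 2) ⊕ (x₂ ⊕ con 2)) ∷ (x₂ ⊑ con 0) ∷ (x₃ ⊕ con 8 ⊑ x₀) ∷ []) (con 4 ⊑ x₁) (1 ∷ 1 ∷ 2 ∷ 1 ∷ []) refl
          (common y z (in-Z y ey) (in-Z z ez)) i≡0 Q≥

      impossible : ⊥
      impossible = matching-completion c (r c) G Z Ma Mc (♯ (r c) + (i + j)) (λ _ e → e)
        (λ x e → A′⊆ (G⊆A′ x e) , ∪-left (G⊆A′ x e)) G∉ (λ x e → Z-degree x (G⊆A′ x e))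
        (record { Matching initial ; covers = [] })
        (lin (i ∷ j ∷ []) ((x₀ ⊕ x₁ ⊑ con 3) ∷ []) (x₁ ⊕ x₀ ⊑ con 4) (1 ∷ 1 ∷ []) refl small)
        (lin (l ∷ ♯ (r c) ∷ i ∷ j ∷ []) ((x₀ ⊕ con 8 ⊑ x₁ ⊕ x₃) ∷ []) (x₀ ⊕ con 8 ⊑ x₁ ⊕ (x₂ ⊕ x₃)) (1 ∷ 1 ∷ []) refl (≤-reflexive (sym tight)))
        (lin (l ∷ ♯ (r c) ∷ i ∷ j ∷ []) ((x₀ ⊕ con 8 ⊑ x₁ ⊕ x₃) ∷ []) (x₂ ⊕ con 8 ⊑ x₁ ⊕ (x₂ ⊕ x₃)) (1 ∷ 1 ∷ []) refl (≤-reflexive (sym tight)))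

  -- The case D + j ≥ n: three vertices left over by a maximal matching

  pairs-apart : ∀ ps {x y x′ y′} → Unique (verts ps) → (x , y) ∈ ps → (x′ , y′) ∈ ps → y ≢ y′ → (x ≢ x′) × (x ≢ y′)
  pairs-apart _               ((n ∷ _) ∷ _)   (here refl) (here refl) ne = ⊥-elim (ne refl)
  pairs-apart ((x , y) ∷ ps)  ((_ ∷ nx) ∷ _)  (here refl) (there m)   ne =
    (λ { refl → distinct-∉ nx (proj₁ (∈-verts m)) }) , (λ { refl → distinct-∉ nx (proj₂ (∈-verts m)) })
  pairs-apart ((x , y) ∷ ps)  ((_ ∷ nx) ∷ ny ∷ _) (there m) (here refl) ne =
    (λ { refl → distinct-∉ nx (proj₁ (∈-verts m)) }) , (λ { refl → distinct-∉ ny (proj₁ (∈-verts m)) })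
  pairs-apart ((x , y) ∷ ps)  (_ ∷ _ ∷ u)     (there m)   (there m′)  ne = pairs-apart ps u m m′ ne

  unique-seconds : ∀ ps → Unique (verts ps) → Unique (seconds ps)
  unique-seconds []             _                  = []
  unique-seconds ((x , y) ∷ ps) (_ ∷ n ∷ u) =
    ∉-distinct (λ m → distinct-∉ n (seconds⊆verts ps m)) ∷ unique-seconds ps u

  module Loose (c : V) (low : l + 4 ≤ ♯ (r c)) (high : ♯ (r c) ≤ l + 7) (maximal : ∀ x → ♯ (r x) ≤ ♯ (r c))
    (Ma Mc : List (V × V)) (B : Bipartite (r c) (b c) (Ma ++ Mc)) (small : length Ma + length Mc ≤ 3)
    (uncovered : ∀ x y → (r c ∖ firsts Ma) x ≡ true → (b c ∖ seconds Mc) y ≡ true → r x y ≡ false)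
    (loose : l + 9 ≤ ♯ (r c) + length Mc) where

    open Middle c low high maximal Ma Mc B small uncovered
    open Augment c (r c) G Z Ma (seconds Mc) (♯ (r c) + (i + j)) (λ _ e → e) (λ x e → A′⊆ (G⊆A′ x e) , ∪-left (G⊆A′ x e)) G∉

    module Final (live : List (V × V)) (M : Match live) (short : length live + i ≤ 3) (stuck : Stuck (G ∖ verts live) live) where

      L : Pred N
      L = G ∖ verts live

      L⊆A′ : ∀ {x} → L x ≡ true → A′ x ≡ true
      L⊆A′ {x} e = G⊆A′ x (proj₁ (∖-elim G (verts live) e))

      L∉ : ∀ x → L x ≡ true → x ∉ verts live
      L∉ x e = proj₂ (∖-elim G (verts live) e)

      unique : Unique (verts live)
      unique = Unique-++ˡ (verts live) (subst Unique (verts-++ live Ma) (Matching.distinct M))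

      L-size : ♯ (r c) + (i + j) ≤ ♯ L + (length live + i) + (length live + i)
      L-size = Matching.size M

      three : 3 ≤ ♯ L
      three = lin (l ∷ ♯ (r c) ∷ i ∷ j ∷ ♯ L ∷ length live ∷ [])
        ((x₁ ⊕ (x₂ ⊕ x₃) ⊑ x₄ ⊕ (x₅ ⊕ x₂) ⊕ (x₅ ⊕ x₂)) ∷ (x₅ ⊕ x₂ ⊑ con 3) ∷ (x₀ ⊕ con 9 ⊑ x₁ ⊕ x₃) ∷ []) (con 3 ⊑ x₄) (1 ∷ 1 ∷ 2 ∷ 1 ∷ []) refl
        L-size short loose

      -- Being blue to the rest of `L` already consumes |L| - 1 of the at most three blue neighbours
      -- of g in `A′`.
      crowded : ∀ xs g → Unique xs → L g ≡ true → All (_∈ verts live) xs → ♯ L + count (A′ ∩ b g) xs ≤ 4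
      crowded xs g u Lg sub = ≤-trans
        (blue-count L A′ xs g u Lg (λ x e m → L∉ x e (AllL.lookup sub m)) (λ x e → L⊆A′ e)
          (λ x e ne → proj₁ (stuck g x Lg e ne)))
        (s≤s (A′-degree four-Q g (L⊆A′ Lg)))

      blue-bit : ∀ g x → A′ x ≡ true → b g x ≡ true → 1 ≤ bit ((A′ ∩ b g) x)
      blue-bit g x a e rewrite a | e = ≤-refl

      -- The vertex u is still matched, say to x. As g u is red, a red edge from another h in `L` to
      -- x would give the augmenting path h, x, u, g.
      record Partner (u g : V) : Set where
        field
          x     : V
          pair  : (x , u) ∈ live
          in-A′ : A′ x ≡ true
          blue  : ∀ h → L h ≡ true → g ≢ h → b h x ≡ true

      first-in-A′ : ∀ {x y} → (x , y) ∈ live → A′ x ≡ true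
      first-in-A′ {x} {y} m with ∪-elim {A′ x} (proj₁ (AllL.lookup (Matching.inside M) m))
      ... | inj₁ a = a
      ... | inj₂ e = ⊥-elim (true≢false (proj₁ (AllL.lookup (Matching.edges M) (∈-++⁺ˡ m))) (b⇒¬r (U-edge e)))

      partner : ∀ u g → U u ≡ true → L g ≡ true → r g u ≡ true → Partner u g
      partner u g Uu Lg rgu with verts-split live (AllL.lookup (Matching.covers M) (member-∈ (seconds Mc) Uu))
      ... | inj₁ m = ⊥-elim (true≢false (proj₁ (AllL.lookup (Matching.edges M) (∈-++⁺ˡ (proj₂ (∈-firsts live m))))) (b⇒¬r (U-edge Uu)))
      ... | inj₂ m with ∈-seconds live m
      ... | x , m′ = record
        { x     = x
        ; pair  = m′
        ; in-A′ = first-in-A′ m′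
        ; blue  = λ h Lh ne → case colour {h} {x} (λ { refl → L∉ h Lh (proj₁ (∈-verts m′)) }) of λ where
            (inj₁ red)  → ⊥-elim (AllL.lookup (proj₂ (stuck h g Lh Lg (ne ∘ sym))) m′ red rgu)
            (inj₂ blue) → blue
        }

      -- A vertex h of `L` other than g and g′ would be blue to two distinct partners and to at
      -- least two vertices of `L`, all in `A′`.
      only-one : ∀ u u′ g g′ → U u ≡ true → U u′ ≡ true → L g ≡ true → L g′ ≡ true →
                 r g u ≡ true → r g′ u′ ≡ true → u ≢ u′ → ⊥
      only-one u u′ g g′ Uu Uu′ Lg Lg′ e e′ ne with pick L (g ∷ g′ ∷ []) three
      ... | h , Lh , h∉ =
        lin⊥ (♯ L ∷ bit ((A′ ∩ b h) P.x) ∷ bit ((A′ ∩ b h) P′.x) ∷ [])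
          ((con 3 ⊑ x₀) ∷ (con 1 ⊑ x₁) ∷ (con 1 ⊑ x₂) ∷ (x₀ ⊕ (x₁ ⊕ (x₂ ⊕ con 0)) ⊑ con 4) ∷ []) (1 ∷ 1 ∷ 1 ∷ 1 ∷ []) refl three
          (blue-bit h P.x P.in-A′ (P.blue h Lh λ q → h∉ (here (sym q))))
          (blue-bit h P′.x P′.in-A′ (P′.blue h Lh λ q → h∉ (there (here (sym q)))))
          (crowded (P.x ∷ P′.x ∷ []) h ((proj₁ (pairs-apart live unique P.pair P′.pair ne) ∷ []) ∷ [] ∷ []) Lh
            (proj₁ (∈-verts P.pair) ∷ proj₁ (∈-verts P′.pair) ∷ []))
        where
        module P  = Partner (partner u g Uu Lg e)
        module P′ = Partner (partner u′ g′ Uu′ Lg′ e′)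

      exactly-three : ∀ u g → U u ≡ true → L g ≡ true → r g u ≡ true → ♯ L ≤ 3
      exactly-three u g Uu Lg e with pick L (g ∷ []) (≤-trans (s≤s (s≤s z≤n)) three)
      ... | h , Lh , h∉ = lin (♯ L ∷ bit ((A′ ∩ b h) P.x) ∷ [])
          ((con 1 ⊑ x₁) ∷ (x₀ ⊕ (x₁ ⊕ con 0) ⊑ con 4) ∷ []) (x₀ ⊑ con 3) (1 ∷ 1 ∷ 1 ∷ []) refl
          (blue-bit h P.x P.in-A′ (P.blue h Lh λ q → h∉ (here (sym q))))
          (crowded (P.x ∷ []) h ([] ∷ []) Lh (proj₁ (∈-verts P.pair) ∷ []))
        where module P = Partner (partner u g Uu Lg e)

      L-joined : ∀ (R : Pred N) → (∀ u → U u ≡ true → R u ≡ true → ∀ g → L g ≡ true → r g u ≡ true → ⊥) →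
                 (∀ y → R y ≡ true → b c y ≡ true) → l + 9 ≤ ♯ R → ⊥
      L-joined R blue R⊆ = three-joined L R (¬-not λ e → true≢false (L⊆A′ e) A′c) R⊆ join three
        where
        join : ∀ x y → L x ≡ true → R y ≡ true → b x y ≡ true
        join x y e q with bool-cases (U y)
        ... | inj₂ n = joined x y (L⊆A′ e) (true-∧ (R⊆ y q) (cong not n))
        ... | inj₁ u with colour {x} {y} (A-C≢ (A′⊆ (L⊆A′ e)) (R⊆ y q))
        ... | inj₁ red   = ⊥-elim (blue y u q x e red)
        ... | inj₂ blue′ = blue′

      -- If some u is red to L then one more vertex of C must be dropped, which is affordable unless c has red degree l + 7; then
      -- some edge of the matching lies inside A′ and can be exchanged.
      one-red : ∀ u g → U u ≡ true → L g ≡ true → r g u ≡ true → ⊥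
      one-red u g Uu Lg e with ♯ (r c) ≤? l + 6
      ... | yes le = L-joined (b c ∖ (u ∷ []))
            (λ u′ Uu′ q g′ Lg′ e′ → only-one u u′ g g′ Uu Uu′ Lg Lg′ e e′ λ eq → proj₂ (∖-elim (b c) (u ∷ []) q) (here (sym eq)))
            (λ y q → proj₁ (∖-elim (b c) (u ∷ []) q))
            (lin (l ∷ ♯ (r c) ∷ ♯ (b c) ∷ ♯ (b c ∖ (u ∷ [])) ∷ [])
              ((x₀ ⊕ x₀ ⊕ con 16 ⊑ x₁ ⊕ x₂) ∷ (x₁ ⊑ x₀ ⊕ con 6) ∷ (x₂ ⊑ x₃ ⊕ con 1) ∷ []) (x₀ ⊕ con 9 ⊑ x₃) (1 ∷ 1 ∷ 1 ∷ 1 ∷ []) refl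
              ♯C le (♯-∖ (b c) (u ∷ [])))
      ... | no nle with AllL.all? (λ (_ , y) → U y ≟ᵇ true) live
      -- If every live edge ended in `U`, there would be at most j of them, and the size invariant
      -- with |L| ≤ 3 would give D ≤ 6, although D ≥ l + 7.
      ... | yes all = lin⊥ (l ∷ ♯ (r c) ∷ i ∷ j ∷ ♯ L ∷ length live ∷ ♯ U ∷ length (seconds Mc) ∷ length (seconds live) ∷ [])
            ((x₁ ⊕ (x₂ ⊕ x₃) ⊑ x₄ ⊕ (x₅ ⊕ x₂) ⊕ (x₅ ⊕ x₂)) ∷ (x₅ ⊕ x₂ ⊑ con 3) ∷ (x₀ ⊕ con 9 ⊑ x₁ ⊕ x₃) ∷ (x₄ ⊑ con 3) ∷
             (x₀ ⊕ con 6 ⊏ x₁) ∷ (x₈ ⊑ x₆) ∷ (x₆ ⊑ x₇) ∷ (x₇ ⊑ x₃) ∷ (x₅ ⊑ x₈) ∷ []) (1 ∷ 1 ∷ 0 ∷ 1 ∷ 1 ∷ 1 ∷ 1 ∷ 1 ∷ 1 ∷ []) refl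
            L-size short loose (exactly-three u g Uu Lg e) (≰⇒> nle)
            (unique-≤ U (unique-seconds live unique) (AllP.map⁺ all)) (♯-member (seconds Mc))
            (≤-reflexive (length-map proj₂ Mc)) (≤-reflexive (sym (length-map proj₂ live)))
      ... | no some with find (AllP.¬All⇒Any¬ (λ (_ , y) → U y ≟ᵇ true) live some)
      ... | (x′ , y′) , m′ , n with pick L (g ∷ []) (≤-trans (s≤s (s≤s z≤n)) three)
      ... | h , Lh , h∉ with pick L (g ∷ h ∷ []) three
      -- Both h and h′ are blue to the partner of u and to two vertices of `L`. That exhausts their
      -- blue neighbours in `A′`, so both are red to x′ and y′.
      ... | h′ , Lh′ , h′∉ = AllL.lookup (proj₂ (stuck h h′ Lh Lh′ λ q → h′∉ (there (here (sym q))))) m′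
              (red h x′ Lh (λ q → h∉ (here (sym q))) (first-in-A′ m′) (proj₁ (∈-verts m′)) (proj₁ apart))
              (red h′ y′ Lh′ (λ q → h′∉ (here (sym q))) second-in-A′ (proj₂ (∈-verts m′)) (proj₂ apart))
        where
        module P = Partner (partner u g Uu Lg e)
        apart : (P.x ≢ x′) × (P.x ≢ y′)
        apart = pairs-apart live unique P.pair m′ λ { refl → n Uu }
        second-in-A′ : A′ y′ ≡ true
        second-in-A′ with ∪-elim {A′ y′} (proj₂ (AllL.lookup (Matching.inside M) m′))
        ... | inj₁ a = a
        ... | inj₂ q = ⊥-elim (n q)
        red : ∀ k z → L k ≡ true → g ≢ k → A′ z ≡ true → z ∈ verts live → P.x ≢ z → r k z ≡ true
        red k z Lk g≢ a m ne with colour {k} {z} (λ { refl → L∉ k Lk m })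
        ... | inj₁ red  = red
        ... | inj₂ blue = ⊥-elim (lin⊥ (♯ L ∷ bit ((A′ ∩ b k) P.x) ∷ bit ((A′ ∩ b k) z) ∷ [])
          ((con 3 ⊑ x₀) ∷ (con 1 ⊑ x₁) ∷ (con 1 ⊑ x₂) ∷ (x₀ ⊕ (x₁ ⊕ (x₂ ⊕ con 0)) ⊑ con 4) ∷ []) (1 ∷ 1 ∷ 1 ∷ 1 ∷ []) refl three
          (blue-bit k P.x P.in-A′ (P.blue k Lk g≢)) (blue-bit k z a blue)
          (crowded (P.x ∷ z ∷ []) k ((ne ∷ []) ∷ [] ∷ []) Lk (proj₁ (∈-verts P.pair) ∷ m ∷ [])))

      final : ⊥
      final = L-joined (b c) (λ u Uu _ g Lg e → one-red u g Uu Lg e) (λ _ e → e)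
        (lin (l ∷ ♯ (r c) ∷ ♯ (b c) ∷ []) ((x₀ ⊕ x₀ ⊕ con 16 ⊑ x₁ ⊕ x₂) ∷ (x₁ ⊑ x₀ ⊕ con 7) ∷ []) (x₀ ⊕ con 9 ⊑ x₂) (2 ∷ 2 ∷ 2 ∷ []) refl
          ♯C high)

    impossible : ⊥
    impossible =
      let live , M , short , stuck = complete (4 ∸ (j + i)) initial
            (m+[n∸m]≡n (lin (i ∷ j ∷ []) ((x₀ ⊕ x₁ ⊑ con 3) ∷ []) (x₁ ⊕ x₀ ⊑ con 4) (1 ∷ 1 ∷ []) refl small))
            (lin (l ∷ ♯ (r c) ∷ i ∷ j ∷ []) ((x₀ ⊕ con 9 ⊑ x₁ ⊕ x₃) ∷ []) (x₀ ⊕ con 8 ⊑ x₁ ⊕ (x₂ ⊕ x₃)) (1 ∷ 1 ∷ []) refl loose)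
      in Final.final live M short stuck

  -- Small orders: at most two vertices surely outside the cover

  module Sparse (c : V) (low : l + 4 ≤ ♯ (r c)) (high : ♯ (r c) ≤ l + 7) (maximal : ∀ x → ♯ (r x) ≤ ♯ (r c))
    (Ma Mc : List (V × V)) (B : Bipartite (r c) (b c) (Ma ++ Mc)) (small : length Ma + length Mc ≤ 3)
    (uncovered : ∀ x y → (r c ∖ firsts Ma) x ≡ true → (b c ∖ seconds Mc) y ≡ true → r x y ≡ false) where

    open Middle c low high maximal Ma Mc B small uncovered

    first-red : ∀ {s} → s ∈ firsts Ma → r c s ≡ true
    first-red m = proj₁ (AllL.lookup (Bipartite.edges B) (∈-++⁺ˡ (proj₂ (∈-firsts Ma m))))

    Q-degree : ∀ x → ♯ Q ≤ ♯ (Q ∩ b x) + ♯ (r c) + 1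
    Q-degree x = lin (♯ Q ∷ ♯ (Q ∩ r x) ∷ ♯ (Q ∩ b x) ∷ ♯ (r x) ∷ ♯ (r c) ∷ [])
      ((x₀ ⊑ x₁ ⊕ x₂ ⊕ con 1) ∷ (x₁ ⊑ x₃) ∷ (x₃ ⊑ x₄) ∷ []) (x₀ ⊑ x₂ ⊕ x₄ ⊕ con 1) (1 ∷ 1 ∷ 1 ∷ 1 ∷ []) refl
      (colour-split Q x) (♯-mono (Q ∩ r x) (r x) λ y e → proj₂ (∧-true {Q y} e)) (maximal x)

    -- s is red to c, so it has at most ♯ (r c) ∸ 1 red neighbours in Q.
    first-degree : ∀ s → r c s ≡ true → ♯ Q + 1 ≤ ♯ (Q ∩ b s) + ♯ (r c)
    first-degree s rcs = lin (♯ Q ∷ ♯ (Q ∩ r s) ∷ ♯ (Q ∩ b s) ∷ ♯ (r s) ∷ ♯ (r c) ∷ [])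
      ((x₀ ⊑ x₁ ⊕ x₂) ∷ (con 1 ⊕ x₁ ⊑ x₃) ∷ (x₃ ⊑ x₄) ∷ []) (x₀ ⊕ con 1 ⊑ x₂ ⊕ x₄) (1 ∷ 1 ∷ 1 ∷ 1 ∷ []) refl
      (colour-split-∉ Q s (Q-out rcs))
      (♯-∷ (r s) (Q ∩ r s) c (r-sym rcs) (¬-not λ e → true≢false (Q⊆ (proj₁ (∧-true e))) (adj-irrefl H c))
        λ y e → proj₂ (∧-true {Q y} e))
      (maximal s)

    -- The rim passes through a₂, y, c, a₁ around the hub x. Since a₁, a₂ and c are joined to all of
    -- `Q`, only the two links beside y are critical. They are chosen before the others, so two
    -- candidates suffice.
    wheel-through : ∀ a₁ a₂ x y → A′ a₁ ≡ true → A′ a₂ ≡ true → a₁ ≢ a₂ → Q x ≡ true → b x y ≡ true →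
                    y ∉ a₁ ∷ a₂ ∷ c ∷ [] → 2 ≤ ♯ (Q ∩ b x ∩ b y) → 5 ≤ ♯ (Q ∩ b x) → ⊥
    wheel-through a₁ a₂ x y e₁ e₂ a₁₂ Qx bxy y∉ two five with ∉-distinct y∉
    ... | ya₁ ∷ ya₂ ∷ yc ∷ [] =
      wheel-pool {x} {a₂} {y} {c} {a₁} (b-sym (joined a₂ x e₂ Qx) ∷ bxy ∷ b-sym (Q⊆ Qx) ∷ b-sym (joined a₁ x e₁ Qx) ∷ [])
        ((ya₂ ∘ sym ∷ a≢c a₂ e₂ ∷ a₁₂ ∘ sym ∷ []) ∷ (yc ∷ ya₁ ∷ []) ∷ (a≢c a₁ e₁ ∘ sym ∷ []) ∷ [] ∷ [])
        R (λ z e → proj₂ (∧-true {Q z} (proj₁ (R-elim e))))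
        (out (Q-out (A′⊆ e₂)) ∷ ¬-not (λ e → proj₂ (R-elim e) (here refl)) ∷ out Qc ∷ out (Q-out (A′⊆ e₁)) ∷ [])
        (≤-trans (s≤s z≤n) (≤-trans two (♯-mono (Q ∩ b x ∩ b y) (R ∩ b a₂ ∩ b y) λ z e →
          true-∧ (into e) (true-∧ (joined a₂ z e₂ (proj₁ (∧-true e))) (by e)))))
        (≤-trans two (♯-mono (Q ∩ b x ∩ b y) (R ∩ b y ∩ b c) λ z e →
          true-∧ (into e) (true-∧ (by e) (Q⊆ (proj₁ (∧-true e))))))
        (≤-trans (s≤s (s≤s (s≤s z≤n))) (≤-trans ♯R (♯-mono R (R ∩ b c ∩ b a₁) λ z e → let q = proj₁ (∧-true (proj₁ (R-elim e))) in
          true-∧ e (true-∧ (Q⊆ q) (joined a₁ z e₁ q)))))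
        (≤-trans ♯R (♯-mono R (R ∩ b a₁ ∩ b a₂) λ z e → let q = proj₁ (∧-true (proj₁ (R-elim e))) in
          true-∧ e (true-∧ (joined a₁ z e₁ q) (joined a₂ z e₂ q))))
      where
      R : Pred N
      R = (Q ∩ b x) ∖ (y ∷ [])
      R-elim : ∀ {z} → R z ≡ true → ((Q ∩ b x) z ≡ true) × (z ∉ y ∷ [])
      R-elim = ∖-elim (Q ∩ b x) (y ∷ [])
      ♯R : 4 ≤ ♯ R
      ♯R = lin (♯ (Q ∩ b x) ∷ ♯ R ∷ []) ((con 5 ⊑ x₀) ∷ (x₀ ⊑ x₁ ⊕ con 1) ∷ []) (con 4 ⊑ x₁) (1 ∷ 1 ∷ 1 ∷ []) refl five (♯-∖ (Q ∩ b x) (y ∷ []))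
      out : ∀ {z} → Q z ≡ false → R z ≡ false
      out f = ¬-not λ e → true≢false (proj₁ (∧-true (proj₁ (R-elim e)))) f
      Qc : Q c ≡ false
      Qc = ¬-not λ q → true≢false (Q⊆ q) (adj-irrefl H c)
      a≢c : ∀ a → A′ a ≡ true → a ≢ c
      a≢c a e refl = true≢false e A′c
      by : ∀ {z} → (Q ∩ b x ∩ b y) z ≡ true → b y z ≡ true
      by {z} e = proj₂ (∧-true {b x z} (proj₂ (∧-true {Q z} e)))
      into : ∀ {z} → (Q ∩ b x ∩ b y) z ≡ true → R z ≡ true
      into {z} e = ∖-intro (Q ∩ b x) (y ∷ []) (true-∧ (proj₁ (∧-true e)) (proj₁ (∧-true {b x z} (proj₂ (∧-true {Q z} e)))))
        λ { (here refl) → b-≢ (by e) refl }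

    -- Here l ≤ 1 and i is 2 or 3. The vertices a₁, a₂, c provide three of four rim vertices. The
    -- fourth is a covering vertex s, or, if s has at most one blue neighbour in `Q` in common with
    -- each of its blue neighbours there, a vertex of `Q`.
    two-left : ♯ (r c) ≡ i + 2 → ⊥
    two-left eq with choose A′ 2 (lin (♯ (r c) ∷ ♯ A′ ∷ i ∷ []) ((x₀ ⊑ x₁ ⊕ x₂) ∷ (x₂ ⊕ con 2 ⊑ x₀) ∷ []) (con 2 ⊑ x₁) (1 ∷ 1 ∷ 1 ∷ []) refl
                       ♯A′ (≤-reflexive (sym eq)))
    ... | a₁ ∷ a₂ ∷ [] , refl , (a₁₂ ∷ []) ∷ _ , e₁ ∷ e₂ ∷ []
      with inhabited (member (firsts Ma)) (lin (l ∷ ♯ (r c) ∷ i ∷ ♯ (member (firsts Ma)) ∷ length (firsts Ma) ∷ [])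
             ((x₀ ⊕ con 4 ⊑ x₁) ∷ (x₁ ⊑ x₂ ⊕ con 2) ∷ (x₂ ⊑ x₄) ∷ (x₄ ⊑ x₃) ∷ []) (con 1 ⊑ x₃) (1 ∷ 1 ∷ 1 ∷ 1 ∷ 1 ∷ []) refl
             low (≤-reflexive eq) (≤-reflexive (sym (length-map proj₁ Ma)))
             (unique-≤ (member (firsts Ma)) (first-unique) (AllL.tabulate (∈-member (firsts Ma)))))
      where
      first-unique : Unique (firsts Ma)
      first-unique = Unique-++ˡ (firsts Ma) (subst Unique (map-++ proj₁ Ma Mc) (Bipartite.unique-firsts B))
    ... | s , ms with inhabited (Q ∩ b s) (lin (l ∷ ♯ (r c) ∷ i ∷ j ∷ ♯ Q ∷ ♯ (Q ∩ b s) ∷ [])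
           ((x₀ ⊕ x₀ ⊕ con 16 ⊑ x₁ ⊕ x₄ ⊕ x₃) ∷ (x₄ ⊕ con 1 ⊑ x₅ ⊕ x₁) ∷ (x₂ ⊕ x₃ ⊑ con 3) ∷ (x₁ ⊑ x₂ ⊕ con 2) ∷ []) (con 1 ⊑ x₅) (1 ∷ 1 ∷ 1 ∷ 2 ∷ 2 ∷ []) refl
           ♯Q≥ (first-degree s (first-red (member-∈ (firsts Ma) ms))) small (≤-reflexive eq))
    ... | x , ex = contradiction
      where
      s∈ : s ∈ firsts Ma
      s∈ = member-∈ (firsts Ma) ms
      ♯Qₗ : l + l + 11 ≤ ♯ Q
      ♯Qₗ = lin (l ∷ ♯ (r c) ∷ i ∷ j ∷ ♯ Q ∷ [])
        ((x₀ ⊕ x₀ ⊕ con 16 ⊑ x₁ ⊕ x₄ ⊕ x₃) ∷ (x₁ ⊑ x₂ ⊕ con 2) ∷ (x₂ ⊕ x₃ ⊑ con 3) ∷ []) (x₀ ⊕ x₀ ⊕ con 11 ⊑ x₄) (1 ∷ 1 ∷ 1 ∷ 1 ∷ []) refl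
        ♯Q≥ (≤-reflexive eq) small
      D≤5 : ♯ (r c) ≤ 5
      D≤5 = lin (♯ (r c) ∷ i ∷ j ∷ []) ((x₀ ⊑ x₁ ⊕ con 2) ∷ (x₁ ⊕ x₂ ⊑ con 3) ∷ []) (x₀ ⊑ con 5) (1 ∷ 1 ∷ 1 ∷ []) refl (≤-reflexive eq) small
      five : ∀ z → 5 ≤ ♯ (Q ∩ b z)
      five z = lin (l ∷ ♯ (r c) ∷ ♯ Q ∷ ♯ (Q ∩ b z) ∷ [])
        ((x₀ ⊕ x₀ ⊕ con 11 ⊑ x₂) ∷ (x₂ ⊑ x₃ ⊕ x₁ ⊕ con 1) ∷ (x₁ ⊑ con 5) ∷ []) (con 5 ⊑ x₃) (1 ∷ 1 ∷ 1 ∷ 1 ∷ []) refl ♯Qₗ (Q-degree z) D≤5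
      s∉ : s ∉ a₁ ∷ a₂ ∷ c ∷ []
      s∉ (here refl)                 = proj₂ (∖-elim (r c) (firsts Ma) e₁) s∈
      s∉ (there (here refl))         = proj₂ (∖-elim (r c) (firsts Ma) e₂) s∈
      s∉ (there (there (here refl))) = r-≢ (first-red s∈) refl
      Q∉ : ∀ {y} → Q y ≡ true → y ∉ a₁ ∷ a₂ ∷ c ∷ []
      Q∉ q (here refl)                 = true≢false q (Q-out (A′⊆ e₁))
      Q∉ q (there (here refl))         = true≢false q (Q-out (A′⊆ e₂))
      Q∉ q (there (there (here refl))) = true≢false (Q⊆ q) (adj-irrefl H c)
      at-most-one : ∀ z → (Q ∩ b s) z ≡ true → ♯ (Q ∩ b z ∩ b s) ≤ 1
      at-most-one z ez with 2 ≤? ♯ (Q ∩ b z ∩ b s)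
      ... | no n = lin (♯ (Q ∩ b z ∩ b s) ∷ []) ((x₀ ⊏ con 2) ∷ []) (x₀ ⊑ con 1) (1 ∷ 1 ∷ []) refl (≰⇒> n)
      ... | yes two = ⊥-elim (wheel-through a₁ a₂ z s e₁ e₂ a₁₂ (proj₁ (∧-true ez)) (b-sym (proj₂ (∧-true {Q z} ez))) s∉ two (five z))
      outer : V → Pred N
      outer z = (Q ∩ b z) ∩ ¬ᵖ b s
      ♯outer : ∀ z → (Q ∩ b s) z ≡ true → ♯ Q ≤ ♯ (outer z) + ♯ (r c) + 2
      ♯outer z ez = lin (♯ Q ∷ ♯ (Q ∩ b z) ∷ ♯ ((Q ∩ b z) ∩ b s) ∷ ♯ (Q ∩ b z ∩ b s) ∷ ♯ (outer z) ∷ ♯ (r c) ∷ [])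
        ((x₀ ⊑ x₁ ⊕ x₅ ⊕ con 1) ∷ (x₁ ⊑ x₂ ⊕ x₄) ∷ (x₂ ⊑ x₃) ∷ (x₃ ⊑ con 1) ∷ []) (x₀ ⊑ x₄ ⊕ x₅ ⊕ con 2) (1 ∷ 1 ∷ 1 ∷ 1 ∷ 1 ∷ []) refl
        (Q-degree z) (♯-split (Q ∩ b z) (b s))
        (♯-mono ((Q ∩ b z) ∩ b s) (Q ∩ b z ∩ b s) λ y e → let q , bs = ∧-true {(Q ∩ b z) y} e ; q′ , bz = ∧-true {Q y} q in
          true-∧ q′ (true-∧ bz bs))
        (at-most-one z ez)
      -- Q ∩ b x and Q ∩ b s overlap, and a common neighbour x′ shares with x most of Q ∖ b s.
      contradiction : ⊥
      contradiction with inhabited (Q ∩ b x ∩ b s) (lin (l ∷ ♯ (r c) ∷ ♯ Q ∷ ♯ (Q ∩ b x) ∷ ♯ (Q ∩ b s) ∷ ♯ ((Q ∩ b x) ∩ (Q ∩ b s)) ∷ ♯ (Q ∩ b x ∩ b s) ∷ [])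
          ((x₂ ⊑ x₃ ⊕ x₁ ⊕ con 1) ∷ (x₂ ⊕ con 1 ⊑ x₄ ⊕ x₁) ∷ (x₃ ⊕ x₄ ⊑ x₂ ⊕ x₅) ∷ (x₅ ⊑ x₆) ∷ (x₀ ⊕ x₀ ⊕ con 11 ⊑ x₂) ∷ (x₁ ⊑ con 5) ∷ [])
          (con 1 ⊑ x₆) (1 ∷ 1 ∷ 1 ∷ 1 ∷ 1 ∷ 1 ∷ 2 ∷ []) refl
          (Q-degree x) (first-degree s (first-red s∈))
          (♯-inter Q (Q ∩ b x) (Q ∩ b s) (λ y e → proj₁ (∧-true e)) (λ y e → proj₁ (∧-true e)))
          (♯-mono ((Q ∩ b x) ∩ (Q ∩ b s)) (Q ∩ b x ∩ b s) λ y e →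
            let q , q′ = ∧-true {(Q ∩ b x) y} e ; k , bx = ∧-true {Q y} q in true-∧ k (true-∧ bx (proj₂ (∧-true {Q y} q′))))
          ♯Qₗ D≤5)
      ... | x′ , ex′ = wheel-through a₁ a₂ x x′ e₁ e₂ a₁₂ (proj₁ (∧-true ex)) bxx′ (Q∉ Qx′)
          -- At most D - 1 vertices of `Q` are outside `b s`, so the two outer sets overlap in at
          -- least 2|Q| - 3D - 3 vertices.
          (lin (l ∷ ♯ (r c) ∷ ♯ Q ∷ ♯ (outer x) ∷ ♯ (outer x′) ∷ ♯ (Q ∩ ¬ᵖ b s) ∷ ♯ (outer x ∩ outer x′) ∷ ♯ (Q ∩ b x ∩ b x′) ∷ ♯ (Q ∩ b s) ∷ [])
            ((x₂ ⊑ x₃ ⊕ x₁ ⊕ con 2) ∷ (x₂ ⊑ x₄ ⊕ x₁ ⊕ con 2) ∷ (x₃ ⊕ x₄ ⊑ x₅ ⊕ x₆) ∷ (x₆ ⊑ x₇) ∷ (x₈ ⊕ x₅ ⊑ x₂) ∷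
             (x₂ ⊕ con 1 ⊑ x₈ ⊕ x₁) ∷ (x₀ ⊕ x₀ ⊕ con 11 ⊑ x₂) ∷ (x₁ ⊑ con 5) ∷ []) (con 2 ⊑ x₇) (1 ∷ 1 ∷ 1 ∷ 1 ∷ 1 ∷ 1 ∷ 1 ∷ 2 ∷ 3 ∷ []) refl
            (♯outer x ex) (♯outer x′ ex″)
            (♯-inter (Q ∩ ¬ᵖ b s) (outer x) (outer x′) sub sub)
            (♯-mono (outer x ∩ outer x′) (Q ∩ b x ∩ b x′) λ y e →
              let o , o′ = ∧-true {outer x y} e ; q , bx = ∧-true {Q y} (proj₁ (∧-true o))
              in true-∧ q (true-∧ bx (proj₂ (∧-true {Q y} (proj₁ (∧-true o′))))))
            (♯-split′ Q (b s)) (first-degree s (first-red s∈)) ♯Qₗ D≤5)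
          (five x)
        where
        Qx′ : Q x′ ≡ true
        Qx′ = proj₁ (∧-true ex′)
        bxx′ : b x x′ ≡ true
        bxx′ = proj₁ (∧-true {b x x′} (proj₂ (∧-true {Q x′} ex′)))
        ex″ : (Q ∩ b s) x′ ≡ true
        ex″ = true-∧ Qx′ (proj₂ (∧-true {b x x′} (proj₂ (∧-true {Q x′} ex′))))
        sub : ∀ {z} y → outer z y ≡ true → (Q ∩ ¬ᵖ b s) y ≡ true
        sub {z} y e = let q , n = ∧-true {(Q ∩ b z) y} e in true-∧ (proj₁ (∧-true q)) n

    -- This forces l = 0, i = 3, j = 0 and D = 4. Two covering vertices s₁, s₂ alternate on the rim
    -- with c and a, which are joined to all of `Q`, so each link serves only one of s₁, s₂. The hub
    -- is a common blue neighbour of s₁ and s₂ in `Q`.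
    one-left : ♯ (r c) ≤ i + 1 → ⊥
    one-left le with inhabited A′ (lin (l ∷ ♯ (r c) ∷ ♯ A′ ∷ i ∷ j ∷ [])
                       ((x₁ ⊑ x₂ ⊕ x₃) ∷ (x₀ ⊕ con 4 ⊑ x₁) ∷ (x₃ ⊕ x₄ ⊑ con 3) ∷ []) (con 1 ⊑ x₂) (1 ∷ 1 ∷ 1 ∷ 1 ∷ []) refl ♯A′ low small)
    ... | a , ea with choose (member (firsts Ma)) 2 (lin (l ∷ ♯ (r c) ∷ i ∷ ♯ (member (firsts Ma)) ∷ length (firsts Ma) ∷ [])
             ((x₀ ⊕ con 4 ⊑ x₁) ∷ (x₁ ⊑ x₂ ⊕ con 1) ∷ (x₂ ⊑ x₄) ∷ (x₄ ⊑ x₃) ∷ []) (con 2 ⊑ x₃) (1 ∷ 1 ∷ 1 ∷ 1 ∷ 1 ∷ []) refl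
             low le (≤-reflexive (sym (length-map proj₁ Ma)))
             (unique-≤ (member (firsts Ma)) first-unique (AllL.tabulate (∈-member (firsts Ma)))))
      where
      first-unique : Unique (firsts Ma)
      first-unique = Unique-++ˡ (firsts Ma) (subst Unique (map-++ proj₁ Ma Mc) (Bipartite.unique-firsts B))
    ... | s₁ ∷ s₂ ∷ [] , refl , (s₁₂ ∷ []) ∷ _ , m₁ ∷ m₂ ∷ []
      with inhabited (Q ∩ b s₁ ∩ b s₂) (lin (l ∷ ♯ (r c) ∷ i ∷ j ∷ ♯ Q ∷ ♯ (Q ∩ b s₁) ∷ ♯ (Q ∩ b s₂) ∷ ♯ ((Q ∩ b s₁) ∩ (Q ∩ b s₂)) ∷ ♯ (Q ∩ b s₁ ∩ b s₂) ∷ [])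
             ((x₀ ⊕ x₀ ⊕ con 16 ⊑ x₁ ⊕ x₄ ⊕ x₃) ∷ (x₄ ⊕ con 1 ⊑ x₅ ⊕ x₁) ∷ (x₄ ⊕ con 1 ⊑ x₆ ⊕ x₁) ∷ (x₅ ⊕ x₆ ⊑ x₄ ⊕ x₇) ∷ (x₇ ⊑ x₈) ∷
              (x₂ ⊕ x₃ ⊑ con 3) ∷ (x₁ ⊑ x₂ ⊕ con 1) ∷ []) (con 1 ⊑ x₈) (1 ∷ 1 ∷ 1 ∷ 1 ∷ 1 ∷ 1 ∷ 3 ∷ 3 ∷ []) refl
             ♯Q≥ (first-degree s₁ (first-red (member-∈ (firsts Ma) m₁))) (first-degree s₂ (first-red (member-∈ (firsts Ma) m₂)))
             (♯-inter Q (Q ∩ b s₁) (Q ∩ b s₂) (λ y e → proj₁ (∧-true e)) (λ y e → proj₁ (∧-true e)))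
             (♯-mono ((Q ∩ b s₁) ∩ (Q ∩ b s₂)) (Q ∩ b s₁ ∩ b s₂) λ y e →
               let q , q′ = ∧-true {(Q ∩ b s₁) y} e ; k , b₁ = ∧-true {Q y} q in true-∧ k (true-∧ b₁ (proj₂ (∧-true {Q y} q′))))
             small le)
    ... | x , ex = wheel-pool {x} {c} {s₁} {a} {s₂}
        (b-sym (Q⊆ Qx) ∷ b-sym (proj₁ bs) ∷ b-sym (joined a x ea Qx) ∷ b-sym (proj₂ bs) ∷ [])
        ((r-≢ (first-red s₁∈) ∷ r-≢ (A′⊆ ea) ∷ r-≢ (first-red s₂∈) ∷ []) ∷
         ((λ { refl → proj₂ (∖-elim (r c) (firsts Ma) ea) s₁∈ }) ∷ s₁₂ ∷ []) ∷
         ((λ { refl → proj₂ (∖-elim (r c) (firsts Ma) ea) s₂∈ }) ∷ []) ∷ [] ∷ [])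
        R (λ y e → proj₂ (∧-true {Q y} e))
        (out Qc ∷ out (Q-out (first-red s₁∈)) ∷ out (Q-out (A′⊆ ea)) ∷ out (Q-out (first-red s₂∈)) ∷ [])
        (≤-trans (s≤s z≤n) (≤-trans (four s₁ s₁∈) (♯-mono (R ∩ b s₁) (R ∩ b c ∩ b s₁) λ y e →
          let ρ , e′ = ∧-true {R y} e in true-∧ ρ (true-∧ (Q⊆ (proj₁ (∧-true ρ))) e′))))
        (≤-trans (s≤s (s≤s z≤n)) (≤-trans (four s₁ s₁∈) (♯-mono (R ∩ b s₁) (R ∩ b s₁ ∩ b a) λ y e →
          let ρ , e′ = ∧-true {R y} e in true-∧ ρ (true-∧ e′ (joined a y ea (proj₁ (∧-true ρ)))))))
        (≤-trans (s≤s (s≤s (s≤s z≤n))) (≤-trans (four s₂ s₂∈) (♯-mono (R ∩ b s₂) (R ∩ b a ∩ b s₂) λ y e →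
          let ρ , e′ = ∧-true {R y} e in true-∧ ρ (true-∧ (joined a y ea (proj₁ (∧-true ρ))) e′))))
        (≤-trans (four s₂ s₂∈) (♯-mono (R ∩ b s₂) (R ∩ b s₂ ∩ b c) λ y e →
          let ρ , e′ = ∧-true {R y} e in true-∧ ρ (true-∧ e′ (Q⊆ (proj₁ (∧-true ρ))))))
      where
      R : Pred N
      R = Q ∩ b x
      Qx : Q x ≡ true
      Qx = proj₁ (∧-true ex)
      bs : (b s₁ x ≡ true) × (b s₂ x ≡ true)
      bs = ∧-true {b s₁ x} (proj₂ (∧-true {Q x} ex))
      s₁∈ : s₁ ∈ firsts Ma
      s₁∈ = member-∈ (firsts Ma) m₁
      s₂∈ : s₂ ∈ firsts Ma
      s₂∈ = member-∈ (firsts Ma) m₂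
      Qc : Q c ≡ false
      Qc = ¬-not λ q → true≢false (Q⊆ q) (adj-irrefl H c)
      out : ∀ {z} → Q z ≡ false → R z ≡ false
      out {z} f = cong (_∧ b x z) f
      four : ∀ s → s ∈ firsts Ma → 4 ≤ ♯ (R ∩ b s)
      four s m = lin (l ∷ ♯ (r c) ∷ i ∷ j ∷ ♯ Q ∷ ♯ R ∷ ♯ (Q ∩ b s) ∷ ♯ (R ∩ (Q ∩ b s)) ∷ ♯ (R ∩ b s) ∷ [])
        ((x₀ ⊕ x₀ ⊕ con 16 ⊑ x₁ ⊕ x₄ ⊕ x₃) ∷ (x₄ ⊑ x₅ ⊕ x₁ ⊕ con 1) ∷ (x₄ ⊕ con 1 ⊑ x₆ ⊕ x₁) ∷ (x₅ ⊕ x₆ ⊑ x₄ ⊕ x₇) ∷ (x₇ ⊑ x₈) ∷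
         (x₂ ⊕ x₃ ⊑ con 3) ∷ (x₁ ⊑ x₂ ⊕ con 1) ∷ []) (con 4 ⊑ x₈) (1 ∷ 1 ∷ 1 ∷ 1 ∷ 1 ∷ 1 ∷ 3 ∷ 3 ∷ []) refl
        ♯Q≥ (Q-degree x) (first-degree s (first-red m))
        (♯-inter Q R (Q ∩ b s) (λ y e → proj₁ (∧-true e)) (λ y e → proj₁ (∧-true e)))
        (♯-mono (R ∩ (Q ∩ b s)) (R ∩ b s) λ y e → let ρ , e′ = ∧-true {R y} e in true-∧ ρ (proj₂ (∧-true {Q y} e′)))
        small le

  middle-degree : ∀ c → l + 4 ≤ ♯ (r c) → ♯ (r c) ≤ l + 7 → (∀ x → ♯ (r x) ≤ ♯ (r c)) → ⊥
  middle-degree c low high maximal with Centre.cover c (r c) (b c) (λ _ e → e) (λ _ → b⇒¬r) (adj-irrefl H c) low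
  ... | Ma , Mc , B , small , uncovered with ♯ (r c) ≤? length Ma + 1
  ... | yes le = Sparse.one-left c low high maximal Ma Mc B small uncovered le
  ... | no n₁ with ♯ (r c) ≤? length Ma + 2
  ... | yes le = Sparse.two-left c low high maximal Ma Mc B small uncovered
          (≤-antisym le (lin (♯ (r c) ∷ length Ma ∷ []) ((x₁ ⊕ con 1 ⊏ x₀) ∷ []) (x₁ ⊕ con 2 ⊑ x₀) (1 ∷ 1 ∷ []) refl (≰⇒> n₁)))
  ... | no n₂ with ♯ (r c) + length Mc ≤? l + 7
  ... | yes le = Middle.few-seconds c low high maximal Ma Mc B small uncovered three le
    where
    open Middle c low high maximal Ma Mc B small uncovered
    three : 3 ≤ ♯ A′
    three = lin (♯ (r c) ∷ length Ma ∷ ♯ A′ ∷ []) ((x₁ ⊕ con 2 ⊏ x₀) ∷ (x₀ ⊑ x₂ ⊕ x₁) ∷ []) (con 3 ⊑ x₂) (1 ∷ 1 ∷ 1 ∷ []) refl (≰⇒> n₂) ♯A′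
  ... | no n₃ with ♯ (r c) + length Mc ≤? l + 8
  ... | yes le = Middle.Tight.impossible c low high maximal Ma Mc B small uncovered three
          (≤-antisym le (lin (♯ (r c) + length Mc ∷ l ∷ []) ((x₁ ⊕ con 7 ⊏ x₀) ∷ []) (x₁ ⊕ con 8 ⊑ x₀) (1 ∷ 1 ∷ []) refl (≰⇒> n₃)))
    where
    open Middle c low high maximal Ma Mc B small uncovered
    three : 3 ≤ ♯ A′
    three = lin (♯ (r c) ∷ length Ma ∷ ♯ A′ ∷ []) ((x₁ ⊕ con 2 ⊏ x₀) ∷ (x₀ ⊑ x₂ ⊕ x₁) ∷ []) (con 3 ⊑ x₂) (1 ∷ 1 ∷ 1 ∷ []) refl (≰⇒> n₂) ♯A′
  ... | no n₄ = Loose.impossible c low high maximal Ma Mc B small uncovered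
          (lin (♯ (r c) + length Mc ∷ l ∷ []) ((x₁ ⊕ con 8 ⊏ x₀) ∷ []) (x₁ ⊕ con 9 ⊑ x₀) (1 ∷ 1 ∷ []) refl (≰⇒> n₄))

  -- R(C₄, K₃) ≤ 7, in the colours good and bad.
  module Ramsey (S : Pred N) (good bad : V → Pred N)
    (good-sym : ∀ {x y} → good x y ≡ true → good y x ≡ true) (bad-sym : ∀ {x y} → bad x y ≡ true → bad y x ≡ true)
    (good-≢ : ∀ {x y} → good x y ≡ true → x ≢ y) (bad-≢ : ∀ {x y} → bad x y ≡ true → x ≢ y)
    (either : ∀ {x y} → x ≢ y → (good x y ≡ true) ⊎ (bad x y ≡ true))
    (exclusive : ∀ {x y} → good x y ≡ true → bad x y ≡ true → ⊥)
    (no-C₄ : ∀ w x y z → S w ≡ true → S x ≡ true → S y ≡ true → S z ≡ true → w ≢ y → x ≢ z →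
             good w x ≡ true → good x y ≡ true → good y z ≡ true → good z w ≡ true → ⊥)
    (no-K₃ : ∀ x y z → S x ≡ true → S y ≡ true → S z ≡ true → bad x y ≡ true → bad y z ≡ true → bad x z ≡ true → ⊥)
    where

    split : ∀ (P : Pred N) x → ♯ P ≤ ♯ (P ∩ good x) + ♯ (P ∩ bad x) + 1
    split P x = lin (♯ P ∷ ♯ (P ∖ (x ∷ [])) ∷ ♯ (P ∩ good x) ∷ ♯ (P ∩ bad x) ∷ [])
      ((x₀ ⊑ x₁ ⊕ con 1) ∷ (x₁ ⊑ x₂ ⊕ x₃) ∷ []) (x₀ ⊑ x₂ ⊕ x₃ ⊕ con 1) (1 ∷ 1 ∷ 1 ∷ []) refl
      (♯-∖ P (x ∷ []))
      (♯-cover (P ∖ (x ∷ [])) (P ∩ good x) (P ∩ bad x) λ y e →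
        let p , y∉ = ∖-elim P (x ∷ []) e
        in case either {x} {y} (λ q → y∉ (here (sym q))) of λ where
          (inj₁ g) → inj₁ (true-∧ p g)
          (inj₂ h) → inj₂ (true-∧ p h))

    g h : V → Pred N
    g x = S ∩ good x
    h x = S ∩ bad x

    h-good : ∀ x p q → S x ≡ true → h x p ≡ true → h x q ≡ true → p ≢ q → good p q ≡ true
    h-good x p q Sx ep eq p≢q with either p≢q | ∧-true {S p} ep | ∧-true {S q} eq
    ... | inj₁ e | _       | _       = e
    ... | inj₂ e | Sp , bp | Sq , bq = ⊥-elim (no-K₃ x p q Sx Sp Sq bp e bq)

    -- The bad neighbours of x are pairwise good, and four of them would contain a good C₄.
    h-small : ∀ x → S x ≡ true → ♯ (h x) ≤ 3
    h-small x Sx with 4 ≤? ♯ (h x)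
    ... | no n = lin (♯ (h x) ∷ []) ((x₀ ⊏ con 4) ∷ []) (x₀ ⊑ con 3) (1 ∷ 1 ∷ []) refl (≰⇒> n)
    ... | yes four with choose (h x) 4 four
    ... | p ∷ q ∷ s ∷ t ∷ [] , refl , (pq ∷ ps ∷ pt ∷ []) ∷ (qs ∷ qt ∷ []) ∷ (st ∷ []) ∷ _ , ep ∷ eq ∷ es ∷ et ∷ [] =
      ⊥-elim (no-C₄ p q s t (proj₁ (∧-true ep)) (proj₁ (∧-true eq)) (proj₁ (∧-true es)) (proj₁ (∧-true et)) ps qt
        (h-good x p q Sx ep eq pq) (h-good x q s Sx eq es qs) (h-good x s t Sx es et st) (h-good x t p Sx et ep (pt ∘ sym)))

    common : ∀ x y p q → S x ≡ true → S y ≡ true → x ≢ y → p ≢ q → g x p ≡ true → g x q ≡ true →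
             good y p ≡ true → good y q ≡ true → ⊥
    common x y p q Sx Sy x≢y p≢q ep eq yp yq with ∧-true {S p} ep | ∧-true {S q} eq
    ... | Sp , xp | Sq , xq = no-C₄ x p y q Sx Sp Sy Sq x≢y p≢q xp (good-sym yp) yq (good-sym xq)

    few-common : ∀ x y → S x ≡ true → S y ≡ true → x ≢ y → ♯ (g x ∩ good y) ≤ 1
    few-common x y Sx Sy x≢y with 2 ≤? ♯ (g x ∩ good y)
    ... | no n = lin (♯ (g x ∩ good y) ∷ []) ((x₀ ⊏ con 2) ∷ []) (x₀ ⊑ con 1) (1 ∷ 1 ∷ []) refl (≰⇒> n)
    ... | yes two with choose (g x ∩ good y) 2 two
    ... | p ∷ q ∷ [] , refl , (pq ∷ []) ∷ _ , ep ∷ eq ∷ [] with ∧-true {g x p} ep | ∧-true {g x q} eq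
    ... | xp , yp | xq , yq = ⊥-elim (common x y p q Sx Sy x≢y pq xp xq yp yq)

    -- Among five good neighbours of x, at most one is good to a given a, so three are bad to a and
    -- hence pairwise good. One of the three then shares the other two with x as good neighbours.
    g-small : ∀ x → S x ≡ true → ♯ (g x) ≤ 4
    g-small x Sx with 5 ≤? ♯ (g x)
    ... | no n = lin (♯ (g x) ∷ []) ((x₀ ⊏ con 5) ∷ []) (x₀ ⊑ con 4) (1 ∷ 1 ∷ []) refl (≰⇒> n)
    ... | yes five with inhabited (g x) (≤-trans (s≤s z≤n) five)
    ... | a , ea with ∧-true {S a} ea
    ... | Sa , xa with choose (g x ∩ bad a) 3 (lin (♯ (g x) ∷ ♯ (g x ∩ good a) ∷ ♯ (g x ∩ bad a) ∷ [])
            ((con 5 ⊑ x₀) ∷ (x₀ ⊑ x₁ ⊕ x₂ ⊕ con 1) ∷ (x₁ ⊑ con 1) ∷ []) (con 3 ⊑ x₂) (1 ∷ 1 ∷ 1 ∷ 1 ∷ []) refl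
            five (split (g x) a) (few-common x a Sx Sa (good-≢ xa)))
    ... | p ∷ q ∷ s ∷ [] , refl , (pq ∷ ps ∷ []) ∷ (qs ∷ []) ∷ _ , ep ∷ eq ∷ es ∷ [] =
      ⊥-elim (common x p q s Sx (proj₁ (∧-true (in-h p ep) )) (good-≢ (proj₂ (∧-true {S p} (proj₁ (∧-true {g x p} ep))))) qs
        (proj₁ (∧-true {g x q} eq)) (proj₁ (∧-true {g x s} es))
        (h-good a p q Sa (in-h p ep) (in-h q eq) pq) (h-good a p s Sa (in-h p ep) (in-h s es) ps))
      where
      in-h : ∀ z → (g x ∩ bad a) z ≡ true → h a z ≡ true
      in-h z e = let gz , bz = ∧-true {g x z} e in true-∧ (proj₁ (∧-true {S z} gz)) bz

    module Seven (seven : ♯ S ≡ 7) where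

      g-large : ∀ x → S x ≡ true → 3 ≤ ♯ (g x)
      g-large x Sx = lin (♯ S ∷ ♯ (g x) ∷ ♯ (h x) ∷ []) ((con 7 ⊑ x₀) ∷ (x₀ ⊑ x₁ ⊕ x₂ ⊕ con 1) ∷ (x₂ ⊑ con 3) ∷ []) (con 3 ⊑ x₁) (1 ∷ 1 ∷ 1 ∷ 1 ∷ []) refl
        (≤-reflexive (sym seven)) (split S x) (h-small x Sx)

      total : ∀ x → S x ≡ true → ♯ (g x) + ♯ (h x) ≤ 6
      total x Sx = lin (♯ S ∷ ♯ (g x) ∷ ♯ (h x) ∷ ♯ (S ∖ (x ∷ [])) ∷ [])
        ((x₀ ⊑ con 7) ∷ (x₁ ⊕ x₂ ⊑ x₃) ∷ (con 1 ⊕ x₃ ⊑ x₀) ∷ []) (x₁ ⊕ x₂ ⊑ con 6) (1 ∷ 1 ∷ 1 ∷ 1 ∷ []) refl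
        (≤-reflexive seven)
        (♯-disjoint (S ∖ (x ∷ [])) (g x) (h x)
          (λ y e → let s , q = ∧-true {S y} e in ∖-intro S (x ∷ []) s λ { (here refl) → good-≢ q refl })
          (λ y e → let s , q = ∧-true {S y} e in ∖-intro S (x ∷ []) s λ { (here refl) → bad-≢ q refl })
          (λ y e e′ → exclusive (proj₂ (∧-true {S y} e)) (proj₂ (∧-true {S y} e′))))
        (♯-∖-unique S ([] ∷ []) (Sx ∷ []))

      neighbours : ∀ x y → ♯ (g y) ≤ ♯ (g x ∩ good y) + ♯ (h x ∩ good y) + 1
      neighbours x y = lin (♯ (g y) ∷ ♯ (g y ∩ good x) ∷ ♯ (g y ∩ bad x) ∷ ♯ (g x ∩ good y) ∷ ♯ (h x ∩ good y) ∷ [])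
        ((x₀ ⊑ x₁ ⊕ x₂ ⊕ con 1) ∷ (x₁ ⊑ x₃) ∷ (x₂ ⊑ x₄) ∷ []) (x₀ ⊑ x₃ ⊕ x₄ ⊕ con 1) (1 ∷ 1 ∷ 1 ∷ 1 ∷ []) refl
        (split (g y) x) (♯-mono (g y ∩ good x) (g x ∩ good y) (exch good)) (♯-mono (g y ∩ bad x) (h x ∩ good y) (exch bad))
        where
        exch : ∀ (k : V → Pred N) z → (g y ∩ k x) z ≡ true → ((S ∩ k x) ∩ good y) z ≡ true
        exch k z e = let gz , kz = ∧-true {g y z} e ; s , q = ∧-true {S z} gz in true-∧ (true-∧ s kz) q

      -- At most two vertices are bad to x. A bad neighbour p finds at most one good neighbour among
      -- them and at most one in `g x`, but needs three.
      four-three : ∀ x → S x ≡ true → 4 ≤ ♯ (g x) → ⊥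
      four-three x Sx four with inhabited (h x) (lin (♯ S ∷ ♯ (g x) ∷ ♯ (h x) ∷ [])
             ((con 7 ⊑ x₀) ∷ (x₀ ⊑ x₁ ⊕ x₂ ⊕ con 1) ∷ (x₁ ⊑ con 4) ∷ []) (con 1 ⊑ x₂) (1 ∷ 1 ∷ 1 ∷ 1 ∷ []) refl
             (≤-reflexive (sym seven)) (split S x) (g-small x Sx))
      ... | p , ep with ∧-true {S p} ep
      ... | Sp , xp = lin⊥ (♯ (g x) ∷ ♯ (h x) ∷ ♯ (g p) ∷ ♯ (g p ∩ good x) ∷ ♯ (g p ∩ bad x) ∷ ♯ (g x ∩ good p) ∷ ♯ (h x ∩ good p) ∷ [])
          ((con 4 ⊑ x₀) ∷ (x₀ ⊕ x₁ ⊑ con 6) ∷ (con 3 ⊑ x₂) ∷ (x₂ ⊑ x₅ ⊕ x₆) ∷ (x₅ ⊑ con 1) ∷ (con 1 ⊕ x₆ ⊑ x₁) ∷ []) (1 ∷ 1 ∷ 1 ∷ 1 ∷ 1 ∷ 1 ∷ []) refl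
          four (total x Sx) (g-large p Sp)
          (♯-cover (g p) (g x ∩ good p) (h x ∩ good p) λ z e → let s , q = ∧-true {S z} e in
            case either {x} {z} (λ { refl → exclusive (good-sym q) xp }) of λ where
              (inj₁ k) → inj₁ (true-∧ (true-∧ s k) q)
              (inj₂ k) → inj₂ (true-∧ (true-∧ s k) q))
          (few-common x p Sx Sp (bad-≢ xp))
          (♯-∷ (h x) (h x ∩ good p) p ep (¬-not λ e → good-≢ (proj₂ (∧-true {h x p} e)) refl) (λ y e → proj₁ (∧-true e)))

      -- Every vertex of g x has a good neighbour in g x, but these form a matching on three vertices.
      impossible : ⊥
      impossible with inhabited S (lin (♯ S ∷ []) ((con 7 ⊑ x₀) ∷ []) (con 1 ⊑ x₀) (1 ∷ 1 ∷ []) refl (≤-reflexive (sym seven)))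
      ... | x , Sx with 4 ≤? ♯ (g x)
      ... | yes four = four-three x Sx four
      ... | no three with choose (h x) 3 (lin (♯ S ∷ ♯ (g x) ∷ ♯ (h x) ∷ [])
             ((con 7 ⊑ x₀) ∷ (x₀ ⊑ x₁ ⊕ x₂ ⊕ con 1) ∷ (x₁ ⊏ con 4) ∷ []) (con 3 ⊑ x₂) (1 ∷ 1 ∷ 1 ∷ 1 ∷ []) refl
             (≤-reflexive (sym seven)) (split S x) (≰⇒> three))
      ... | p ∷ q ∷ s ∷ [] , refl , (pq ∷ ps ∷ []) ∷ (qs ∷ []) ∷ _ , ep ∷ eq ∷ es ∷ [] = matching
        where
        third : ∀ y z → h x y ≡ true → h x z ≡ true → ∃ λ w → (h x w ≡ true) × (w ≢ y) × (w ≢ z)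
        third y z ey ez with pick (h x) (y ∷ z ∷ [])
          (unique-≤ (h x) ((pq ∷ ps ∷ []) ∷ (qs ∷ []) ∷ [] ∷ []) (ep ∷ eq ∷ es ∷ []))
        ... | w , ew , w∉ = w , ew , (λ k → w∉ (here k)) , λ k → w∉ (there (here k))
        -- The set `h x` is a good triangle, so two good neighbours y, z of a in it close a good C₄
        -- with the third vertex.
        one-h : ∀ a → g x a ≡ true → ♯ (h x ∩ good a) ≤ 1
        one-h a ea with 2 ≤? ♯ (h x ∩ good a)
        ... | no n = lin (♯ (h x ∩ good a) ∷ []) ((x₀ ⊏ con 2) ∷ []) (x₀ ⊑ con 1) (1 ∷ 1 ∷ []) refl (≰⇒> n)
        ... | yes two with choose (h x ∩ good a) 2 two
        ... | y ∷ z ∷ [] , refl , (yz ∷ []) ∷ _ , ey ∷ ez ∷ [] with ∧-true {h x y} ey | ∧-true {h x z} ez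
        ... | hy , ay | hz , az with third y z hy hz
        ... | w , hw , wy , wz = ⊥-elim (no-C₄ y a z w (proj₁ (∧-true hy)) (proj₁ (∧-true ea)) (proj₁ (∧-true hz)) (proj₁ (∧-true hw))
               yz (λ { refl → exclusive (proj₂ (∧-true {S a} ea)) (proj₂ (∧-true {S a} hw)) })
               (good-sym ay) az (h-good x z w Sx hz hw (wz ∘ sym)) (h-good x w y Sx hw hy wy))
        partner : ∀ a → g x a ≡ true → ∃ λ d → (g x d ≡ true) × (good a d ≡ true)
        partner a ea with inhabited (g x ∩ good a) (lin (♯ (g a) ∷ ♯ (g x ∩ good a) ∷ ♯ (h x ∩ good a) ∷ [])
            ((con 3 ⊑ x₀) ∷ (x₀ ⊑ x₁ ⊕ x₂ ⊕ con 1) ∷ (x₂ ⊑ con 1) ∷ []) (con 1 ⊑ x₁) (1 ∷ 1 ∷ 1 ∷ 1 ∷ []) refl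
            (g-large a (proj₁ (∧-true ea))) (neighbours x a) (one-h a ea))
        ... | d , ed = d , ∧-true {g x d} ed
        matching : ⊥
        matching with inhabited (g x) (≤-trans (s≤s z≤n) (g-large x Sx))
        ... | a , ea with partner a ea
        ... | d , ed , ad with pick (g x) (a ∷ d ∷ []) (g-large x Sx)
        ... | f , ef , f∉ with partner f ef
        ... | k , ek , fk with a ≟ k | d ≟ k
        ... | yes refl | _ = common x a d f Sx (proj₁ (∧-true ea)) (good-≢ (proj₂ (∧-true {S a} ea)))
                (λ e → f∉ (there (here (sym e)))) ed ef ad (good-sym fk)
        ... | no _ | yes refl = common x d a f Sx (proj₁ (∧-true ed)) (good-≢ (proj₂ (∧-true {S d} ed)))
                (λ e → f∉ (here (sym e))) ea ef (good-sym ad) (good-sym fk)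
        ... | no ak | no dk = three (unique-≤ (g x)
                ((good-≢ fk ∷ (λ e → f∉ (here e)) ∷ (λ e → f∉ (there (here e))) ∷ []) ∷ ((ak ∘ sym) ∷ (dk ∘ sym) ∷ []) ∷ (good-≢ ad ∷ []) ∷ [] ∷ [])
                (ef ∷ ek ∷ ea ∷ ed ∷ []))

  -- Here z serves as the link between y₁ and y₂ and is not needed for the links at y₃.
  wheel-extra : ∀ {h y₁ y₂ y₃ y₄ z} (let ys = y₁ ∷ y₂ ∷ y₃ ∷ y₄ ∷ []) → All (λ y → b h y ≡ true) ys → Unique ys →
                (R : Pred N) → (∀ x → R x ≡ true → b h x ≡ true) → All (λ y → R y ≡ false) ys →
                R z ≡ true → b y₁ z ≡ true → b y₂ z ≡ true → b y₃ z ≡ false →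
                3 ≤ ♯ (R ∩ b y₂ ∩ b y₃) → 3 ≤ ♯ (R ∩ b y₃ ∩ b y₄) → 3 ≤ ♯ (R ∩ b y₄ ∩ b y₁) → ⊥
  wheel-extra {h} {y₁} {y₂} {y₃} {y₄} {z} hs u R R⊆ out Rz z₁ z₂ z₃ n₂ n₃ n₄ =
    let c₄ , p₄ , q₄ = pick (R ∩ b y₄ ∩ b y₁) (z ∷ []) (≤-trans (s≤s (s≤s z≤n)) n₄)
        c₂ , p₂ , q₂ = pick (R ∩ b y₂ ∩ b y₃) (c₄ ∷ []) (≤-trans (s≤s (s≤s z≤n)) n₂)
        c₃ , p₃ , q₃ = pick (R ∩ b y₃ ∩ b y₄) (c₂ ∷ c₄ ∷ []) n₃
        lnk : ∀ y y′ x → (R ∩ b y ∩ b y′) x ≡ true → Link h (y₁ ∷ y₂ ∷ y₃ ∷ y₄ ∷ []) y y′ x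
        lnk = link (y₁ ∷ y₂ ∷ y₃ ∷ y₄ ∷ []) R R⊆ out
        apart : ∀ x → b y₃ x ≡ true → x ≢ z
        apart x e = λ q → true≢false (subst (λ k → b y₃ k ≡ true) q e) z₃
    in wheel-links hs u (lnk y₁ y₂ z (true-∧ Rz (true-∧ z₁ z₂))) (lnk y₂ y₃ c₂ p₂) (lnk y₃ y₄ c₃ p₃) (lnk y₄ y₁ c₄ p₄)
         (λ { (here q) → apart c₂ (proj₂ (∧-true {b y₂ c₂} (proj₂ (∧-true {R c₂} p₂)))) q })
         (λ { (here q) → apart c₃ (proj₁ (∧-true {b y₃ c₃} (proj₂ (∧-true {R c₃} p₃)))) q ; (there (here q)) → q₃ (here q) })
         (λ { (here q) → q₄ (here q) ; (there (here q)) → q₂ (here (sym q)) ; (there (there (here q))) → q₃ (there (here (sym q))) })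

  -- All red degrees at most n - 6

  ♯-all : ∀ (P Q : Pred N) → ♯ P ≤ ♯ (P ∩ Q) → ∀ x → P x ≡ true → Q x ≡ true
  ♯-all P Q le x p with Q x in eq
  ... | true  = refl
  ... | false = ⊥-elim (lin⊥ (♯ P ∷ ♯ (P ∩ Q) ∷ ♯ (P ∩ ¬ᵖ Q) ∷ [])
        ((x₀ ⊑ x₁) ∷ (x₁ ⊕ x₂ ⊑ x₀) ∷ (con 1 ⊑ x₂) ∷ []) (1 ∷ 1 ∷ 1 ∷ []) refl
        le (♯-split′ P Q) (unique-≤ (P ∩ ¬ᵖ Q) ([] ∷ []) (true-∧ p (cong not eq) ∷ [])))

  module LowDegree (bound : ∀ x → ♯ (r x) ≤ l + 3) (v : V) where

    A O : Pred N
    A = b v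
    O = ¬ᵖ b v

    t : ℕ
    t = ♯ O

    m : V → ℕ
    m x = ♯ (O ∩ ¬ᵖ b x)

    N≤ : l + l + 17 ≤ ♯ (full {N})
    N≤ = ≤-trans (≤-reflexive (sym order≡)) (≤-reflexive (sym (♯-full N)))

    A+t : ♯ A + t ≤ l + l + 17
    A+t = ≤-trans (♯-split′ full A) (≤-trans (≤-reflexive (♯-full N)) (≤-reflexive order≡))

    blue-degree : ∀ x → l + 13 ≤ ♯ (b x)
    blue-degree x = lin (l ∷ ♯ (full {N}) ∷ ♯ (r x) ∷ ♯ (b x) ∷ [])
      ((x₀ ⊕ x₀ ⊕ con 17 ⊑ x₁) ∷ (x₁ ⊑ x₂ ⊕ x₃ ⊕ con 1) ∷ (x₂ ⊑ x₀ ⊕ con 3) ∷ []) (x₀ ⊕ con 13 ⊑ x₃) (2 ∷ 2 ∷ 2 ∷ 2 ∷ []) refl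
      N≤ (colour-split full x) (bound x)

    t≤ : t ≤ l + 4
    t≤ = lin (l ∷ ♯ A ∷ t ∷ []) ((x₁ ⊕ x₂ ⊑ x₀ ⊕ x₀ ⊕ con 17) ∷ (x₀ ⊕ con 13 ⊑ x₁) ∷ []) (x₂ ⊑ x₀ ⊕ con 4) (1 ∷ 1 ∷ 1 ∷ []) refl
      A+t (blue-degree v)

    -- What x does not spend of its blue degree on `O` it has to spend on `A`, so missing many
    -- vertices of `O` is an advantage inside `A`.
    A-degree : ∀ x → l + 13 + m x ≤ ♯ (A ∩ b x) + t
    A-degree x = lin (l ∷ ♯ (b x) ∷ ♯ (A ∩ b x) ∷ ♯ (O ∩ b x) ∷ m x ∷ t ∷ [])
      ((x₀ ⊕ con 13 ⊑ x₁) ∷ (x₁ ⊑ x₂ ⊕ x₃) ∷ (x₃ ⊕ x₄ ⊑ x₅) ∷ []) (x₀ ⊕ con 13 ⊕ x₄ ⊑ x₂ ⊕ x₅) (1 ∷ 1 ∷ 1 ∷ 1 ∷ []) refl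
      (blue-degree x)
      (♯-cover (b x) (A ∩ b x) (O ∩ b x) λ y e → case bool-cases (A y) of λ where
        (inj₁ a) → inj₁ (true-∧ a e)
        (inj₂ a) → inj₂ (true-∧ (cong not a) e))
      (♯-split′ O (b x))

    -- Two low vertices and a low hub miss at most t ∸ 3 vertices of O together, which leaves three links between the two in O.
    low? : ∀ x → Dec ((4 ≤ t) × (3 * m x + 3 ≤ t))
    low? x = (4 ≤? t) ×-dec (3 * m x + 3 ≤? t)

    Low High : Pred N
    Low  = A ∩ (λ x → ⌊ low? x ⌋)
    High = A ∩ ¬ᵖ (λ x → ⌊ low? x ⌋)

    high-elim : ∀ x → High x ≡ true → (t ≤ 3) ⊎ (t ≤ 3 * m x + 2)
    high-elim x e with 4 ≤? t | 3 * m x + 3 ≤? t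
    ... | no n  | _     = inj₁ (lin (t ∷ []) ((x₀ ⊏ con 4) ∷ []) (x₀ ⊑ con 3) (1 ∷ 1 ∷ []) refl (≰⇒> n))
    ... | yes _ | no n  = inj₂ (lin (t ∷ m x ∷ []) ((x₀ ⊏ 3 ⊛ x₁ ⊕ con 3) ∷ []) (x₀ ⊑ 3 ⊛ x₁ ⊕ con 2) (1 ∷ 1 ∷ []) refl (≰⇒> n))
    ... | yes p | yes q = ⊥-elim (true≢false (proj₂ (∧-true {A x} e)) refl)

    shared : V → V → ℕ
    shared x y = ♯ (A ∩ b x ∩ b y)

    shared-sym : ∀ x y → shared x y ≤ shared y x
    shared-sym x y = ♯-mono (A ∩ b x ∩ b y) (A ∩ b y ∩ b x) λ z e →
      let a , e′ = ∧-true {A z} e ; bx , by = ∧-true {b x z} e′ in true-∧ a (true-∧ by bx)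

    -- Six is four links plus the two remaining rim vertices, which may be among the common
    -- neighbours and have to be discarded.
    good? : ∀ x y → Dec ((x ≢ y) × (6 ≤ shared x y))
    good? x y = ¬? (x ≟ y) ×-dec (6 ≤? shared x y)

    bad? : ∀ x y → Dec ((x ≢ y) × ¬ (6 ≤ shared x y))
    bad? x y = ¬? (x ≟ y) ×-dec ¬? (6 ≤? shared x y)

    no-good-C₄ : ∀ w x y z → A w ≡ true → A x ≡ true → A y ≡ true → A z ≡ true → w ≢ y → x ≢ z →
                 (w ≢ x) × (6 ≤ shared w x) → (x ≢ y) × (6 ≤ shared x y) →
                 (y ≢ z) × (6 ≤ shared y z) → (z ≢ w) × (6 ≤ shared z w) → ⊥
    no-good-C₄ w x y z Aw Ax Ay Az wy xz (wx , g₁) (xy , g₂) (yz , g₃) (zw , g₄) =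
      wheel-greedy {v} {w} {x} {y} {z} (Aw ∷ Ax ∷ Ay ∷ Az ∷ []) ((wx ∷ wy ∷ (zw ∘ sym) ∷ []) ∷ (xy ∷ xz ∷ []) ∷ (yz ∷ []) ∷ [] ∷ [])
        (Shared w x y z) (Shared x y z w) (Shared y z w x) (Shared z w x y)
        (λ s e → let a , p , q , n₁ , n₂ = Shared-elim w x y z s e in a , p , q ,
          λ { (here refl) → b-≢ p refl ; (there (here refl)) → b-≢ q refl ; (there (there (here k))) → n₁ k ; (there (there (there (here k)))) → n₂ k })
        (λ s e → let a , p , q , n₁ , n₂ = Shared-elim x y z w s e in a , p , q ,
          λ { (here k) → n₂ k ; (there (here refl)) → b-≢ p refl ; (there (there (here refl))) → b-≢ q refl ; (there (there (there (here k)))) → n₁ k })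
        (λ s e → let a , p , q , n₁ , n₂ = Shared-elim y z w x s e in a , p , q ,
          λ { (here k) → n₁ k ; (there (here k)) → n₂ k ; (there (there (here refl))) → b-≢ p refl ; (there (there (there (here refl)))) → b-≢ q refl })
        (λ s e → let a , p , q , n₁ , n₂ = Shared-elim z w x y s e in a , p , q ,
          λ { (here refl) → b-≢ q refl ; (there (here k)) → n₁ k ; (there (there (here k))) → n₂ k ; (there (there (there (here refl)))) → b-≢ p refl })
        (≤-trans (s≤s z≤n) (Shared-size w x y z g₁)) (≤-trans (s≤s (s≤s z≤n)) (Shared-size x y z w g₂))
        (≤-trans (s≤s (s≤s (s≤s z≤n))) (Shared-size y z w x g₃)) (Shared-size z w x y g₄)
      where
      Shared : V → V → V → V → Pred N
      Shared p q p′ q′ = (A ∩ b p ∩ b q) ∖ (p′ ∷ q′ ∷ [])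
      Shared-elim : ∀ p q p′ q′ s → Shared p q p′ q′ s ≡ true → (A s ≡ true) × (b p s ≡ true) × (b q s ≡ true) × (s ≢ p′) × (s ≢ q′)
      Shared-elim p q p′ q′ s e =
        let e′ , n = ∖-elim (A ∩ b p ∩ b q) (p′ ∷ q′ ∷ []) e ; a , e″ = ∧-true {A s} e′ ; bp , bq = ∧-true {b p s} e″
        in a , bp , bq , (λ k → n (here k)) , λ k → n (there (here k))
      Shared-size : ∀ p q p′ q′ → 6 ≤ shared p q → 4 ≤ ♯ (Shared p q p′ q′)
      Shared-size p q p′ q′ six = lin (shared p q ∷ ♯ (Shared p q p′ q′) ∷ []) ((con 6 ⊑ x₀) ∷ (x₀ ⊑ x₁ ⊕ con 2) ∷ []) (con 4 ⊑ x₁) (1 ∷ 1 ∷ 1 ∷ []) refl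
        six (♯-∖ (A ∩ b p ∩ b q) (p′ ∷ q′ ∷ []))

    -- Bonferroni's inequality for three subsets of `A`.
    three-sum : ∀ x y z → ♯ (A ∩ b x) + ♯ (A ∩ b y) + ♯ (A ∩ b z) ≤ ♯ A + shared x y + shared y z + shared x z
    three-sum x y z = lin (♯ (A ∩ b x) ∷ ♯ (A ∩ b y) ∷ ♯ (A ∩ b z) ∷ ♯ A ∷ shared x y ∷ shared y z ∷ shared x z ∷
                           ♯ X∪Y ∷ ♯ ((A ∩ b x) ∩ (A ∩ b y)) ∷ ♯ (X∪Y ∩ (A ∩ b z)) ∷ [])
      ((x₀ ⊕ x₁ ⊑ x₇ ⊕ x₈) ∷ (x₇ ⊕ x₂ ⊑ x₃ ⊕ x₉) ∷ (x₈ ⊑ x₄) ∷ (x₉ ⊑ x₅ ⊕ x₆) ∷ []) (x₀ ⊕ x₁ ⊕ x₂ ⊑ x₃ ⊕ x₄ ⊕ x₅ ⊕ x₆) (1 ∷ 1 ∷ 1 ∷ 1 ∷ 1 ∷ []) refl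
      (♯-inter X∪Y (A ∩ b x) (A ∩ b y) (λ _ → ∪-left) (λ s → ∪-right {(A ∩ b x) s}))
      (♯-inter A X∪Y (A ∩ b z) (λ s e → case ∪-elim {(A ∩ b x) s} e of λ where
         (inj₁ k) → proj₁ (∧-true k)
         (inj₂ k) → proj₁ (∧-true k)) (λ s e → proj₁ (∧-true e)))
      (♯-mono ((A ∩ b x) ∩ (A ∩ b y)) (A ∩ b x ∩ b y) (meet x y))
      (♯-cover (X∪Y ∩ (A ∩ b z)) (A ∩ b y ∩ b z) (A ∩ b x ∩ b z) λ s e →
        let k , e′ = ∧-true {X∪Y s} e in case ∪-elim {(A ∩ b x) s} k of λ where
          (inj₁ kx) → inj₂ (meet x z s (true-∧ kx e′))
          (inj₂ ky) → inj₁ (meet y z s (true-∧ ky e′)))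
      where
      X∪Y : Pred N
      X∪Y = (A ∩ b x) ∪ (A ∩ b y)
      meet : ∀ p q s → ((A ∩ b p) ∩ (A ∩ b q)) s ≡ true → (A ∩ b p ∩ b q) s ≡ true
      meet p q s e = let ep , eq = ∧-true {(A ∩ b p) s} e ; a , bp = ∧-true {A s} ep in true-∧ a (true-∧ bp (proj₂ (∧-true {A s} eq)))

    bad-sum : ∀ x y z → ¬ (6 ≤ shared x y) → ¬ (6 ≤ shared y z) → ¬ (6 ≤ shared x z) →
              3 * l + 39 + (m x + m y + m z) ≤ ♯ A + 15 + 3 * t
    bad-sum x y z xy yz xz = lin (l ∷ m x + m y + m z ∷ ♯ (A ∩ b x) + ♯ (A ∩ b y) + ♯ (A ∩ b z) ∷ t ∷ ♯ A ∷ shared x y ∷ shared y z ∷ shared x z ∷ [])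
      ((3 ⊛ x₀ ⊕ con 39 ⊕ x₁ ⊑ x₂ ⊕ 3 ⊛ x₃) ∷ (x₂ ⊑ x₄ ⊕ x₅ ⊕ x₆ ⊕ x₇) ∷ (x₅ ⊏ con 6) ∷ (x₆ ⊏ con 6) ∷ (x₇ ⊏ con 6) ∷ [])
      (3 ⊛ x₀ ⊕ con 39 ⊕ x₁ ⊑ x₄ ⊕ con 15 ⊕ 3 ⊛ x₃) (1 ∷ 1 ∷ 1 ∷ 1 ∷ 1 ∷ 1 ∷ []) refl
      (lin (l ∷ m x ∷ m y ∷ m z ∷ ♯ (A ∩ b x) ∷ ♯ (A ∩ b y) ∷ ♯ (A ∩ b z) ∷ t ∷ [])
        ((x₀ ⊕ con 13 ⊕ x₁ ⊑ x₄ ⊕ x₇) ∷ (x₀ ⊕ con 13 ⊕ x₂ ⊑ x₅ ⊕ x₇) ∷ (x₀ ⊕ con 13 ⊕ x₃ ⊑ x₆ ⊕ x₇) ∷ [])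
        (3 ⊛ x₀ ⊕ con 39 ⊕ (x₁ ⊕ x₂ ⊕ x₃) ⊑ x₄ ⊕ x₅ ⊕ x₆ ⊕ 3 ⊛ x₇) (1 ∷ 1 ∷ 1 ∷ 1 ∷ []) refl (A-degree x) (A-degree y) (A-degree z))
      (three-sum x y z) (≰⇒> xy) (≰⇒> yz) (≰⇒> xz)

    -- For t ≥ 4 the three numbers of missed vertices add up to at least t - 2, and `bad-sum` would
    -- give t ≥ l + 5. This just contradicts t ≤ l + 4. For t ≤ 3 the degrees alone are large
    -- enough.
    no-bad-K₃ : ∀ x y z → High x ≡ true → High y ≡ true → High z ≡ true →
                ¬ (6 ≤ shared x y) → ¬ (6 ≤ shared y z) → ¬ (6 ≤ shared x z) → ⊥
    no-bad-K₃ x y z hx hy hz xy yz xz with t ≤? 3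
    ... | yes tiny = lin⊥ (l ∷ t ∷ ♯ A ∷ m x + m y + m z ∷ [])
        ((x₁ ⊑ con 3) ∷ (x₂ ⊕ x₁ ⊑ x₀ ⊕ x₀ ⊕ con 17) ∷ (3 ⊛ x₀ ⊕ con 39 ⊕ x₃ ⊑ x₂ ⊕ con 15 ⊕ 3 ⊛ x₁) ∷ []) (2 ∷ 1 ∷ 1 ∷ []) refl
        tiny A+t (bad-sum x y z xy yz xz)
    ... | no t>3 = lin⊥ (l ∷ t ∷ ♯ A ∷ m x ∷ m y ∷ m z ∷ [])
        ((x₁ ⊑ 3 ⊛ x₃ ⊕ con 2) ∷ (x₁ ⊑ 3 ⊛ x₄ ⊕ con 2) ∷ (x₁ ⊑ 3 ⊛ x₅ ⊕ con 2) ∷ (x₂ ⊕ x₁ ⊑ x₀ ⊕ x₀ ⊕ con 17) ∷ (x₁ ⊑ x₀ ⊕ con 4) ∷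
         (3 ⊛ x₀ ⊕ con 39 ⊕ (x₃ ⊕ x₄ ⊕ x₅) ⊑ x₂ ⊕ con 15 ⊕ 3 ⊛ x₁) ∷ []) (1 ∷ 1 ∷ 1 ∷ 3 ∷ 3 ∷ 3 ∷ []) refl
        (misses x hx) (misses y hy) (misses z hz) A+t t≤ (bad-sum x y z xy yz xz)
      where
      misses : ∀ x → High x ≡ true → t ≤ 3 * m x + 2
      misses x e with high-elim x e
      ... | inj₁ tiny = ⊥-elim (t>3 tiny)
      ... | inj₂ k    = k

    ♯High : ♯ High ≤ 6
    ♯High with 7 ≤? ♯ High
    ... | no n = lin (♯ High ∷ []) ((x₀ ⊏ con 7) ∷ []) (x₀ ⊑ con 6) (1 ∷ 1 ∷ []) refl (≰⇒> n)
    ... | yes le with shrink High 7 le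
    ... | S , seven , S⊆ = ⊥-elim (Ramsey.Seven.impossible S (λ x y → ⌊ good? x y ⌋) (λ x y → ⌊ bad? x y ⌋)
            (λ {x} {y} e → let n , k = yes-true (good? x y) e in true-yes (good? y x) ((n ∘ sym) , ≤-trans k (shared-sym x y)))
            (λ {x} {y} e → let n , k = yes-true (bad? x y) e in true-yes (bad? y x) ((n ∘ sym) , λ q → k (≤-trans q (shared-sym y x))))
            (λ {x} {y} e → proj₁ (yes-true (good? x y) e)) (λ {x} {y} e → proj₁ (yes-true (bad? x y) e))
            (λ {x} {y} n → case 6 ≤? shared x y of λ where
              (yes k) → inj₁ (true-yes (good? x y) (n , k))
              (no k)  → inj₂ (true-yes (bad? x y) (n , k)))
            (λ {x} {y} e e′ → proj₂ (yes-true (bad? x y) e′) (proj₂ (yes-true (good? x y) e)))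
            (λ w x y z Sw Sx Sy Sz wy xz wx xy yz zw → no-good-C₄ w x y z
              (proj₁ (∧-true (S⊆ w Sw))) (proj₁ (∧-true (S⊆ x Sx))) (proj₁ (∧-true (S⊆ y Sy))) (proj₁ (∧-true (S⊆ z Sz))) wy xz
              (yes-true (good? w x) wx) (yes-true (good? x y) xy) (yes-true (good? y z) yz) (yes-true (good? z w) zw))
            (λ x y z Sx Sy Sz xy yz xz → no-bad-K₃ x y z (S⊆ x Sx) (S⊆ y Sy) (S⊆ z Sz)
              (proj₂ (yes-true (bad? x y) xy)) (proj₂ (yes-true (bad? y z) yz)) (proj₂ (yes-true (bad? x z) xz)))
            seven)

    low-elim : ∀ {x} → Low x ≡ true → (A x ≡ true) × (4 ≤ t) × (3 * m x + 3 ≤ t)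
    low-elim {x} e = let a , k = ∧-true {A x} e in a , yes-true (low? x) k

    -- A vertex z there that is joined to two of the y's but not to all of them is used by
    -- wheel-extra; otherwise the vertices joined to two of y₁, y₂, y₃ are joined to all four, and counting gives four of them.
    module LowHub (w : V) (Lw : Low w ≡ true) where

      R : Pred N
      R = O ∩ b w

      ♯R : t ≤ ♯ R + m w
      ♯R = ♯-split O (b w)

      missed : ∀ y → ♯ (R ∩ ¬ᵖ b y) ≤ m y
      missed y = ♯-mono (R ∩ ¬ᵖ b y) (O ∩ ¬ᵖ b y) λ x e → let ρ , n = ∧-true {R x} e in true-∧ (proj₁ (∧-true ρ)) n

      three-links : ∀ y y′ → Low y ≡ true → Low y′ ≡ true → 3 ≤ ♯ (R ∩ b y ∩ b y′)
      three-links y y′ ly ly′ = lin (t ∷ ♯ R ∷ m w ∷ m y ∷ m y′ ∷ ♯ (R ∩ b y) ∷ ♯ (R ∩ ¬ᵖ b y) ∷ ♯ (R ∩ b y ∩ b y′) ∷ ♯ (R ∩ ¬ᵖ b y′) ∷ [])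
        ((x₀ ⊑ x₁ ⊕ x₂) ∷ (3 ⊛ x₂ ⊕ con 3 ⊑ x₀) ∷ (3 ⊛ x₃ ⊕ con 3 ⊑ x₀) ∷ (3 ⊛ x₄ ⊕ con 3 ⊑ x₀) ∷
         (x₁ ⊑ x₅ ⊕ x₆) ∷ (x₆ ⊑ x₃) ∷ (x₅ ⊑ x₇ ⊕ x₈) ∷ (x₈ ⊑ x₄) ∷ []) (con 3 ⊑ x₇) (3 ∷ 3 ∷ 1 ∷ 1 ∷ 1 ∷ 3 ∷ 3 ∷ 3 ∷ 3 ∷ []) refl
        ♯R (proj₂ (proj₂ (low-elim Lw))) (proj₂ (proj₂ (low-elim ly))) (proj₂ (proj₂ (low-elim ly′)))
        (♯-split R (b y)) (missed y)
        (♯-cover (R ∩ b y) (R ∩ b y ∩ b y′) (R ∩ ¬ᵖ b y′) λ x e → let ρ , k = ∧-true {R x} e in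
          case bool-cases (b y′ x) of λ where
            (inj₁ q) → inj₁ (true-∧ ρ (true-∧ k q))
            (inj₂ q) → inj₂ (true-∧ ρ (cong not q)))
        (missed y′)

      R-out : ∀ {y} → Low y ≡ true → R y ≡ false
      R-out {y} e = ¬-not λ k → true≢false (proj₁ (∧-true {O y} k)) (cong not (proj₁ (low-elim e)))

      low-blue : V → Set
      low-blue y = (Low ∩ b w) y ≡ true

      lowᵇ : ∀ {y} → low-blue y → Low y ≡ true
      lowᵇ e = proj₁ (∧-true e)

      blueᵇ : ∀ {y} → low-blue y → b w y ≡ true
      blueᵇ {y} e = proj₂ (∧-true {Low y} e)

      spread : ∀ {y₁ y₂ y₃ y₄} → low-blue y₁ → low-blue y₂ → low-blue y₃ → low-blue y₄ →
               y₁ ≢ y₂ → y₁ ≢ y₃ → y₁ ≢ y₄ → y₂ ≢ y₃ → y₂ ≢ y₄ → y₃ ≢ y₄ →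
               ∀ z → R z ≡ true → b y₁ z ≡ true → b y₂ z ≡ true → b y₃ z ≡ true
      spread {y₁} {y₂} {y₃} {y₄} l₁ l₂ l₃ l₄ n₁₂ n₁₃ n₁₄ n₂₃ n₂₄ n₃₄ z Rz z₁ z₂ with bool-cases (b y₃ z)
      ... | inj₁ e = e
      ... | inj₂ z₃ = ⊥-elim (wheel-extra {w} {y₁} {y₂} {y₃} {y₄} {z} (blueᵇ l₁ ∷ blueᵇ l₂ ∷ blueᵇ l₃ ∷ blueᵇ l₄ ∷ [])
              ((n₁₂ ∷ n₁₃ ∷ n₁₄ ∷ []) ∷ (n₂₃ ∷ n₂₄ ∷ []) ∷ (n₃₄ ∷ []) ∷ [] ∷ [])
              R (λ x e → proj₂ (∧-true {O x} e)) (R-out (lowᵇ l₁) ∷ R-out (lowᵇ l₂) ∷ R-out (lowᵇ l₃) ∷ R-out (lowᵇ l₄) ∷ [])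
              Rz z₁ z₂ z₃ (three-links y₂ y₃ (lowᵇ l₂) (lowᵇ l₃)) (three-links y₃ y₄ (lowᵇ l₃) (lowᵇ l₄)) (three-links y₄ y₁ (lowᵇ l₄) (lowᵇ l₁)))

      four-impossible : ∀ y₁ y₂ y₃ y₄ → Unique (y₁ ∷ y₂ ∷ y₃ ∷ y₄ ∷ []) → All low-blue (y₁ ∷ y₂ ∷ y₃ ∷ y₄ ∷ []) → ⊥
      four-impossible y₁ y₂ y₃ y₄ u@((n₁₂ ∷ n₁₃ ∷ n₁₄ ∷ []) ∷ (n₂₃ ∷ n₂₄ ∷ []) ∷ (n₃₄ ∷ []) ∷ [] ∷ []) (l₁ ∷ l₂ ∷ l₃ ∷ l₄ ∷ [])
        with 4 ≤? ♯ (R ∩ b y₁ ∩ b y₂ ∩ b y₃ ∩ b y₄)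
      ... | yes four = wheel-complete {w} {y₁ ∷ y₂ ∷ y₃ ∷ y₄ ∷ []} refl (blueᵇ l₁ ∷ blueᵇ l₂ ∷ blueᵇ l₃ ∷ blueᵇ l₄ ∷ []) u
          (R ∩ b y₁ ∩ b y₂ ∩ b y₃ ∩ b y₄) (λ x e → proj₂ (∧-true {O x} (proj₁ (∧-true {R x} e)))) all four
        where
        all : ∀ {y} → y ∈ y₁ ∷ y₂ ∷ y₃ ∷ y₄ ∷ [] → ∀ x → (R ∩ b y₁ ∩ b y₂ ∩ b y₃ ∩ b y₄) x ≡ true → b y x ≡ true
        all m x e with ∧-true {R x} e
        ... | _ , e₁ with ∧-true {b y₁ x} e₁
        ... | k₁ , e₂ with ∧-true {b y₂ x} e₂
        ... | k₂ , e₃ with ∧-true {b y₃ x} e₃ | m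
        ... | k₃ , k₄ | here refl = k₁
        ... | k₃ , k₄ | there (here refl) = k₂
        ... | k₃ , k₄ | there (there (here refl)) = k₃
        ... | k₃ , k₄ | there (there (there (here refl))) = k₄
      -- With at most three vertices in `Four`, counting the edges to y₁, y₂, y₃ gives 2|R| ≤ t + 3,
      -- whereas |R| ≥ 2t/3 + 1. Together t ≤ 3, which explains the condition 4 ≤ t in `low?`.
      ... | no few = lin⊥ (t ∷ ♯ R ∷ m w ∷ m y₁ ∷ m y₂ ∷ m y₃ ∷ ♯ (R ∩ b y₁) + ♯ (R ∩ b y₂) + ♯ (R ∩ b y₃) ∷ ♯ Four ∷ [])
          ((x₀ ⊑ x₁ ⊕ x₂) ∷ (con 4 ⊑ x₀) ∷ (3 ⊛ x₂ ⊕ con 3 ⊑ x₀) ∷ (3 ⊛ x₃ ⊕ con 3 ⊑ x₀) ∷ (3 ⊛ x₄ ⊕ con 3 ⊑ x₀) ∷ (3 ⊛ x₅ ⊕ con 3 ⊑ x₀) ∷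
           (3 ⊛ x₁ ⊑ x₆ ⊕ (x₃ ⊕ x₄ ⊕ x₅)) ∷ (x₆ ⊑ x₁ ⊕ 2 ⊛ x₇) ∷ (x₇ ⊏ con 4) ∷ []) (6 ∷ 1 ∷ 2 ∷ 1 ∷ 1 ∷ 1 ∷ 3 ∷ 3 ∷ 6 ∷ []) refl
          ♯R (proj₁ (proj₂ (low-elim Lw))) (proj₂ (proj₂ (low-elim Lw)))
          (proj₂ (proj₂ (low-elim (lowᵇ l₁)))) (proj₂ (proj₂ (low-elim (lowᵇ l₂)))) (proj₂ (proj₂ (low-elim (lowᵇ l₃))))
          each doubled (≰⇒> few)
        where
        Four X∪Y : Pred N
        Four = R ∩ b y₁ ∩ b y₂ ∩ b y₃ ∩ b y₄
        X∪Y = (R ∩ b y₁) ∪ (R ∩ b y₂)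
        each : 3 * ♯ R ≤ ♯ (R ∩ b y₁) + ♯ (R ∩ b y₂) + ♯ (R ∩ b y₃) + (m y₁ + m y₂ + m y₃)
        each = lin (♯ R ∷ ♯ (R ∩ b y₁) ∷ ♯ (R ∩ b y₂) ∷ ♯ (R ∩ b y₃) ∷ m y₁ ∷ m y₂ ∷ m y₃ ∷ ♯ (R ∩ ¬ᵖ b y₁) ∷ ♯ (R ∩ ¬ᵖ b y₂) ∷ ♯ (R ∩ ¬ᵖ b y₃) ∷ [])
          ((x₀ ⊑ x₁ ⊕ x₇) ∷ (x₇ ⊑ x₄) ∷ (x₀ ⊑ x₂ ⊕ x₈) ∷ (x₈ ⊑ x₅) ∷ (x₀ ⊑ x₃ ⊕ x₉) ∷ (x₉ ⊑ x₆) ∷ [])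
          (3 ⊛ x₀ ⊑ x₁ ⊕ x₂ ⊕ x₃ ⊕ (x₄ ⊕ x₅ ⊕ x₆)) (1 ∷ 1 ∷ 1 ∷ 1 ∷ 1 ∷ 1 ∷ 1 ∷ []) refl
          (♯-split R (b y₁)) (missed y₁) (♯-split R (b y₂)) (missed y₂) (♯-split R (b y₃)) (missed y₃)
        pair₁₂ : ∀ z → R z ≡ true → b y₁ z ≡ true → b y₂ z ≡ true → Four z ≡ true
        pair₁₂ z Rz z₁ z₂ = true-∧ Rz (true-∧ z₁ (true-∧ z₂ (true-∧
          (spread l₁ l₂ l₃ l₄ n₁₂ n₁₃ n₁₄ n₂₃ n₂₄ n₃₄ z Rz z₁ z₂)
          (spread l₁ l₂ l₄ l₃ n₁₂ n₁₄ n₁₃ n₂₄ n₂₃ (n₃₄ ∘ sym) z Rz z₁ z₂))))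
        pair₁₃ : ∀ z → R z ≡ true → b y₁ z ≡ true → b y₃ z ≡ true → Four z ≡ true
        pair₁₃ z Rz z₁ z₃ = pair₁₂ z Rz z₁ (spread l₁ l₃ l₂ l₄ n₁₃ n₁₂ n₁₄ (n₂₃ ∘ sym) n₃₄ n₂₄ z Rz z₁ z₃)
        pair₂₃ : ∀ z → R z ≡ true → b y₂ z ≡ true → b y₃ z ≡ true → Four z ≡ true
        pair₂₃ z Rz z₂ z₃ = pair₁₂ z Rz (spread l₂ l₃ l₁ l₄ n₂₃ (n₁₂ ∘ sym) n₂₄ (n₁₃ ∘ sym) n₃₄ n₁₄ z Rz z₂ z₃) z₂
        -- A vertex of `R` joined to two of y₁, y₂, y₃ lies in `Four` and is counted at most three
        -- times; every other vertex is counted at most once.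
        doubled : ♯ (R ∩ b y₁) + ♯ (R ∩ b y₂) + ♯ (R ∩ b y₃) ≤ ♯ R + 2 * ♯ Four
        doubled = lin (♯ (R ∩ b y₁) ∷ ♯ (R ∩ b y₂) ∷ ♯ (R ∩ b y₃) ∷ ♯ R ∷ ♯ Four ∷ ♯ X∪Y ∷ ♯ ((R ∩ b y₁) ∩ (R ∩ b y₂)) ∷ ♯ (X∪Y ∩ (R ∩ b y₃)) ∷ [])
          ((x₀ ⊕ x₁ ⊑ x₅ ⊕ x₆) ∷ (x₅ ⊕ x₂ ⊑ x₃ ⊕ x₇) ∷ (x₆ ⊑ x₄) ∷ (x₇ ⊑ x₄) ∷ []) (x₀ ⊕ x₁ ⊕ x₂ ⊑ x₃ ⊕ 2 ⊛ x₄) (2 ∷ 2 ∷ 2 ∷ 2 ∷ 2 ∷ []) refl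
          (♯-inter X∪Y (R ∩ b y₁) (R ∩ b y₂) (λ _ → ∪-left) (λ s → ∪-right {(R ∩ b y₁) s}))
          (♯-inter R X∪Y (R ∩ b y₃) (λ s e → case ∪-elim {(R ∩ b y₁) s} e of λ where
             (inj₁ k) → proj₁ (∧-true k)
             (inj₂ k) → proj₁ (∧-true k)) (λ s e → proj₁ (∧-true e)))
          (♯-mono ((R ∩ b y₁) ∩ (R ∩ b y₂)) Four λ z e →
            let k , k′ = ∧-true {(R ∩ b y₁) z} e ; ρ , z₁ = ∧-true {R z} k in pair₁₂ z ρ z₁ (proj₂ (∧-true {R z} k′)))
          (♯-mono (X∪Y ∩ (R ∩ b y₃)) Four λ z e →
            let k , k′ = ∧-true {X∪Y z} e ; ρ , z₃ = ∧-true {R z} k′ in case ∪-elim {(R ∩ b y₁) z} k of λ where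
              (inj₁ q) → pair₁₃ z ρ (proj₂ (∧-true {R z} q)) z₃
              (inj₂ q) → pair₂₃ z ρ (proj₂ (∧-true {R z} q)) z₃)

      few-low : ♯ (Low ∩ b w) ≤ 3
      few-low with 4 ≤? ♯ (Low ∩ b w)
      ... | no n = lin (♯ (Low ∩ b w) ∷ []) ((x₀ ⊏ con 4) ∷ []) (x₀ ⊑ con 3) (1 ∷ 1 ∷ []) refl (≰⇒> n)
      ... | yes four with choose (Low ∩ b w) 4 four
      ... | y₁ ∷ y₂ ∷ y₃ ∷ y₄ ∷ [] , refl , u , all = ⊥-elim (four-impossible y₁ y₂ y₃ y₄ u all)

      -- By `A-degree` and t ≤ l + 4, the vertex w has at least nine blue neighbours in `A`, of
      -- which at most three are low.
      six-high : 6 ≤ ♯ (High ∩ b w)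
      six-high = lin (l ∷ ♯ (A ∩ b w) ∷ ♯ (Low ∩ b w) ∷ ♯ (High ∩ b w) ∷ t ∷ m w ∷ [])
        ((x₀ ⊕ con 13 ⊕ x₅ ⊑ x₁ ⊕ x₄) ∷ (x₁ ⊑ x₂ ⊕ x₃) ∷ (x₂ ⊑ con 3) ∷ (x₄ ⊑ x₀ ⊕ con 4) ∷ []) (con 6 ⊑ x₃) (1 ∷ 1 ∷ 1 ∷ 1 ∷ 1 ∷ []) refl
        (A-degree w)
        (♯-cover (A ∩ b w) (Low ∩ b w) (High ∩ b w) λ x e → let a , k = ∧-true {A x} e in
          case bool-cases ⌊ low? x ⌋ of λ where
            (inj₁ q) → inj₁ (true-∧ (true-∧ a q) k)
            (inj₂ q) → inj₂ (true-∧ (true-∧ a (cong not q)) k))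
        few-low t≤

      all-high : ∀ x → High x ≡ true → b w x ≡ true
      all-high = ♯-all High (b w) (≤-trans ♯High six-high)

    ♯Low : 7 ≤ ♯ Low
    ♯Low = lin (l ∷ ♯ A ∷ ♯ Low ∷ ♯ High ∷ []) ((x₀ ⊕ con 13 ⊑ x₁) ∷ (x₁ ⊑ x₂ ⊕ x₃) ∷ (x₃ ⊑ con 6) ∷ []) (con 7 ⊑ x₂) (1 ∷ 1 ∷ 1 ∷ 1 ∷ []) refl
      (blue-degree v) (♯-split A (λ x → ⌊ low? x ⌋)) ♯High

    impossible : ⊥
    impossible with inhabited Low (≤-trans (s≤s z≤n) ♯Low)
    ... | w , Lw with choose High 4 (≤-trans (≤-trans (m≤n+m 4 2) (LowHub.six-high w Lw)) (♯-mono (High ∩ b w) High λ x e → proj₁ (∧-true e)))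
    ... | ys , len , u , all = wheel-complete {v} {ys} len (AllL.map (λ {y} e → proj₁ (∧-true {A y} e)) all) u Low
          (λ x e → proj₁ (low-elim e)) (λ {y} k x e → b-sym (LowHub.all-high x e y (AllL.lookup all k)))
          (≤-trans (m≤n+m 4 3) ♯Low)

  contradiction : ⊥
  contradiction with inhabited (full {N}) (lin (N ∷ l ∷ ♯ (full {N}) ∷ []) ((x₁ ⊕ x₁ ⊕ con 17 ⊑ x₀) ∷ (x₀ ⊑ x₂) ∷ []) (con 1 ⊑ x₂) (1 ∷ 1 ∷ 1 ∷ []) refl
         (≤-reflexive (sym order≡)) (≤-reflexive (sym (♯-full N))))
  ... | v , _ with argmax (λ x → ♯ (r x)) v
  ... | c , maximal with l + 4 ≤? ♯ (r c)
  ... | no small = LowDegree.impossible (λ x → ≤-trans (maximal x)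
          (lin (♯ (r c) ∷ l ∷ []) ((x₀ ⊏ x₁ ⊕ con 4) ∷ []) (x₀ ⊑ x₁ ⊕ con 3) (1 ∷ 1 ∷ []) refl (≰⇒> small))) v
  ... | yes low with l + 8 ≤? ♯ (r c)
  ... | yes large = large-degree c large
  ... | no n = middle-degree c low (lin (♯ (r c) ∷ l ∷ []) ((x₀ ⊏ x₁ ⊕ con 8) ∷ []) (x₀ ⊑ x₁ ⊕ con 7) (1 ∷ 1 ∷ []) refl (≰⇒> n)) maximal

-- Two disjoint red cliques

module TwoCliques (s M : ℕ) (M≤ : M ≤ s + s) where

  side : Fin M → Bool
  side v = ⌊ toℕ v <? s ⌋

  joined? : ∀ u v → Dec ((side u ≡ side v) × (u ≢ v))
  joined? u v = (side u ≟ᵇ side v) ×-dec ¬? (u ≟ v)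

  cliques : Graph M
  cliques = record
    { adj        = λ u v → ⌊ joined? u v ⌋
    ; adj-sym    = λ u v → bool-ext (swapped u v) (swapped v u)
    ; adj-irrefl = λ v → ¬-not λ e → proj₂ (yes-true (joined? v v) e) refl
    }
    where
    swapped : ∀ u v → ⌊ joined? u v ⌋ ≡ true → ⌊ joined? v u ⌋ ≡ true
    swapped u v e = let eq , ne = yes-true (joined? u v) e in true-yes (joined? v u) (sym eq , ne ∘ sym)

  -- The index of v within its own clique, which lets a one-sided set be injected into s places.
  position : ∀ v → ∃ λ k → (k < s) × ((side v ≡ true × toℕ v ≡ k) ⊎ (side v ≡ false × toℕ v ≡ s + k))
  position v with toℕ v <? s
  ... | yes p = toℕ v , p , inj₁ (refl , refl)
  ... | no n with m≤n⇒∃[o]m+o≡n (≮⇒≥ n)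
  ... | k , eq = k , lin (s ∷ k ∷ M ∷ toℕ v ∷ []) ((x₃ ⊏ x₂) ∷ (x₂ ⊑ x₀ ⊕ x₀) ∷ (x₀ ⊕ x₁ ⊑ x₃) ∷ []) (x₁ ⊏ x₀) (1 ∷ 1 ∷ 1 ∷ 1 ∷ []) refl
                   (toℕ<n v) M≤ (≤-reflexive eq) , inj₂ (refl , sym eq)

  one-side : ∀ {n} (f : Fin n → Fin M) → Injective _≡_ _≡_ f → (∀ i j → side (f i) ≡ side (f j)) → n ≤ s
  one-side f inj same = injective⇒≤ {f = λ i → fromℕ< (proj₁ (proj₂ (position (f i))))} λ {i} {j} e →
    inj (toℕ-injective (agree (f i) (f j) (same i j) (fromℕ<-injective _ _ _ _ e)))
    where
    agree : ∀ u v → side u ≡ side v → proj₁ (position u) ≡ proj₁ (position v) → toℕ u ≡ toℕ v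
    agree u v eq e with position u | position v
    ... | _ , _ , inj₁ (_ , p) | _ , _ , inj₁ (_ , q) = trans p (trans e (sym q))
    ... | _ , _ , inj₂ (_ , p) | _ , _ , inj₂ (_ , q) = trans p (trans (cong (s +_) e) (sym q))
    ... | _ , _ , inj₁ (a , _) | _ , _ , inj₂ (c , _) = ⊥-elim (true≢false (trans (sym eq) a) c)
    ... | _ , _ , inj₂ (a , _) | _ , _ , inj₁ (c , _) = ⊥-elim (true≢false (trans eq c) a)

  -- The spider is connected, so it would lie on one side, which is one vertex too small.
  no-spider : ∀ l → s ≡ 8 + l → ¬ (SpiderS (9 + l) ⊆ᴳ cliques)
  no-spider l refl (f , inj , hom) = <⇒≱ (n<1+n (8 + l)) (one-side f inj λ i j → trans (centre i) (sym (centre j)))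
    where
    edge : ∀ i j → spiderAdj i j ≡ true → side (f i) ≡ side (f j)
    edge i j e = proj₁ (yes-true (joined? (f i) (f j)) (hom i j e))
    centre : ∀ i → side (f i) ≡ side (f zero)
    centre zero = refl
    centre (suc zero) = edge (suc zero) zero refl
    centre (suc (suc zero)) = edge (suc (suc zero)) zero refl
    centre (suc (suc (suc zero))) = edge (suc (suc (suc zero))) zero refl
    centre (suc (suc (suc (suc zero)))) = edge (suc (suc (suc (suc zero)))) zero refl
    centre (suc (suc (suc (suc (suc zero))))) =
      trans (edge (suc (suc (suc (suc (suc zero))))) (suc zero) refl) (centre (suc zero))
    centre (suc (suc (suc (suc (suc (suc zero)))))) =
      trans (edge (suc (suc (suc (suc (suc (suc zero)))))) (suc (suc zero)) refl) (centre (suc (suc zero)))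
    centre (suc (suc (suc (suc (suc (suc (suc zero))))))) =
      trans (edge (suc (suc (suc (suc (suc (suc (suc zero))))))) (suc (suc (suc zero))) refl) (centre (suc (suc (suc zero))))
    centre (suc (suc (suc (suc (suc (suc (suc (suc zero)))))))) =
      trans (edge (suc (suc (suc (suc (suc (suc (suc (suc zero)))))))) (suc (suc (suc (suc zero)))) refl) (centre (suc (suc (suc (suc zero)))))
    centre (suc (suc (suc (suc (suc (suc (suc (suc (suc i))))))))) = edge (suc (suc (suc (suc (suc (suc (suc (suc (suc i))))))))) zero refl

  crossing : ∀ u v → adj (complement cliques) u v ≡ true → side u ≢ side v
  crossing u v e eq = true≢false e (trans (complement-not cliques u v u≢v) (cong not (true-yes (joined? u v) (eq , u≢v))))
    where
    u≢v : u ≢ v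
    u≢v refl = true≢false e (adj-irrefl (complement cliques) u)

  no-wheel : ¬ (W₈ ⊆ᴳ complement cliques)
  no-wheel (f , _ , hom) = two-colours (side (f zero)) (side (f (suc zero))) (side (f (suc (suc zero))))
    (crossing _ _ (hom zero (suc zero) refl)) (crossing _ _ (hom (suc zero) (suc (suc zero)) refl)) (crossing _ _ (hom zero (suc (suc zero)) refl))
    where
    two-colours : ∀ a b c → a ≢ b → b ≢ c → a ≢ c → ⊥
    two-colours true  true  c     p q r = p refl
    two-colours false false c     p q r = p refl
    two-colours true  false true  p q r = r refl
    two-colours true  false false p q r = q refl
    two-colours false true  true  p q r = q refl
    two-colours false true  false p q r = r refl

theorem22 : (n : ℕ) → 9 ≤ n → RamseyNumberIs (SpiderS n) W₈ (2 * n ∸ 1)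
theorem22 n 9≤n with m≤n⇒∃[o]m+o≡n 9≤n
... | l , refl = arrows , λ M M< arr → case arr (TwoCliques.cliques (8 + l) M (bound M M<)) of λ where
      (inj₁ e) → TwoCliques.no-spider (8 + l) M (bound M M<) l refl e
      (inj₂ e) → TwoCliques.no-wheel (8 + l) M (bound M M<) e
  where
  twice : 2 * (9 + l) ∸ 1 ≡ l + l + 17
  twice = ≤-antisym
    (lin (l ∷ []) [] (con 8 ⊕ x₀ ⊕ (con 9 ⊕ x₀ ⊕ con 0) ⊑ x₀ ⊕ x₀ ⊕ con 17) (1 ∷ []) refl)
    (lin (l ∷ []) [] (x₀ ⊕ x₀ ⊕ con 17 ⊑ con 8 ⊕ x₀ ⊕ (con 9 ⊕ x₀ ⊕ con 0)) (1 ∷ []) refl)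
  bound : ∀ M → M < 2 * (9 + l) ∸ 1 → M ≤ (8 + l) + (8 + l)
  bound M M< = lin (l ∷ M ∷ []) ((x₁ ⊏ con 8 ⊕ x₀ ⊕ (con 9 ⊕ x₀ ⊕ con 0)) ∷ []) (x₁ ⊑ con 8 ⊕ x₀ ⊕ (con 8 ⊕ x₀)) (2 ∷ 2 ∷ []) refl M<
  arrows : Arrows (2 * (9 + l) ∸ 1) (SpiderS (9 + l)) W₈
  arrows F with SpiderS (9 + l) ⊆ᴳ? F | W₈ ⊆ᴳ? complement F
  ... | yes e | _     = inj₁ e
  ... | no _  | yes e = inj₂ e
  ... | no ns | no nw = ⊥-elim (Colours.contradiction F (complement F) (complement-not F) l twice ns nw)
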